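{- Let $a,d\in\mathbb{Z}$ with $ad\neq 0$, and let $f(x)=x^4+ax^3+d$. If $f(x)$ is monogenic, then $\mathrm{Gal}(f)\not\simeq C_2\times C_2$ and $\mathrm{Gal}(f)\not\simeq C_4$.
   Context: A monic polynomial $f(x)\in\mathbb{Z}[x]$ of degree 4 is called monogenic if $f(x)$ is irreducible over $\mathbb{Q}$ and, for $\theta$ with $f(\theta)=0$ and $K=\mathbb{Q}(\theta)$, the set $\{1,\theta,\theta^2,\theta^3\}$ is a $\mathbb{Z}$-basis of the ring of integers $\mathbb{Z}_K$ of $K$ (equivalently, $\mathbb{Z}_K=\mathbb{Z}[\theta]$). $\mathrm{Gal}(f)$ is the Galois group of $f$ over $\mathbb{Q}$, i.e. the Galois group over $\mathbb{Q}$ of the splitting field of $f$. $C_n$ denotes the cyclic group of order $n$. -}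

module Defs where

open import Level using (0ℓ; _⊔_)
open import Algebra.Bundles using (CommutativeRing; Group; RawRing; RawSemiring)
open import Algebra.Apartness.Bundles using (HeytingField)
open import Algebra.Morphism.Structures using (module RingMorphisms; module GroupMorphisms)
import Algebra.Morphism.Construct.Composition as Compose
import Algebra.Morphism.Construct.Identity as Identity
import Algebra.Definitions.RawSemiring as RawSemiringDefinitions
open import Data.Fin.Base using (Fin; toℕ)
open import Data.Integer.Base as ℤ using (ℤ; +_; 0ℤ; 1ℤ)
import Data.Integer.Properties as ℤ
import Data.Integer.Divisibility.Signed as ℤ
open import Data.Integer.Tactic.RingSolver using (solve-∀)
open import Data.List.Base using (List; []; _∷_; map; foldr)
open import Data.List.Relation.Unary.Any using (Any)
open import Data.Nat.Base as ℕ using (ℕ; zero; suc)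
open import Data.Product.Base using (∃-syntax; _×_; _,_; proj₁; proj₂)
open import Data.Rational.Base as ℚ using (ℚ)
open import Function.Base using (_∘_)
open import Function.Bundles using (_⇔_)
open import Relation.Binary.Definitions using (Decidable)
open import Relation.Binary.PropositionalEquality.Core using (_≡_; refl; sym; subst)

fromℤ : ℤ → ℚ
fromℤ i = i ℚ./ 1

-- A polynomial is its list of coefficients, constant term first.  Trailing
-- zeros are allowed, so equality is equality of all coefficients.

module Polynomial {c ℓ} (R : RawRing c ℓ) where
  open RawRing R

  Poly : Set c
  Poly = List Carrier

  coeff : Poly → ℕ → Carrier
  coeff []      _       = 0#
  coeff (a ∷ p) zero    = a
  coeff (a ∷ p) (suc n) = coeff p n

  infix  4 _≈ₚ_
  infixl 6 _+ₚ_
  infixl 7 _*ₚ_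

  _≈ₚ_ : Poly → Poly → Set ℓ
  p ≈ₚ q = ∀ n → coeff p n ≈ coeff q n

  _+ₚ_ : Poly → Poly → Poly
  []      +ₚ q       = q
  (a ∷ p) +ₚ []      = a ∷ p
  (a ∷ p) +ₚ (b ∷ q) = (a + b) ∷ (p +ₚ q)

  _*ₚ_ : Poly → Poly → Poly
  []      *ₚ q = []
  (a ∷ p) *ₚ q = map (a *_) q +ₚ (0# ∷ (p *ₚ q))

  1ₚ : Poly
  1ₚ = 1# ∷ []

  X-_ : Carrier → Poly
  X- a = (- a) ∷ 1# ∷ []

  eval : Poly → Carrier → Carrier
  eval p x = foldr (λ a r → a + x * r) 0# p

  MonicOfDegree : ℕ → Poly → Set ℓ
  MonicOfDegree n p = coeff p n ≈ 1# × (∀ m → n ℕ.< m → coeff p m ≈ 0#)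

  polyRawSemiring : RawSemiring c ℓ
  polyRawSemiring = record
    { Carrier = Poly ; _≈_ = _≈ₚ_ ; _+_ = _+ₚ_ ; _*_ = _*ₚ_ ; 0# = [] ; 1# = 1ₚ }

module ℤ[X] = Polynomial ℤ.+-*-rawRing
module ℚ[X] = Polynomial ℚ.+-*-rawRing

IrreducibleOverℚ : ℤ[X].Poly → Set
IrreducibleOverℚ f =
  RawSemiringDefinitions.Irreducible ℚ[X].polyRawSemiring (map fromℤ f)

-- The ring homomorphism ι makes the field an extension of ℚ.  Decidability of
-- _#_ (hence of _≈_, by tightness) makes this the classical notion of field:
-- every element is zero or invertible.  Number fields satisfy it constructively.

record Extension : Set₁ where
  field
    heytingField : HeytingField 0ℓ 0ℓ 0ℓ

  open HeytingField heytingField public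

  commutativeRing : CommutativeRing 0ℓ 0ℓ
  commutativeRing = record { isCommutativeRing = isCommutativeRing }

  open CommutativeRing commutativeRing public using (rawRing)

  field
    _#?_               : Decidable _#_
    ι                  : ℚ → Carrier
    isRingHomomorphism : RingMorphisms.IsRingHomomorphism ℚ.+-*-rawRing rawRing ι

module _ (E : Extension) where
  open Extension E
  open RawSemiringDefinitions (RawRing.rawSemiring rawRing) using (sum; _^_)
  private module E[X] = Polynomial rawRing

  ιℤ : ℤ → Carrier
  ιℤ = ι ∘ fromℤ

  evalℤ : ℤ[X].Poly → Carrier → Carrier
  evalℤ p = E[X].eval (map ιℤ p)

  -- The smallest subfield ℚ(S) containing ι(ℚ) and S.

  data Generated (S : Carrier → Set) : Carrier → Set where
    base : ∀ q → Generated S (ι q)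
    gen  : ∀ {x} → S x → Generated S x
    add  : ∀ {x y} → Generated S x → Generated S y → Generated S (x + y)
    mul  : ∀ {x y} → Generated S x → Generated S y → Generated S (x * y)
    neg  : ∀ {x} → Generated S x → Generated S (- x)
    inv  : ∀ {x y} → Generated S x → x * y ≈ 1# → Generated S y
    resp : ∀ {x y} → x ≈ y → Generated S x → Generated S y

  IntegralOverℤ : Carrier → Set
  IntegralOverℤ x =
    ∃[ n ] ∃[ p ] ℤ[X].MonicOfDegree n p × evalℤ p x ≈ 0#

  InRingOfIntegersOfℚ⟨_⟩ : Carrier → Carrier → Set
  InRingOfIntegersOfℚ⟨ θ ⟩ x = Generated (_≈ θ) x × IntegralOverℤ x

  ℤ-combination : ∀ {n} → (Fin n → ℤ) → (Fin n → Carrier) → Carrier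
  ℤ-combination c v = sum λ i → ιℤ (c i) * v i

  record IsℤBasis {n} (M : Carrier → Set) (v : Fin n → Carrier) : Set where
    field
      member      : ∀ i → M (v i)
      independent : ∀ c → ℤ-combination c v ≈ 0# → ∀ i → c i ≡ 0ℤ
      spanning    : ∀ x → M x → ∃[ c ] x ≈ ℤ-combination c v

  powers : ∀ n → Carrier → Fin n → Carrier
  powers n θ i = θ ^ toℕ i

  -- Only meant for monic f, whose splitting is f = ∏ (X - αᵢ).

  record IsSplittingField (f : ℤ[X].Poly) : Set where
    field
      roots     : List Carrier
      splits    : map ιℤ f E[X].≈ₚ foldr (λ α p → (E[X].X- α) E[X].*ₚ p) E[X].1ₚ roots
      generated : ∀ x → Generated (λ y → Any (y ≈_) roots) x

  record Automorphism : Set where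
    field
      ⟦_⟧               : Carrier → Carrier
      isRingIsomorphism : RingMorphisms.IsRingIsomorphism rawRing rawRing ⟦_⟧
      fixesℚ            : ∀ q → ⟦ ι q ⟧ ≈ ι q

    open RingMorphisms.IsRingIsomorphism isRingIsomorphism public
      renaming (injective to ⟦⟧-injective)

  Gal : Group 0ℓ 0ℓ
  Gal = record
    { Carrier = Automorphism
    ; _≈_     = λ σ τ → ∀ x → ⟦ σ ⟧ x ≈ ⟦ τ ⟧ x
    ; _∙_     = _∙_
    ; ε       = ε
    ; _⁻¹     = _⁻¹
    ; isGroup = record
      { isMonoid = record
        { isSemigroup = record
          { isMagma = record
            { isEquivalence = record
              { refl  = λ _ → ≈-refl
              ; sym   = λ p x → ≈-sym (p x)
              ; trans = λ p q x → ≈-trans (p x) (q x)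
              }
            ; ∙-cong = λ {σ} {σ′} {τ} {τ′} p q x →
                ≈-trans (⟦⟧-cong σ (q x)) (p (⟦ τ′ ⟧ x))
            }
          ; assoc = λ _ _ _ _ → ≈-refl
          }
        ; identity = (λ _ _ → ≈-refl) , (λ _ _ → ≈-refl)
        }
      ; inverse = inverseˡ , inverseʳ
      ; ⁻¹-cong = λ {σ} {τ} p x → ⟦⟧-injective σ
          (≈-trans (inverseʳ σ x)
            (≈-trans (≈-sym (inverseʳ τ x)) (≈-sym (p (⟦ τ ⁻¹ ⟧ x)))))
      }
    }
    where
    open Automorphism
    open CommutativeRing commutativeRing using ()
      renaming ( refl to ≈-refl; sym to ≈-sym; trans to ≈-trans
               ; +-cong to +-≈; *-cong to *-≈; -‿cong to -‿≈)

    _∙_ : Automorphism → Automorphism → Automorphism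
    σ ∙ τ = record
      { ⟦_⟧               = ⟦ σ ⟧ ∘ ⟦ τ ⟧
      ; isRingIsomorphism = Compose.isRingIsomorphism ≈-trans
          (isRingIsomorphism τ) (isRingIsomorphism σ)
      ; fixesℚ            = λ q → ≈-trans (⟦⟧-cong σ (fixesℚ τ q)) (fixesℚ σ q)
      }

    ε : Automorphism
    ε = record
      { ⟦_⟧               = λ x → x
      ; isRingIsomorphism = Identity.isRingIsomorphism rawRing ≈-refl
      ; fixesℚ            = λ _ → ≈-refl
      }

    module Inverse (σ : Automorphism) where
      σ⁻¹ : Carrier → Carrier
      σ⁻¹ y = proj₁ (surjective σ y)

      σσ⁻¹ : ∀ y → ⟦ σ ⟧ (σ⁻¹ y) ≈ y
      σσ⁻¹ y = proj₂ (surjective σ y) ≈-refl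

      unique : ∀ {x y} → ⟦ σ ⟧ x ≈ y → σ⁻¹ y ≈ x
      unique {x} {y} p = ⟦⟧-injective σ (≈-trans (σσ⁻¹ y) (≈-sym p))

      cong⁻¹ : ∀ {x y} → x ≈ y → σ⁻¹ x ≈ σ⁻¹ y
      cong⁻¹ {x} {y} p = unique (≈-trans (σσ⁻¹ y) (≈-sym p))

    _⁻¹ : Automorphism → Automorphism
    σ ⁻¹ = record
      { ⟦_⟧               = σ⁻¹
      ; isRingIsomorphism = record
        { isRingMonomorphism = record
          { isRingHomomorphism = record
            { isSemiringHomomorphism = record
              { isNearSemiringHomomorphism = record
                { +-isMonoidHomomorphism = record
                  { isMagmaHomomorphism = record
                    { isRelHomomorphism = record { cong = cong⁻¹ }
                    ; homo = λ x y → unique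
                        (≈-trans (+-homo σ _ _) (+-≈ (σσ⁻¹ x) (σσ⁻¹ y)))
                    }
                  ; ε-homo = unique (0#-homo σ)
                  }
                ; *-homo = λ x y → unique
                    (≈-trans (*-homo σ _ _) (*-≈ (σσ⁻¹ x) (σσ⁻¹ y)))
                }
              ; 1#-homo = unique (1#-homo σ)
              }
            ; -‿homo = λ x → unique (≈-trans (-‿homo σ _) (-‿≈ (σσ⁻¹ x)))
            }
          ; injective = λ {x} {y} p →
              ≈-trans (≈-sym (σσ⁻¹ x)) (≈-trans (⟦⟧-cong σ p) (σσ⁻¹ y))
          }
        ; surjective = λ x → ⟦ σ ⟧ x , λ p →
            ≈-trans (cong⁻¹ p) (unique ≈-refl)
        }
      ; fixesℚ            = λ q → unique (fixesℚ σ q)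
      }
      where open Inverse σ

    inverseʳ : ∀ σ x → ⟦ σ ⟧ (⟦ σ ⁻¹ ⟧ x) ≈ x
    inverseʳ σ = Inverse.σσ⁻¹ σ

    inverseˡ : ∀ σ x → ⟦ σ ⁻¹ ⟧ (⟦ σ ⟧ x) ≈ x
    inverseˡ σ x = Inverse.unique σ ≈-refl

-- All roots of an irreducible f are conjugate over ℚ, so it is immaterial that
-- the condition is asked of every root in every extension.

record Monogenic (f : ℤ[X].Poly) : Set₁ where
  field
    monic       : ℤ[X].MonicOfDegree 4 f
    irreducible : IrreducibleOverℚ f
    powerBasis  : ∀ (E : Extension) (θ : Extension.Carrier E) →
                  Extension._≈_ E (evalℤ E f θ) (Extension.0# E) →
                  IsℤBasis E (InRingOfIntegersOfℚ⟨_⟩ E θ) (powers E 4 θ)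

-- The cyclic group of order n, as ℤ with equality taken modulo n.

C : ℕ → Group 0ℓ 0ℓ
C n = record
  { Carrier = ℤ
  ; _≈_     = _≈_
  ; _∙_     = ℤ._+_
  ; ε       = 0ℤ
  ; _⁻¹     = ℤ.-_
  ; isGroup = record
    { isMonoid = record
      { isSemigroup = record
        { isMagma = record
          { isEquivalence = record
            { refl  = λ {x} → reflexive {x} refl
            ; sym   = λ {x} {y} p → subst (+ n ℤ.∣_) (sym-eq x y) (ℤ.∣m⇒∣-m p)
            ; trans = λ {x} {y} {z} p q →
                subst (+ n ℤ.∣_) (trans-eq x y z) (ℤ.∣m∣n⇒∣m+n p q)
            }
          ; ∙-cong = λ {x} {y} {u} {v} p q →
              subst (+ n ℤ.∣_) (+-eq x y u v) (ℤ.∣m∣n⇒∣m+n p q)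
          }
        ; assoc = λ x y z → reflexive (ℤ.+-assoc x y z)
        }
      ; identity = (λ x → reflexive (ℤ.+-identityˡ x)) , (λ x → reflexive (ℤ.+-identityʳ x))
      }
    ; inverse = (λ x → reflexive (ℤ.+-inverseˡ x)) , (λ x → reflexive (ℤ.+-inverseʳ x))
    ; ⁻¹-cong = λ {x} {y} p → subst (+ n ℤ.∣_) (neg-eq x y) (ℤ.∣m⇒∣-m p)
    }
  }
  where
  _≈_ : ℤ → ℤ → Set
  x ≈ y = + n ℤ.∣ x ℤ.- y

  reflexive : ∀ {x y} → x ≡ y → x ≈ y
  reflexive {x} refl = subst (+ n ℤ.∣_) (sym (ℤ.+-inverseʳ x)) (ℤ.divides 0ℤ refl)

  sym-eq : ∀ x y → ℤ.- (x ℤ.- y) ≡ y ℤ.- x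
  sym-eq = solve-∀

  trans-eq : ∀ x y z → (x ℤ.- y) ℤ.+ (y ℤ.- z) ≡ x ℤ.- z
  trans-eq = solve-∀

  +-eq : ∀ x y u v → (x ℤ.- y) ℤ.+ (u ℤ.- v) ≡ (x ℤ.+ u) ℤ.- (y ℤ.+ v)
  +-eq = solve-∀

  neg-eq : ∀ x y → ℤ.- (x ℤ.- y) ≡ ℤ.- x ℤ.- (ℤ.- y)
  neg-eq = solve-∀

infix 4 _≅_

_≅_ : ∀ {a b ℓ₁ ℓ₂} → Group a ℓ₁ → Group b ℓ₂ → Set (a ⊔ b ⊔ ℓ₁ ⊔ ℓ₂)
G ≅ H = ∃[ φ ] GroupMorphisms.IsGroupIsomorphism (Group.rawGroup G) (Group.rawGroup H) φ

x⁴+ax³+d : ℤ → ℤ → ℤ[X].Poly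
x⁴+ax³+d a d = d ∷ 0ℤ ∷ 0ℤ ∷ a ∷ 1ℤ ∷ []

{-# OPTIONS --safe #-}

-- Let f be monogenic with roots θ₀, …, θ₃ and Gal(f) ≃ C₂ × C₂ or C₄.  As Gal(f) is
-- abelian and transitive on the roots, point stabilisers are trivial.  So L = ℚ(θ₀):
-- a root outside ℚ(θ₀) would have a second conjugate over ℚ(θ₀).  Hence integral
-- elements of L fixed by Gal(f), being ℤ-combinations of 1, θ₀, θ₀², θ₀³, lie in ℤ.
-- Suitably numbered, the roots give such an element y = θ₀θ₂ + θ₁θ₃, a root of the
-- resolvent cubic y³ - 4dy = a²d.  With w = (θ₀ - θ₂)(θ₁ - θ₃) and p = θ₀θ₂ - θ₁θ₃ one
-- has w² = W := 16d - 3y² and p² = V := y² - 4d, and w ∈ ℤ for C₂ × C₂, pw ∈ ℤ for C₄.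
-- So W or VW is a square; as W = y² - 4V, both imply W ≥ 0.
--
-- If m² ∣ d for an integer m, then (θ₀³ + aθ₀²) / m is integral, so d is squarefree by
-- monogenicity.  By the resolvent cubic d ∣ y³, hence d ∣ y and then d ∣ a.  Finally
-- d² (256d - 27a⁴) = (3y² - 4d)² W ≥ 0 leaves d ∈ {1, 2} and a = ± d only: here the
-- resolvent cubic has no integer root or W = 20 and V = -4.
--
-- Automorphisms are built by adjoining the roots one by one: an isomorphism of
-- subfields φ(S) ≃ ψ(S) of L, given by two homomorphisms from a ring S, extends to
-- S[X] by X ↦ α and X ↦ β when β is a root of the conjugate of the minimal polynomial
-- of α.  Such polynomials exist only up to double negation, which suffices for ⊥.

module Submission where

open import Defs
open import Algebra.Bundles using (CommutativeRing; Group; RawRing)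
open import Algebra.Construct.DirectProduct using (group)
open import Algebra.Definitions.RawMagma using (module _∣ʳ_)
import Algebra.Apartness.Properties.HeytingCommutativeRing as HeytingProperties
import Algebra.Definitions.RawSemiring as RawSemiringDefinitions
open import Algebra.Morphism.Structures using (module GroupMorphisms; module RingMorphisms)
import Algebra.Properties.Ring as RingProperties
import Algebra.Solver.Ring
open import Algebra.Solver.Ring.AlmostCommutativeRing
  using (_-Raw-AlmostCommutative⟶_; fromCommutativeRing)
open import Data.Empty using (⊥; ⊥-elim)
open import Data.Fin.Base as Fin using (Fin)
open import Data.Integer.Base as ℤ using (ℤ; +_; -[1+_]; 0ℤ; 1ℤ)
import Data.Integer.Divisibility.Signed as ℤ∣
import Data.Integer.Properties as ℤ
open import Data.Integer.Tactic.RingSolver using (solve-∀)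
open import Data.List.Base using (List; []; _∷_; map; foldr; length; applyUpTo; _∷ʳ_)
import Data.List.Properties as List
open import Data.List.Relation.Unary.All as All using (All; []; _∷_)
import Data.List.Relation.Unary.All.Properties as All
open import Data.List.Relation.Unary.AllPairs using (AllPairs; []; _∷_)
import Data.List.Relation.Unary.AllPairs.Properties as AllPairs
open import Data.List.Relation.Unary.Any as Any using (Any)
open import Data.Maybe.Base using (Maybe; just; nothing)
open import Data.Nat.Base as ℕ using (ℕ; zero; suc; z≤n; s≤s; s≤s⁻¹)
import Data.Nat.Coprimality as Coprime
import Data.Nat.Divisibility as ℕ∣
open import Data.Nat.GCD using (gcd[m,n]∣m; gcd[m,n]∣n; gcd-greatest)
open import Data.Nat.Primality using (Prime; euclidsLemma; ¬prime[1])
open import Data.Nat.Primality.Factorisation using (factorise)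
import Data.Nat.Properties as ℕ
import Data.Nat.Tactic.RingSolver as ℕ-Solver
open import Data.Product.Base using (∃-syntax; _×_; _,_; proj₁; proj₂)
open import Data.Rational.Base as ℚ using (ℚ; mkℚ; 0ℚ; 1ℚ)
import Data.Rational.Properties as ℚ
open import Data.Sum.Base as Sum using (_⊎_; inj₁; inj₂; [_,_]′)
open import Function.Base using (_∘_; id)
open import Level using (0ℓ)
open import Relation.Binary.PropositionalEquality as ≡ using (_≡_; _≢_; refl; cong; cong₂)
import Relation.Binary.Reasoning.Setoid as SetoidReasoning
open import Relation.Nullary using (¬_; Dec; yes; no)
open import Relation.Nullary.Decidable using (decidable-stable)

-- Both groups preserve the pairing {θ₀, θ₂}, {θ₁, θ₃} of the roots. It splits f into two
-- quadratics: y is the sum of their constant terms, and w² is the product of their discriminants.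
-- So y is rational in both cases, and one arithmetic argument serves both. The final inequality is
-- strong enough only because a = k d: for d > 0, 27 a⁴ ≤ 256 d then reads 27 k⁴ d³ ≤ 256.
--
-- The field theory is shaped by what can be decided. Equality in L is decidable, but no procedure
-- is at hand for membership in ℚ(θ₀) or for the existence of a shorter polynomial annihilating an
-- element. Hence no dimension is ever computed: the existence of conjugates and the surjectivity of
-- extended maps come from counting roots. Polynomials are lists that may end in zeros, so a length
-- only bounds a degree, and leading coefficients have to be searched for.

-- Squarefree integers and the Diophantine problem for a, d and y

module Arithmetic where
  open import Data.Integer.Base using (∣_∣; _+_; _*_; _-_; -_)
  open import Data.Integer.Divisibility.Signed using (_∣_; divides)
  open import Data.Nat.ListAction using (product)

  prime-divisor : ∀ n → n ≢ 0 → n ≢ 1 → ∃[ p ] Prime p × p ℕ∣.∣ n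
  prime-divisor zero      n≢0 _   = ⊥-elim (n≢0 refl)
  prime-divisor n@(suc _) _   n≢1 with factorise n
  ... | record { factors = [] ; isFactorisation = n≡1 } = ⊥-elim (n≢1 n≡1)
  ... | record { factors = p ∷ ps ; isFactorisation = n≡ ; factorsPrime = p-prime ∷ _ } =
    p , p-prime , ℕ∣.divides (product ps) (≡.trans n≡ (ℕ.*-comm p (product ps)))

  Squarefree : ℤ → Set
  Squarefree d = ∀ p → + p * + p ∣ d → p ≡ 1

  prime-∣-* : ∀ {p} → Prime p → ∀ i j → + p ∣ i * j → (+ p ∣ i) ⊎ (+ p ∣ j)
  prime-∣-* p-prime i j p∣ij = Sum.map ℤ∣.∣ᵤ⇒∣ ℤ∣.∣ᵤ⇒∣
    (euclidsLemma ∣ i ∣ ∣ j ∣ p-prime (≡.subst (_ ℕ∣.∣_) (ℤ.abs-* i j) (ℤ∣.∣⇒∣ᵤ p∣ij)))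

  -- Otherwise d / gcd(d, y) has a prime factor p. It divides d, hence y, hence the gcd as well, so
  -- p² divides d.
  squarefree-∣ : ∀ {d y} → d ≢ 0ℤ → Squarefree d → (∀ p → Prime p → + p ∣ d → + p ∣ y) → d ∣ y
  squarefree-∣ {d} {y} d≢0 d-sqf primes with gcd[m,n]∣m ∣ d ∣ ∣ y ∣
  ... | ℕ∣.divides e d≡eg with e ℕ.≟ 1
  ...   | yes refl = ℤ∣.∣ᵤ⇒∣ (≡.subst (ℕ∣._∣ ∣ y ∣) (≡.sym (≡.trans d≡eg (ℕ.*-identityˡ _)))
      (gcd[m,n]∣n ∣ d ∣ ∣ y ∣))
  ...   | no e≢1 with prime-divisor e (λ { refl → d≢0 (ℤ.∣i∣≡0⇒i≡0 d≡eg) }) e≢1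
  ...     | p , p-prime , p∣e = ⊥-elim (¬prime[1] (≡.subst Prime (d-sqf p (ℤ∣.∣ᵤ⇒∣ pp∣d)) p-prime))
    where
    p∣d : p ℕ∣.∣ ∣ d ∣
    p∣d = ≡.subst (p ℕ∣.∣_) (≡.sym d≡eg) (ℕ∣.∣m⇒∣m*n _ p∣e)
    pp∣d : ∣ + p * + p ∣ ℕ∣.∣ ∣ d ∣
    pp∣d = ≡.subst₂ ℕ∣._∣_ (≡.sym (ℤ.abs-* (+ p) (+ p))) (≡.sym d≡eg)
      (ℕ∣.*-pres-∣ p∣e (gcd-greatest p∣d (ℤ∣.∣⇒∣ᵤ (primes p p-prime (ℤ∣.∣ᵤ⇒∣ p∣d)))))

  squarefree-∣-square : ∀ {d} i → d ≢ 0ℤ → Squarefree d → d ∣ i * i → d ∣ i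
  squarefree-∣-square i d≢0 d-sqf d∣ii = squarefree-∣ d≢0 d-sqf λ p p-prime p∣d →
    [ id , id ]′ (prime-∣-* p-prime i i (ℤ∣.∣-trans p∣d d∣ii))

  squarefree-∣-cube : ∀ {d} i → d ≢ 0ℤ → Squarefree d → d ∣ i * i * i → d ∣ i
  squarefree-∣-cube i d≢0 d-sqf d∣iii = squarefree-∣ d≢0 d-sqf λ p p-prime p∣d →
    [ [ id , id ]′ ∘ prime-∣-* p-prime i i , id ]′ (prime-∣-* p-prime (i * i) i (ℤ∣.∣-trans p∣d d∣iii))

  square≡+ : ∀ i → i * i ≡ + (∣ i ∣ ℕ.* ∣ i ∣)
  square≡+ (+ n)    = ≡.sym (ℤ.pos-* n n)
  square≡+ -[1+ n ] = refl

  -- Here `s` stands for y². If W < 0 and V W ≥ 0, then V ≤ 0, so W = s - 4 V ≥ 0 after all.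
  nonneg-of-product : ∀ V W s n → W ≡ + s - + 4 * V → + n ≡ V * W → ∃[ w ] W ≡ + w
  nonneg-of-product V (+ w) s n _ _ = w , refl
  nonneg-of-product (+ zero)  -[1+ w ] s n W≡ _ = ⊥-elim (neg≢pos (≡.trans W≡ (ℤ.+-identityʳ (+ s))))
    where
    neg≢pos : ∀ {m n} → -[1+ m ] ≢ + n
    neg≢pos ()
  nonneg-of-product (+ suc v) -[1+ w ] s n _ ()
  nonneg-of-product -[1+ v ]  -[1+ w ] s n () _

  -- The hypothesis is 27 (a² d)² ≤ 256 d³ for a = k d. Cancelling d³ leaves 27 k⁴ d³ ≤ 256, for
  -- which already k = 2 or d = 3 is too large.
  bound : ∀ k d → k ≢ 0 → 27 ℕ.* ((k ℕ.* k ℕ.* (d ℕ.* d ℕ.* d)) ℕ.* (k ℕ.* k ℕ.* (d ℕ.* d ℕ.* d))) ℕ.≤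
      256 ℕ.* (d ℕ.* d ℕ.* d) →
          d ≡ 0 ⊎ (k ≡ 1 × (d ≡ 1 ⊎ d ≡ 2))
  bound k zero      _   _ = inj₁ refl
  bound k d@(suc _) k≢0 h = inj₂ (small-k k k≢0 h′ , small-d d h′ λ ())
    where
    D K : ℕ
    D = d ℕ.* d ℕ.* d
    K = k ℕ.* k ℕ.* (k ℕ.* k)
    h′ : 27 ℕ.* (K ℕ.* D) ℕ.≤ 256
    h′ = ℕ.*-cancelʳ-≤ _ _ D (ℕ.≤-trans (ℕ.≤-reflexive (regroup k D)) h)
      where
      regroup : ∀ k D → 27 ℕ.* (k ℕ.* k ℕ.* (k ℕ.* k) ℕ.* D) ℕ.* D ≡ 27 ℕ.*
          ((k ℕ.* k ℕ.* D) ℕ.* (k ℕ.* k ℕ.* D))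
      regroup = ℕ-Solver.solve-∀
    cube-mono : ∀ {m n} → m ℕ.≤ n → m ℕ.* m ℕ.* m ℕ.≤ n ℕ.* n ℕ.* n
    cube-mono m≤n = ℕ.*-mono-≤ (ℕ.*-mono-≤ m≤n m≤n) m≤n
    fourth-mono : ∀ {m n} → m ℕ.≤ n → m ℕ.* m ℕ.* (m ℕ.* m) ℕ.≤ n ℕ.* n ℕ.* (n ℕ.* n)
    fourth-mono m≤n = ℕ.*-mono-≤ (ℕ.*-mono-≤ m≤n m≤n) (ℕ.*-mono-≤ m≤n m≤n)
    exceeds : ∀ a → 257 ℕ.≤ a → ¬ (a ℕ.≤ 256)
    exceeds a l u = ℕ.<-irrefl refl (ℕ.≤-trans l u)
    small-k : ∀ k → k ≢ 0 → 27 ℕ.* (k ℕ.* k ℕ.* (k ℕ.* k) ℕ.* D) ℕ.≤ 256 → k ≡ 1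
    small-k zero            k≢0 _ = ⊥-elim (k≢0 refl)
    small-k (suc zero)      _   _ = refl
    -- The left side is at least 27 · 2⁴ · 1³ = 432 = 175 + 257.
    small-k (suc (suc k)) _   h = ⊥-elim (exceeds _ (ℕ.≤-trans (ℕ.m≤n+m 257 175)
      (ℕ.*-monoʳ-≤ 27 (ℕ.*-mono-≤ (fourth-mono {2} {suc (suc k)} (s≤s (s≤s z≤n)))
          (cube-mono {1} {d} (s≤s z≤n))))) h)
    small-d : ∀ d → 27 ℕ.* (K ℕ.* (d ℕ.* d ℕ.* d)) ℕ.≤ 256 → d ≢ 0 → d ≡ 1 ⊎ d ≡ 2
    small-d zero                _ d≢0 = ⊥-elim (d≢0 refl)
    small-d (suc zero)          _ _   = inj₁ refl
    small-d (suc (suc zero))    _ _   = inj₂ refl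
    -- The left side is at least 27 · 1⁴ · 3³ = 729 = 472 + 257.
    small-d (suc (suc (suc d))) h _   = ⊥-elim (exceeds _ (ℕ.≤-trans (ℕ.m≤n+m 257 472)
      (ℕ.*-monoʳ-≤ 27 (ℕ.*-mono-≤ (fourth-mono {1} {k} (ℕ.n≢0⇒n>0 k≢0))
          (cube-mono {3} {suc (suc (suc d))} (s≤s (s≤s (s≤s z≤n))))))) h)

  ∣1⇒±1 : ∀ z → z ∣ 1ℤ → z ≡ 1ℤ ⊎ z ≡ - 1ℤ
  ∣1⇒±1 z z∣1 with ℕ∣.∣1⇒≡1 (ℤ∣.∣⇒∣ᵤ z∣1)
  ∣1⇒±1 (+ 1)    _ | refl = inj₁ refl
  ∣1⇒±1 -[1+ 0 ] _ | refl = inj₂ refl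

  20-not-square : ∀ w → w ℕ.* w ≢ 20
  20-not-square 0 ()
  20-not-square 1 ()
  20-not-square 2 ()
  20-not-square 3 ()
  20-not-square 4 ()
  20-not-square w@(suc (suc (suc (suc (suc _))))) w²≡20 =
    ℕ.<⇒≢ (ℕ.<-≤-trans (ℕ.m≤m+n 21 4) (ℕ.*-mono-≤ {5} {w} {5} 5≤w 5≤w)) (≡.sym w²≡20)
    where 5≤w = s≤s (s≤s (s≤s (s≤s (s≤s z≤n))))

  -- For the roots θᵢ of f, these are (θ₀θ₂ - θ₁θ₃)² and ((θ₀ - θ₂)(θ₁ - θ₃))² in
  -- terms of y = θ₀θ₂ + θ₁θ₃.
  V W : ℤ → ℤ → ℤ
  V d y = y * y - + 4 * d
  W d y = + 16 * d - + 3 * (y * y)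

  W-nonneg : ∀ d y → (∃[ w ] w * w ≡ W d y) ⊎ (∃[ n ] n * n ≡ V d y * W d y) → ∃[ w ] W d y ≡ + w
  W-nonneg d y (inj₁ (w , ww≡W)) = _ , ≡.trans (≡.sym ww≡W) (square≡+ w)
  W-nonneg d y (inj₂ (n , nn≡VW)) = nonneg-of-product (V d y) (W d y) (∣ y ∣ ℕ.* ∣ y ∣)
      (∣ n ∣ ℕ.* ∣ n ∣)
    (≡.trans (identity d y) (cong (_- + 4 * V d y) (square≡+ y))) (≡.trans (≡.sym (square≡+ n)) nn≡VW)
    where
    identity : ∀ d y → + 16 * d - + 3 * (y * y) ≡ y * y - + 4 * (y * y - + 4 * d)
    identity = solve-∀

  -- For t = a² d this bounds the discriminant d² (256 d - 27 a⁴) of f from below,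
  -- which is (3 y² - 4 d)² W.
  positive-discriminant : ∀ d y t → t ≡ y * y * y - + 4 * d * y → (∃[ w ] W d y ≡ + w) →
    ∃[ n ] + 256 * (d * d * d) ≡ + (27 ℕ.* (∣ t ∣ ℕ.* ∣ t ∣) ℕ.+ n)
  positive-discriminant d y t t≡ (w , W≡w) = s ℕ.* s ℕ.* w , (begin
    + 256 * (d * d * d)                                    ≡⟨ identity d y ⟩
    + 27 * (t′ * t′) + u * u * W d y                       ≡⟨ cong (λ t →
        + 27 * (t * t) + u * u * W d y) t≡ ⟨
    + 27 * (t * t) + u * u * W d y                         ≡⟨ cong₂ (λ a b → + 27 * a + b) (square≡+ t)
        (cong₂ _*_ (square≡+ u) W≡w) ⟩
    + 27 * + (∣ t ∣ ℕ.* ∣ t ∣) + + (s ℕ.* s) * + w         ≡⟨ cong₂ _+_ (ℤ.pos-* 27 (∣ t ∣ ℕ.* ∣ t ∣))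
        (ℤ.pos-* (s ℕ.* s) w) ⟨
    + (27 ℕ.* (∣ t ∣ ℕ.* ∣ t ∣) ℕ.+ s ℕ.* s ℕ.* w)         ∎)
    where
    open ≡.≡-Reasoning
    t′ = y * y * y - + 4 * d * y
    u = + 3 * (y * y) - + 4 * d
    s = ∣ u ∣
    identity : ∀ d y → + 256 * (d * d * d) ≡ + 27 * ((y * y * y - + 4 * d * y) *
        (y * y * y - + 4 * d * y))
                 + (+ 3 * (y * y) - + 4 * d) * (+ 3 * (y * y) - + 4 * d) * (+ 16 * d - + 3 * (y * y))
    identity = solve-∀

  abs-scaled : ∀ m x r → + m * x ≡ + r → m ℕ.* ∣ x ∣ ≡ r
  abs-scaled m x r mx≡r = ≡.trans (≡.sym (ℤ.abs-* (+ m) x)) (cong ℤ.∣_∣ mx≡r)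

  abs-cube : ∀ x → ∣ x * x * x ∣ ≡ ∣ x ∣ ℕ.* ∣ x ∣ ℕ.* ∣ x ∣
  abs-cube x = ≡.trans (ℤ.abs-* (x * x) x) (cong (ℕ._* ∣ x ∣) (ℤ.abs-* x x))

  256*cube≢- : ∀ n r → + 256 * (-[1+ n ] * -[1+ n ] * -[1+ n ]) ≢ + r
  256*cube≢- n r ()

  -- For a = k d the product a² d is k² d³, the `t` below. The bound only sees absolute values; the
  -- sign of d is settled by 256 d³ being a natural number.
  bounded : ∀ d y k → d ≢ 0ℤ → k ≢ 0ℤ → k * k * (d * d * d) ≡ y * y * y - + 4 * d * y →
      (∃[ w ] W d y ≡ + w) →
            ∣ k ∣ ≡ 1 × (d ≡ + 1 ⊎ d ≡ + 2)
  bounded d y k d≢0 k≢0 eq W≥0 = conclude d refl (bound ∣ k ∣ ∣ d ∣ (k≢0 ∘ ℤ.∣i∣≡0⇒i≡0)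
      (≡.subst₂ ℕ._≤_ (cong (λ t → 27 ℕ.* (t ℕ.* t)) abs-t) (cong (256 ℕ.*_) (abs-cube d))
        (ℕ.≤-trans (ℕ.m≤m+n (27 ℕ.* (∣ t ∣ ℕ.* ∣ t ∣)) n)
            (ℕ.≤-reflexive (≡.sym (abs-scaled 256 (d * d * d) _ 256d³≡))))))
    where
    t = k * k * (d * d * d)
    positive = positive-discriminant d y t eq W≥0
    n = proj₁ positive
    256d³≡ = proj₂ positive
    abs-t : ∣ t ∣ ≡ ∣ k ∣ ℕ.* ∣ k ∣ ℕ.* (∣ d ∣ ℕ.* ∣ d ∣ ℕ.* ∣ d ∣)
    abs-t = ≡.trans (ℤ.abs-* (k * k) (d * d * d)) (cong₂ ℕ._*_ (ℤ.abs-* k k) (abs-cube d))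
    conclude : ∀ e → d ≡ e → ∣ e ∣ ≡ 0 ⊎ (∣ k ∣ ≡ 1 × (∣ e ∣ ≡ 1 ⊎ ∣ e ∣ ≡ 2)) →
        ∣ k ∣ ≡ 1 × (d ≡ + 1 ⊎ d ≡ + 2)
    conclude e        d≡e (inj₁ ∣e∣≡0)     = ⊥-elim (d≢0 (≡.trans d≡e (ℤ.∣i∣≡0⇒i≡0 ∣e∣≡0)))
    conclude (+ e)    d≡e (inj₂ (k≡1 , e≡)) = k≡1 , Sum.map (≡.trans d≡e ∘ cong (λ n → + n))
        (≡.trans d≡e ∘ cong (λ n → + n)) e≡
    conclude -[1+ e ] d≡e (inj₂ _) = ⊥-elim (256*cube≢- e (27 ℕ.* (∣ t ∣ ℕ.* ∣ t ∣) ℕ.+ n)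
      (≡.trans (cong (λ d → + 256 * (d * d * d)) (≡.sym d≡e)) 256d³≡))

  z-unit₁ : ∀ z → + 1 ≡ z * z * z * + 1 - + 4 * z → z ∣ 1ℤ
  z-unit₁ z eq = divides (z * z - + 4) (≡.trans eq (identity z))
    where
    identity : ∀ z → z * z * z * + 1 - + 4 * z ≡ (z * z - + 4) * z
    identity = solve-∀

  z-unit₂ : ∀ z → + 2 ≡ z * z * z * + 2 - + 4 * z → z ∣ 1ℤ
  z-unit₂ z eq = divides (z * z - + 2) (ℤ.*-cancelʳ-≡ 1ℤ ((z * z - + 2) * z) (+ 2)
      (≡.trans eq (identity z)))
    where
    identity : ∀ z → z * z * z * + 2 - + 4 * z ≡ (z * z - + 2) * z * + 2
    identity = solve-∀

  -- The equation makes z a unit. For d = 1 the values z = ± 1 give ∓ 3 on the right. For d = 2 they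
  -- give ∓ 2, so z = - 1 survives, with y = - 2, and it takes the squares to exclude it: V W = - 80
  -- is negative and W = 20 lies between 4² and 5².
  small-cases : ∀ d z → d ≡ + 1 ⊎ d ≡ + 2 → d ≡ z * z * z * d - + 4 * z →
                ¬ ((∃[ w ] w * w ≡ W d (z * d)) ⊎ (∃[ n ] n * n ≡ V d (z * d) * W d (z * d)))
  small-cases _ z (inj₁ refl) eq _ with ∣1⇒±1 z (z-unit₁ z eq)
  small-cases _ _ (inj₁ refl) () _ | inj₁ refl
  small-cases _ _ (inj₁ refl) () _ | inj₂ refl
  small-cases _ z (inj₂ refl) eq _ with ∣1⇒±1 z (z-unit₂ z eq)
  small-cases _ _ (inj₂ refl) () _ | inj₁ refl
  small-cases _ _ (inj₂ refl) _ (inj₁ (w , ww≡20)) | inj₂ refl =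
    20-not-square ∣ w ∣ (ℤ.+-injective (≡.trans (≡.sym (square≡+ w)) ww≡20))
  small-cases _ _ (inj₂ refl) _ (inj₂ (n , nn≡-80)) | inj₂ refl
    with () ← ≡.trans (≡.sym (square≡+ n)) nn≡-80

  y∣-cubic : ∀ a d y → y * y * y - + 4 * d * y ≡ a * a * d → d ∣ y * y * y
  y∣-cubic a d y cubic = divides (a * a + + 4 * y)
      (≡.trans (move (y * y * y) (+ 4 * d * y)) (≡.trans (cong (_+ + 4 * d * y) cubic) (factor a d y)))
    where
    move : ∀ i j → i ≡ i - j + j
    move = solve-∀
    factor : ∀ a d y → a * a * d + + 4 * d * y ≡ (a * a + + 4 * y) * d
    factor = solve-∀

  cancel-cubic : ∀ a d z → d ≢ 0ℤ → z * d * (z * d) * (z * d) - + 4 * d * (z * d) ≡ a * a * d →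
                 a * a ≡ (z * z * z * d - + 4 * z) * d
  cancel-cubic a d z d≢0 cubic = ℤ.*-cancelʳ-≡ (a * a) ((z * z * z * d - + 4 * z) * d) d
      {{ℤ.≢-nonZero d≢0}}
      (≡.trans (≡.sym cubic) (identity d z))
    where
    identity : ∀ d z → z * d * (z * d) * (z * d) - + 4 * d * (z * d) ≡ (z * z * z * d - + 4 * z) * d * d
    identity = solve-∀

  cancel-square : ∀ k d e → d ≢ 0ℤ → k * d * (k * d) ≡ e * d → k * k * d ≡ e
  cancel-square k d e d≢0 eq = ℤ.*-cancelʳ-≡ (k * k * d) e d {{ℤ.≢-nonZero d≢0}}
      (≡.trans (regroup k d) eq)
    where
    regroup : ∀ k d → k * k * d * d ≡ k * d * (k * d)
    regroup = solve-∀

  -- With a = k d and y = z d the cubic, divided by d², is k² d = z³ d - 4 z. Once k = ± 1, this is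
  -- the equation of `small-cases`.
  reduced : ∀ d k z → d ≢ 0ℤ → k ≢ 0ℤ → z * d * (z * d) * (z * d) - + 4 * d * (z * d) ≡ k * d * (k * d)
      * d →
    ¬ ((∃[ w ] w * w ≡ W d (z * d)) ⊎ (∃[ n ] n * n ≡ V d (z * d) * W d (z * d)))
  reduced d k z d≢0 k≢0 cubic squares = small-cases d z d≡ (≡.trans (≡.sym k²d≡d) k²d≡) squares
    where
    shape : ∀ k d → k * k * (d * d * d) ≡ k * d * (k * d) * d
    shape = solve-∀
    k²d≡ : k * k * d ≡ z * z * z * d - + 4 * z
    k²d≡ = cancel-square k d (z * z * z * d - + 4 * z) d≢0 (cancel-cubic (k * d) d z d≢0 cubic)
    small = bounded d (z * d) k d≢0 k≢0 (≡.trans (shape k d) (≡.sym cubic)) (W-nonneg d (z * d) squares)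
    d≡ = proj₂ small
    k²d≡d : k * k * d ≡ d
    k²d≡d = ≡.trans (cong (_* d) (≡.trans (square≡+ k) (cong (λ m → + (m ℕ.* m)) (proj₁ small))))
        (ℤ.*-identityˡ d)

  no-solution : ∀ a d y → a ≢ 0ℤ → d ≢ 0ℤ → Squarefree d → y * y * y - + 4 * d * y ≡ a * a * d →
    ¬ ((∃[ w ] w * w ≡ W d y) ⊎ (∃[ n ] n * n ≡ V d y * W d y))
  no-solution a d y a≢0 d≢0 d-sqf cubic =
    step₁ a y a≢0 (squarefree-∣-cube y d≢0 d-sqf (y∣-cubic a d y cubic)) cubic
    where
    step₂ : ∀ a z → a ≢ 0ℤ → d ∣ a → z * d * (z * d) * (z * d) - + 4 * d * (z * d) ≡ a * a * d →
      ¬ ((∃[ w ] w * w ≡ W d (z * d)) ⊎ (∃[ n ] n * n ≡ V d (z * d) * W d (z * d)))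
    step₂ _ z a≢0 (divides k refl) = reduced d k z d≢0 λ k≡0 →
        a≢0 (≡.trans (cong (_* d) k≡0) (ℤ.*-zeroˡ d))
    step₁ : ∀ a y → a ≢ 0ℤ → d ∣ y → y * y * y - + 4 * d * y ≡ a * a * d →
      ¬ ((∃[ w ] w * w ≡ W d y) ⊎ (∃[ n ] n * n ≡ V d y * W d y))
    step₁ a _ a≢0 (divides z refl) cubic = step₂ a z a≢0
      (squarefree-∣-square a d≢0 d-sqf (divides (z * z * z * d - + 4 * z)
          (cancel-cubic a d z d≢0 cubic))) cubic

-- The fraction i / 1 is normalised by a computation that is stuck for a variable i. The right side
-- is already in lowest terms, so its numerator can be read off.
fromℤ-mkℚ : ∀ i → fromℤ i ≡ mkℚ i 0 (Coprime.sym (Coprime.1-coprimeTo ℤ.∣ i ∣))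
fromℤ-mkℚ i = ℚ.↥p/↧p≡p (mkℚ i 0 _)

fromℤ-homo-+ : ∀ i j → fromℤ (i ℤ.+ j) ≡ fromℤ i ℚ.+ fromℤ j
fromℤ-homo-+ i j rewrite fromℤ-mkℚ i | fromℤ-mkℚ j =
  cong (λ k → k ℚ./ 1) (cong₂ ℤ._+_ (≡.sym (ℤ.*-identityʳ i)) (≡.sym (ℤ.*-identityʳ j)))

fromℤ-homo-* : ∀ i j → fromℤ (i ℤ.* j) ≡ fromℤ i ℚ.* fromℤ j
fromℤ-homo-* i j rewrite fromℤ-mkℚ i | fromℤ-mkℚ j = refl

fromℤ-injective-0 : ∀ i → fromℤ i ≡ 0ℚ → i ≡ 0ℤ
fromℤ-injective-0 i p = ≡.trans (≡.sym (cong ℚ.↥_ (fromℤ-mkℚ i))) (cong ℚ.↥_ p)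

fromℤ-homo-neg : ∀ i → fromℤ (ℤ.- i) ≡ ℚ.- fromℤ i
fromℤ-homo-neg i = lemma (fromℤ (ℤ.- i)) (fromℤ i) eq
  where
  eq : fromℤ (ℤ.- i) ℚ.+ fromℤ i ≡ 0ℚ
  eq = ≡.trans (≡.sym (fromℤ-homo-+ (ℤ.- i) i)) (cong fromℤ (ℤ.+-inverseˡ i))
  lemma : ∀ p q → p ℚ.+ q ≡ 0ℚ → p ≡ ℚ.- q
  lemma p q pq = RingProperties.+-inverseˡ-unique (CommutativeRing.ring ℚ.+-*-commutativeRing) p q pq

-- Field extensions of ℚ with decidable equality

module Field (E : Extension) where
  open Extension E public
    using (Carrier; _≈_; _#?_; _+_; _*_; -_; 0#; 1#; ι; isRingHomomorphism; commutativeRing)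
  open CommutativeRing commutativeRing public
    using ( rawRing; ring; setoid; _-_
          ; +-cong; +-congˡ; +-congʳ; *-cong; *-congˡ; *-congʳ; -‿cong
          ; +-identityˡ; +-identityʳ; *-identityˡ; *-identityʳ; zeroˡ; zeroʳ; *-comm; *-assoc)
    renaming (refl to ≈-refl; sym to ≈-sym; trans to ≈-trans; reflexive to ≈-reflexive)
  open RingMorphisms.IsRingHomomorphism isRingHomomorphism public
    using () renaming ( +-homo to ι-+; *-homo to ι-*; -‿homo to ι-neg; 0#-homo to ι-0; 1#-homo to ι-1;
        ⟦⟧-cong to ι-cong)
  open SetoidReasoning setoid public
  open RingProperties ring public using (-0#≈0#)
  private module H = HeytingProperties (Extension.heytingCommutativeRing E)

  infix 4 _≉_
  _≉_ : Carrier → Carrier → Set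
  x ≉ y = ¬ (x ≈ y)

  _≟_ : ∀ x y → Dec (x ≈ y)
  x ≟ y with x #? y
  ... | yes x#y = no λ x≈y → Extension.#-irrefl E x≈y x#y
  ... | no ¬x#y = yes (proj₁ (Extension.tight E x y) ¬x#y)

  int : ℤ → Carrier
  int = ιℤ E

  int-+ : ∀ i j → int (i ℤ.+ j) ≈ int i + int j
  int-+ i j = ≈-trans (ι-cong (fromℤ-homo-+ i j)) (ι-+ _ _)

  int-* : ∀ i j → int (i ℤ.* j) ≈ int i * int j
  int-* i j = ≈-trans (ι-cong (fromℤ-homo-* i j)) (ι-* _ _)

  int-neg : ∀ i → int (ℤ.- i) ≈ - int i
  int-neg i = ≈-trans (ι-cong (fromℤ-homo-neg i)) (ι-neg _)

  -- The constants 0 and 1 of the ring solver are to be the 0# and 1# of the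
  -- field definitionally, which int 0ℤ and int 1ℤ are not.
  constant : ℤ → Carrier
  constant (+ 0) = 0#
  constant (+ 1) = 1#
  constant i     = int i

  constant≈int : ∀ i → constant i ≈ int i
  constant≈int (+ 0)           = ≈-sym ι-0
  constant≈int (+ 1)           = ≈-sym ι-1
  constant≈int (+ suc (suc n)) = ≈-refl
  constant≈int -[1+ n ]        = ≈-refl

  morphism : ℤ.+-*-rawRing -Raw-AlmostCommutative⟶ fromCommutativeRing commutativeRing
  morphism = record
    { ⟦_⟧    = constant
    ; +-homo = λ i j → ≈-trans (constant≈int (i ℤ.+ j)) (≈-trans (int-+ i j)
                 (≈-sym (+-cong (constant≈int i) (constant≈int j))))
    ; *-homo = λ i j → ≈-trans (constant≈int (i ℤ.* j)) (≈-trans (int-* i j)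
                 (≈-sym (*-cong (constant≈int i) (constant≈int j))))
    ; -‿homo = λ i → ≈-trans (constant≈int (ℤ.- i)) (≈-trans (int-neg i)
                 (≈-sym (-‿cong (constant≈int i))))
    ; 0-homo = ≈-refl
    ; 1-homo = ≈-refl
    }

  _coeff≟_ : ∀ i j → Maybe (constant i ≈ constant j)
  i coeff≟ j with i ℤ.≟ j
  ... | yes refl = just ≈-refl
  ... | no _     = nothing

  open Algebra.Solver.Ring ℤ.+-*-rawRing (fromCommutativeRing commutativeRing) morphism _coeff≟_ public
    using (con; _:*_; _:+_; _:-_; :-_; _:=_; solve)
    renaming (Polynomial to Syntax)

  x-y≈0⇒x≈y : ∀ {x y} → x - y ≈ 0# → x ≈ y
  x-y≈0⇒x≈y {x} {y} p = ≈-trans (solve 2 (λ x y → x := (x :- y) :+ y) ≈-refl x y)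
      (≈-trans (+-congʳ p) (+-identityˡ y))

  x≈y⇒x-y≈0 : ∀ {x y} → x ≈ y → x - y ≈ 0#
  x≈y⇒x-y≈0 {x} {y} p = ≈-trans (+-congʳ p) (Extension.-‿inverseʳ E y)

  0≉1 : 0# ≉ 1#
  0≉1 p = Extension.#-irrefl E (≈-sym p) H.1#0

  inverse : ∀ {x} → x ≉ 0# → ∃[ y ] x * y ≈ 1#
  inverse {x} x≉0 with x #? 0#
  ... | no ¬x#0 = ⊥-elim (x≉0 (proj₁ (Extension.tight E x 0#) ¬x#0))
  ... | yes x#0 with Extension.#⇒invertible E x#0
  ...   | y , _ , xy≈1 = y , ≈-trans (*-congʳ (≈-sym (H.x-0≈x x))) xy≈1

  unit⇒≉0 : ∀ {x y} → x * y ≈ 1# → x ≉ 0#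
  unit⇒≉0 {x} {y} p x≈0 = 0≉1 (≈-trans (≈-sym (zeroˡ y)) (≈-trans (*-congʳ (≈-sym x≈0)) p))

  x*y≈0 : ∀ {x y} → x * y ≈ 0# → x ≉ 0# → y ≈ 0#
  x*y≈0 {x} {y} xy≈0 x≉0 with inverse x≉0
  ... | z , xz≈1 = begin
    y             ≈⟨ *-identityʳ y ⟨
    y * 1#        ≈⟨ *-congˡ xz≈1 ⟨
    y * (x * z)   ≈⟨ solve 3 (λ x y z → y :* (x :* z) := (x :* y) :* z) ≈-refl x y z ⟩
    (x * y) * z   ≈⟨ *-congʳ xy≈0 ⟩
    0# * z        ≈⟨ zeroˡ z ⟩
    0# ∎

  ι-injective-0 : ∀ {q} → ι q ≈ 0# → q ≡ 0ℚ
  ι-injective-0 {q} p with q ℚ.≟ 0ℚ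
  ... | yes q≡0 = q≡0
  ... | no q≢0 = ⊥-elim (unit⇒≉0 eq p)
    where
    instance nz = ℚ.≢-nonZero q≢0
    eq : ι q * ι (ℚ.1/ q) ≈ 1#
    eq = ≈-trans (≈-sym (ι-* q _)) (≈-trans (ι-cong (ℚ.*-inverseʳ q)) ι-1)

  int-injective-0 : ∀ {i} → int i ≈ 0# → i ≡ 0ℤ
  int-injective-0 {i} p = fromℤ-injective-0 i (ι-injective-0 p)

  int-injective : ∀ {i j} → int i ≈ int j → i ≡ j
  int-injective {i} {j} p = ℤ.i-j≡0⇒i≡j i j (int-injective-0 (begin
    int (i ℤ.- j)         ≈⟨ ≈-trans (int-+ i (ℤ.- j)) (+-congˡ (int-neg j)) ⟩
    int i - int j         ≈⟨ x≈y⇒x-y≈0 p ⟩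
    0# ∎))

-- Values of polynomials and division with remainder

module Evaluation (E : Extension) where
  open Field E

  -- No laws are asked of S and its equality is ignored: its elements serve as names, compared only
  -- through their values under `χ`.
  record Preserves (S : RawRing 0ℓ 0ℓ) (χ : RawRing.Carrier S → Carrier) : Set where
    private module S = RawRing S
    field
      pres-+ : ∀ s t → χ (s S.+ t) ≈ χ s + χ t
      pres-* : ∀ s t → χ (s S.* t) ≈ χ s * χ t
      pres-neg : ∀ s → χ (S.- s) ≈ - χ s
      pres-0 : χ S.0# ≈ 0#
      pres-1 : χ S.1# ≈ 1#

  eval : ∀ {S : Set} → (S → Carrier) → List S → Carrier → Carrier
  eval χ p x = foldr (λ s r → χ s + x * r) 0# p

  infixr 8 _^_
  _^_ : Carrier → ℕ → Carrier
  x ^ zero  = 1#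
  x ^ suc n = x * x ^ n

  eval-∷ʳ : ∀ {S : Set} (χ : S → Carrier) p c x → eval χ (p ∷ʳ c) x ≈ eval χ p x + χ c * x ^ length p
  eval-∷ʳ χ [] c x = solve 2 (λ c x → c :+ x :* con 0ℤ := con 0ℤ :+ c :* con 1ℤ) ≈-refl (χ c) x
  eval-∷ʳ χ (a ∷ p) c x = begin
    χ a + x * eval χ (p ∷ʳ c) x                     ≈⟨ +-congˡ (*-congˡ (eval-∷ʳ χ p c x)) ⟩
    χ a + x * (eval χ p x + χ c * x ^ length p)     ≈⟨ solve 5 (λ a x e c y →
        a :+ x :* (e :+ c :* y) := (a :+ x :* e) :+ c :* (x :* y)) ≈-refl _ _ _ _ _ ⟩
    (χ a + x * eval χ p x) + χ c * (x * x ^ length p) ∎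

  eval-map-zero : ∀ {S : Set} (χ : S → Carrier) {p} → All (λ s → χ s ≈ 0#) p → ∀ x → eval χ p x ≈ 0#
  eval-map-zero χ [] x = ≈-refl
  eval-map-zero χ (a≈0 ∷ p≈0) x = begin
    _ + x * _    ≈⟨ +-cong a≈0 (*-congˡ (eval-map-zero χ p≈0 x)) ⟩
    0# + x * 0#  ≈⟨ solve 1 (λ x → con 0ℤ :+ x :* con 0ℤ := con 0ℤ) ≈-refl x ⟩
    0# ∎

  eval-cong : ∀ {S : Set} (χ : S → Carrier) p {x y} → x ≈ y → eval χ p x ≈ eval χ p y
  eval-cong χ [] x≈y = ≈-refl
  eval-cong χ (a ∷ p) x≈y = +-congˡ (*-cong x≈y (eval-cong χ p x≈y))

  eval-map : ∀ {S T : Set} (χ : T → Carrier) (f : S → T) p x → eval χ (map f p) x ≡ eval (χ ∘ f) p x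
  eval-map χ f []      x = refl
  eval-map χ f (a ∷ p) x = cong (λ r → χ (f a) + x * r) (eval-map χ f p x)

  eval-ext : ∀ {S : Set} (χ ψ : S → Carrier) → (∀ s → χ s ≈ ψ s) → ∀ p x → eval χ p x ≈ eval ψ p x
  eval-ext χ ψ h [] x = ≈-refl
  eval-ext χ ψ h (a ∷ p) x = +-cong (h a) (*-congˡ (eval-ext χ ψ h p x))

  module _ (S : RawRing 0ℓ 0ℓ) where
    private module S = RawRing S
    open Polynomial S using (Poly; _+ₚ_; _*ₚ_; 1ₚ; _≈ₚ_)

    polynomialRing : RawRing 0ℓ 0ℓ
    polynomialRing = record
      { Carrier = Poly ; _≈_ = _≈ₚ_ ; _+_ = _+ₚ_ ; _*_ = _*ₚ_
      ; -_ = map S.-_ ; 0# = [] ; 1# = 1ₚ }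

    length-+ₚ : ∀ {n} p q → length p ℕ.≤ n → length q ℕ.≤ n → length (p +ₚ q) ℕ.≤ n
    length-+ₚ []      q       _         q≤n       = q≤n
    length-+ₚ (a ∷ p) []      p≤n       _         = p≤n
    length-+ₚ (a ∷ p) (b ∷ q) (s≤s p≤n) (s≤s q≤n) = s≤s (length-+ₚ p q p≤n q≤n)

    module _ {χ : S.Carrier → Carrier} (χ-pres : Preserves S χ) where
      open Preserves χ-pres

      eval-+ₚ : ∀ p q x → eval χ (p +ₚ q) x ≈ eval χ p x + eval χ q x
      eval-+ₚ []      q       x = ≈-sym (+-identityˡ _)
      eval-+ₚ (a ∷ p) []      x = ≈-sym (+-identityʳ _)
      eval-+ₚ (a ∷ p) (b ∷ q) x = begin
        χ (a S.+ b) + x * eval χ (p +ₚ q) x             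
            ≈⟨ +-cong (pres-+ a b) (*-congˡ (eval-+ₚ p q x)) ⟩
        (χ a + χ b) + x * (eval χ p x + eval χ q x)     
            ≈⟨ solve 5 (λ a b x p q → (a :+ b) :+ x :* (p :+ q) := (a :+ x :* p) :+ (b :+ x :* q))
            ≈-refl _ _ _ _ _ ⟩
        (χ a + x * eval χ p x) + (χ b + x * eval χ q x)  ∎

      eval-scale : ∀ c p x → eval χ (map (c S.*_) p) x ≈ χ c * eval χ p x
      eval-scale c []      x = ≈-sym (zeroʳ _)
      eval-scale c (a ∷ p) x = begin
        χ (c S.* a) + x * eval χ (map (c S.*_) p) x ≈⟨ +-cong (pres-* c a) (*-congˡ (eval-scale c p x))
            ⟩
        χ c * χ a + x * (χ c * eval χ p x)        ≈⟨ solve 4 (λ c a x p →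
            c :* a :+ x :* (c :* p) := c :* (a :+ x :* p)) ≈-refl _ _ _ _ ⟩
        χ c * (χ a + x * eval χ p x)              ∎

      eval-neg : ∀ p x → eval χ (map S.-_ p) x ≈ - eval χ p x
      eval-neg []      x = ≈-sym -0#≈0#
      eval-neg (a ∷ p) x = begin
        χ (S.- a) + x * eval χ (map S.-_ p) x  ≈⟨ +-cong (pres-neg a) (*-congˡ (eval-neg p x)) ⟩
        - χ a + x * - eval χ p x              ≈⟨ solve 3 (λ a x p →
            :- a :+ x :* :- p := :- (a :+ x :* p)) ≈-refl _ _ _ ⟩
        - (χ a + x * eval χ p x)              ∎

      eval-*ₚ : ∀ p q x → eval χ (p *ₚ q) x ≈ eval χ p x * eval χ q x
      eval-*ₚ []      q x = ≈-sym (zeroˡ _)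
      eval-*ₚ (a ∷ p) q x = begin
        eval χ (map (a S.*_) q +ₚ (S.0# ∷ p *ₚ q)) x                  
            ≈⟨ eval-+ₚ (map (a S.*_) q) (S.0# ∷ p *ₚ q) x ⟩
        eval χ (map (a S.*_) q) x + (χ S.0# + x * eval χ (p *ₚ q) x)  
            ≈⟨ +-cong (eval-scale a q x) (+-cong pres-0 (*-congˡ (eval-*ₚ p q x))) ⟩
        χ a * eval χ q x + (0# + x * (eval χ p x * eval χ q x))       
            ≈⟨ solve 4 (λ a x p q → a :* q :+ (con 0ℤ :+ x :* (p :* q)) := (a :+ x :* p) :* q) ≈-refl _
            _ _ _ ⟩
        (χ a + x * eval χ p x) * eval χ q x                            ∎

      eval-constant : ∀ a x → eval χ (a ∷ []) x ≈ χ a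
      eval-constant a x = solve 2 (λ a x → a :+ x :* con 0ℤ := a) ≈-refl (χ a) x

      eval-preserves : ∀ x → Preserves polynomialRing (λ p → eval χ p x)
      eval-preserves x = record
        { pres-+   = λ p q → eval-+ₚ p q x
        ; pres-*   = λ p q → eval-*ₚ p q x
        ; pres-neg = λ p → eval-neg p x
        ; pres-0   = ≈-refl
        ; pres-1   = ≈-trans (eval-constant S.1# x) pres-1
        }

    -- From a list of at most m + 1 entries this splits off the coefficient of degree m; missing
    -- entries count as zero.
    truncate : ℕ → Poly → Poly × S.Carrier
    truncate _       []      = [] , S.0#
    truncate zero    (a ∷ _) = [] , a
    truncate (suc m) (a ∷ p) = let q , c = truncate m p in a ∷ q , c

    length-truncate : ∀ m p → length (proj₁ (truncate m p)) ℕ.≤ m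
    length-truncate zero    []      = z≤n
    length-truncate zero    (a ∷ p) = z≤n
    length-truncate (suc m) []      = z≤n
    length-truncate (suc m) (a ∷ p) = s≤s (length-truncate m p)

    eval-truncate : ∀ {χ} → Preserves S χ → ∀ m p → length p ℕ.≤ suc m → ∀ x →
      eval χ p x ≈ eval χ (proj₁ (truncate m p)) x + χ (proj₂ (truncate m p)) * x ^ m
    eval-truncate χ-pres m [] _ x = begin
      0#              ≈⟨ solve 1 (λ y → con 0ℤ := con 0ℤ :+ con 0ℤ :* y) ≈-refl (x ^ m) ⟩
      0# + 0# * x ^ m ≈⟨ +-congˡ (*-congʳ (Preserves.pres-0 χ-pres)) ⟨
      0# + _ * x ^ m  ∎
    eval-truncate {χ} χ-pres zero (a ∷ []) _ x =
      solve 2 (λ a x → a :+ x :* con 0ℤ := con 0ℤ :+ a :* con 1ℤ) ≈-refl (χ a) x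
    eval-truncate χ-pres zero (a ∷ b ∷ p) (s≤s ()) x
    eval-truncate {χ} χ-pres (suc m) (a ∷ p) (s≤s p≤m) x = begin
      χ a + x * eval χ p x                 ≈⟨ +-congˡ (*-congˡ (eval-truncate χ-pres m p p≤m x)) ⟩
      χ a + x * (_ + χ c * x ^ m)          ≈⟨ solve 5 (λ a x e c y →
          a :+ x :* (e :+ c :* y) := (a :+ x :* e) :+ c :* (x :* y)) ≈-refl _ _ _ _ _ ⟩
      (χ a + x * _) + χ c * (x * x ^ m)    ∎
      where c = proj₂ (truncate m p)

    -- A monic polynomial is represented by its coefficients below the leading one.
    monic : Poly → Poly
    monic M = M ∷ʳ S.1#

    eval-monic : ∀ {χ} → Preserves S χ → ∀ M x → eval χ (monic M) x ≈ eval χ M x + x ^ length M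
    eval-monic {χ} χ-pres M x = begin
      eval χ (monic M) x                     ≈⟨ eval-∷ʳ χ M S.1# x ⟩
      eval χ M x + χ S.1# * x ^ length M     ≈⟨ +-congˡ (≈-trans (*-congʳ (Preserves.pres-1 χ-pres))
          (*-identityˡ _)) ⟩
      eval χ M x + x ^ length M              ∎

    -- Horner's scheme: if p = G Q + R for the monic divisor G, then a + x p = G (x Q) + (a + x R).
    -- Subtracting c G, where c is the coefficient of a + x R in degree `length M`, makes the
    -- remainder short again. The number n bounds the length of the quotient; if p has at most n +
    -- `length M` entries, what is left when n runs out is short enough to be a remainder.
    divide : Poly → ℕ → Poly → Poly × Poly
    divide M zero    p       = [] , p
    divide M (suc n) []      = [] , []
    divide M (suc n) (a ∷ p) =
      let Q , R = divide M n p
          R′ , c = truncate (length M) (a ∷ R)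
      in c ∷ Q , R′ +ₚ map (S.- c S.*_) M

    quotient remainder : Poly → ℕ → Poly → Poly
    quotient  M n p = proj₁ (divide M n p)
    remainder M n p = proj₂ (divide M n p)

    length-quotient : ∀ M n p → length (quotient M n p) ℕ.≤ n
    length-quotient M zero    p       = z≤n
    length-quotient M (suc n) []      = z≤n
    length-quotient M (suc n) (a ∷ p) = s≤s (length-quotient M n p)

    length-remainder : ∀ M n p → length p ℕ.≤ n ℕ.+ length M → length (remainder M n p) ℕ.≤ length M
    length-remainder M zero    p       p≤ = p≤
    length-remainder M (suc n) []      p≤ = z≤n
    length-remainder M (suc n) (a ∷ p) p≤ =
      length-+ₚ (proj₁ (truncate (length M) (a ∷ remainder M n p))) _
        (length-truncate (length M) (a ∷ remainder M n p)) (ℕ.≤-reflexive (List.length-map _ M))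

    eval-divide : ∀ {χ} → Preserves S χ → ∀ M n p → length p ℕ.≤ n ℕ.+ length M → ∀ x →
      eval χ p x ≈ eval χ (monic M) x * eval χ (quotient M n p) x + eval χ (remainder M n p) x
    eval-divide {χ} χ-pres M zero p _ x =
      solve 2 (λ m p → p := m :* con 0ℤ :+ p) ≈-refl (eval χ (monic M) x) (eval χ p x)
    eval-divide {χ} χ-pres M (suc n) [] _ x =
      solve 1 (λ m → con 0ℤ := m :* con 0ℤ :+ con 0ℤ) ≈-refl (eval χ (monic M) x)
    eval-divide {χ} χ-pres M (suc n) (a ∷ p) (s≤s p≤) x = begin
      χ a + x * e p
        ≈⟨ +-congˡ (*-congˡ (eval-divide χ-pres M n p p≤ x)) ⟩
      χ a + x * (e (monic M) * e Q + e R)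
        ≈⟨ solve 5 (λ a x m q r → a :+ x :* (m :* q :+ r) := x :* (m :* q) :+ (a :+ x :* r)) ≈-refl _ _
            _ _ _ ⟩
      x * (e (monic M) * e Q) + e (a ∷ R)
        ≈⟨ +-cong (*-congˡ (*-congʳ (eval-monic χ-pres M x)))
            (eval-truncate χ-pres (length M) (a ∷ R) (s≤s (length-remainder M n p p≤)) x) ⟩
      x * ((e M + x ^ length M) * e Q) + (e R′ + χ c * x ^ length M)
        ≈⟨ solve 6 (λ x m y q r c → x :* ((m :+ y) :* q) :+ (r :+ c :* y)
                                  := (m :+ y) :* (c :+ x :* q) :+ (r :+ (:- c) :* m)) ≈-refl _ _ _ _ _ _
                                      ⟩
      (e M + x ^ length M) * (χ c + x * e Q) + (e R′ + (- χ c) * e M)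
        ≈⟨ +-cong (*-congʳ (eval-monic χ-pres M x))
             (≈-trans (eval-+ₚ χ-pres R′ _ x) (+-congˡ (≈-trans (eval-scale χ-pres (S.- c) M x)
                 (*-congʳ (Preserves.pres-neg χ-pres c))))) ⟨
      e (monic M) * e (c ∷ Q) + e (R′ +ₚ map (S.- c S.*_) M) ∎
      where
      e : Poly → Carrier
      e q = eval χ q x
      Q  = quotient M n p
      R  = remainder M n p
      R′ = proj₁ (truncate (length M) (a ∷ R))
      c  = proj₂ (truncate (length M) (a ∷ R))

    module Division (D p : Poly) where
      n′ : ℕ
      n′ = length p ℕ.∸ length D

      p≤n′+D : length p ℕ.≤ n′ ℕ.+ length D
      p≤n′+D = ℕ.≤-trans (ℕ.m≤n+m∸n (length p) (length D)) (ℕ.≤-reflexive (ℕ.+-comm (length D) n′))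

      Q R : Poly
      Q = quotient D n′ p
      R = remainder D n′ p

      R≤D : length R ℕ.≤ length D
      R≤D = length-remainder D n′ p p≤n′+D

      division : ∀ {χ} → Preserves S χ → ∀ x → eval χ p x ≈ eval χ (monic D) x * eval χ Q x + eval χ R x
      division χ-pres = eval-divide χ-pres D n′ p p≤n′+D

-- Counting the roots of a polynomial

module RootCounting (E : Extension) where
  open Field E
  open Evaluation E

  -- The quotient of x p(x) - r p(r) by x - r.
  synthetic : Carrier → List Carrier → List Carrier
  synthetic r []      = []
  synthetic r (a ∷ p) = (a + r * eval id p r) ∷ synthetic r p

  length-synthetic : ∀ r p → length (synthetic r p) ≡ length p
  length-synthetic r []      = refl
  length-synthetic r (a ∷ p) = cong suc (length-synthetic r p)

  eval-synthetic : ∀ r p x → x * eval id p x - r * eval id p r ≈ (x - r) * eval id (synthetic r p) x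
  eval-synthetic r [] x = solve 2 (λ x r → x :* con 0ℤ :- r :* con 0ℤ := (x :- r) :* con 0ℤ) ≈-refl x r
  eval-synthetic r (a ∷ p) x = begin
    x * (a + x * eval id p x) - r * (a + r * eval id p r)
      ≈⟨ solve 5 (λ x r a p q → x :* (a :+ x :* p) :- r :* (a :+ r :* q)
                             := (x :- r) :* (a :+ r :* q) :+ x :* (x :* p :- r :* q)) ≈-refl _ _ _ _ _ ⟩
    (x - r) * (a + r * eval id p r) + x * (x * eval id p x - r * eval id p r)
      ≈⟨ +-congˡ (*-congˡ (eval-synthetic r p x)) ⟩
    (x - r) * (a + r * eval id p r) + x * ((x - r) * eval id (synthetic r p) x)
      ≈⟨ solve 4 (λ d c x q → d :* c :+ x :* (d :* q) := d :* (c :+ x :* q)) ≈-refl _ _ _ _ ⟩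
    (x - r) * ((a + r * eval id p r) + x * eval id (synthetic r p) x) ∎

  cancel-constant : ∀ {a} r p → All (_≈ 0#) p → eval id (a ∷ p) r ≈ 0# → a ≈ 0#
  cancel-constant {a} r p p≈0 ap≈0 = begin
    a                    ≈⟨ solve 2 (λ a r → a := a :+ r :* con 0ℤ) ≈-refl a r ⟩
    a + r * 0#           ≈⟨ +-congˡ (*-congˡ (eval-map-zero id p≈0 r)) ⟨
    a + r * eval id p r  ≈⟨ ap≈0 ⟩
    0#                   ∎

  -- From the top coefficient down: once the tail p is zero, the entry a + r p(r) is a itself.
  synthetic-zero : ∀ r p → All (_≈ 0#) (synthetic r p) → All (_≈ 0#) p
  synthetic-zero r []      []             = []
  synthetic-zero r (a ∷ p) (ap≈0 ∷ q≈0) = cancel-constant r p p≈0 ap≈0 ∷ p≈0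
    where p≈0 = synthetic-zero r p q≈0

  -- For a further root x, (x - r) q(x) is the difference of the values at x and at r, hence zero.
  -- So the quotient q, one entry shorter, has all the remaining roots.
  many-roots⇒zero : ∀ p rs → length p ℕ.≤ length rs → AllPairs _≉_ rs →
                    All (λ r → eval id p r ≈ 0#) rs → All (_≈ 0#) p
  many-roots⇒zero []      rs       _         _              _            = []
  many-roots⇒zero (a ∷ p) (r ∷ rs) (s≤s p≤) (r∉rs ∷ rs!) (pr≈0 ∷ prs≈0) =
    cancel-constant r p p≈0 pr≈0 ∷ p≈0
    where
    q = synthetic r p
    root : ∀ {x} → r ≉ x × eval id (a ∷ p) x ≈ 0# → eval id q x ≈ 0#
    root {x} (r≉x , px≈0) = x*y≈0 (begin
      (x - r) * eval id q x                              ≈⟨ eval-synthetic r p x ⟨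
      x * eval id p x - r * eval id p r                 
          ≈⟨ solve 3 (λ a y z → y :- z := (a :+ y) :- (a :+ z)) ≈-refl a _ _ ⟩
      eval id (a ∷ p) x - eval id (a ∷ p) r              ≈⟨ x≈y⇒x-y≈0 (≈-trans px≈0 (≈-sym pr≈0)) ⟩
      0#                                                 ∎)
      (λ x-r≈0 → r≉x (≈-sym (x-y≈0⇒x≈y x-r≈0)))
    p≈0 = synthetic-zero r p (many-roots⇒zero q rs
            (ℕ.≤-trans (ℕ.≤-reflexive (length-synthetic r p)) p≤) rs!
            (All.map root (All.zip (r∉rs , prs≈0))))

  -- The integers embed in the field, so 0, 1, 2, ... supply as many distinct roots as needed.
  vanishing⇒zero : ∀ {S : Set} (χ : S → Carrier) p → (∀ x → eval χ p x ≈ 0#) → All (λ s → χ s ≈ 0#) p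
  vanishing⇒zero χ p p≈0 = All.map⁻ (many-roots⇒zero (map χ p) points
    (ℕ.≤-reflexive (≡.trans (List.length-map χ p) (≡.sym (List.length-applyUpTo point (length p)))))
    (AllPairs.applyUpTo⁺₁ point (length p) λ i<j _ p≈q → ℕ.<⇒≢ i<j (ℤ.+-injective (int-injective p≈q)))
    (All.universal (λ x → ≈-trans (≈-reflexive (eval-map id χ p x)) (p≈0 x)) points))
    where
    point : ℕ → Carrier
    point n = int (+ n)
    points : List Carrier
    points = applyUpTo point (length p)

  -- Ends the degree arguments below, in which too many roots or a zero cofactor would make a monic
  -- polynomial vanish everywhere.
  monic-nonvanishing : ∀ {S χ} → Preserves S χ → ∀ M → ¬ (∀ x → eval χ (monic S M) x ≈ 0#)
  monic-nonvanishing {S} {χ} χ-pres M M≈0 =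
    0≉1 (≈-trans (≈-sym (proj₂ (All.∷ʳ⁻ (vanishing⇒zero χ (monic S M) M≈0)))) (Preserves.pres-1 χ-pres))

-- Isomorphisms of subfields, extended by adjoining an element

module Extending (E : Extension) where
  open Field E
  open Evaluation E
  open RootCounting E

  -- An isomorphism between the subfields φ(S) and ψ(S), namely φ s ↦ ψ s.
  record PartialIso : Set₁ where
    field
      S        : RawRing 0ℓ 0ℓ
    open RawRing S public using () renaming (Carrier to Source)
    field
      φ ψ      : Source → Carrier
      φ-pres   : Preserves S φ
      ψ-pres   : Preserves S ψ
      kernel   : ∀ s → φ s ≈ 0# → ψ s ≈ 0#
      invert   : ∀ s → φ s ≉ 0# → ∃[ t ] φ s * φ t ≈ 1#
      scalar   : ℚ → Source
      φ-scalar : ∀ q → φ (scalar q) ≈ ι q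
      ψ-scalar : ∀ q → ψ (scalar q) ≈ ι q

  module Adjoin (T : PartialIso) (α : Carrier) where
    open PartialIso T
    private
      module S = RawRing S
      S[X] = polynomialRing S
      module S[X] = RawRing S[X]

    Annihilates : List Source → Set
    Annihilates M = eval φ (monic S M) α ≈ 0#

    record MinimalPolynomial : Set where
      field
        M           : List Source
        annihilates : Annihilates M
        least       : ∀ N → length N ℕ.< length M → ¬ Annihilates N

    -- The search claims that N is minimal. A refutation of this claim has to exhibit a shorter
    -- annihilator, from which the search resumes; whether one exists is never decided.
    ¬¬minimal : ∀ N → Annihilates N → ¬ ¬ MinimalPolynomial
    ¬¬minimal N = go (length N) N ℕ.≤-refl
      where
      go : ∀ n N → length N ℕ.≤ n → Annihilates N → ¬ ¬ MinimalPolynomial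
      go zero    []      _         N-ann none = none record { M = [] ; annihilates = N-ann ; least =
          λ _ () }
      go (suc n) N       N≤n       N-ann none = none record
        { M = N ; annihilates = N-ann
        ; least = λ N′ N′<N N′-ann → go n N′ (s≤s⁻¹ (ℕ.<-≤-trans N′<N N≤n)) N′-ann none }

    -- A coefficient may vanish under `φ` without being the zero of S, so the leading coefficient is
    -- found by testing values from the top. N omits the leading 1, hence is strictly shorter than
    -- p.
    normalise : ∀ p → All (λ s → φ s ≈ 0#) p ⊎
      (∃[ N ] ∃[ c ] ∃[ c⁻¹ ] length N ℕ.< length p × φ c * φ c⁻¹ ≈ 1# ×
                  (∀ x → eval φ p x ≈ φ c * eval φ (monic S N) x))
    normalise [] = inj₁ []
    normalise (a ∷ p) with normalise p
    ... | inj₂ (N , c , c⁻¹ , N<p , cc⁻¹≈1 , p≈cN) = inj₂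
        (c⁻¹ S.* a ∷ N , c , c⁻¹ , s≤s N<p , cc⁻¹≈1 , λ x → begin
      φ a + x * eval φ p x
        ≈⟨ +-cong (≈-trans (≈-sym (*-identityˡ _)) (*-congʳ (≈-sym cc⁻¹≈1))) (*-congˡ (p≈cN x)) ⟩
      (φ c * φ c⁻¹) * φ a + x * (φ c * eval φ (monic S N) x)
        ≈⟨ solve 5 (λ c d a x n → (c :* d) :* a :+ x :* (c :* n) := c :* (d :* a :+ x :* n)) ≈-refl _ _
            _ _ _ ⟩
      φ c * (φ c⁻¹ * φ a + x * eval φ (monic S N) x)
        ≈⟨ *-congˡ (+-congʳ (Preserves.pres-* φ-pres c⁻¹ a)) ⟨
      φ c * (φ (c⁻¹ S.* a) + x * eval φ (monic S N) x) ∎)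
    ... | inj₁ p≈0 with φ a ≟ 0#
    ...   | yes a≈0 = inj₁ (a≈0 ∷ p≈0)
    ...   | no a≉0 = let a⁻¹ , aa⁻¹≈1 = invert a a≉0 in inj₂ ([] , a , a⁻¹ , s≤s z≤n , aa⁻¹≈1 , λ x → begin
      φ a + x * eval φ p x        ≈⟨ +-congˡ (*-congˡ (eval-map-zero φ p≈0 x)) ⟩
      φ a + x * 0#                ≈⟨ solve 2 (λ a x → a :+ x :* con 0ℤ := a :* (con 1ℤ :+ x :* con 0ℤ))
          ≈-refl (φ a) x ⟩
      φ a * (1# + x * 0#)         ≈⟨ *-congˡ (+-congʳ (Preserves.pres-1 φ-pres)) ⟨
      φ a * (φ S.1# + x * 0#)     ∎)

    module WithMinimal (minimal : MinimalPolynomial) where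
      open MinimalPolynomial minimal

      -- M lists only the coefficients below the leading 1, so a list no longer than M stays below
      -- the degree of the minimal polynomial. Made monic, it would contradict `least`.
      short-annihilator⇒zero : ∀ p → length p ℕ.≤ length M → eval φ p α ≈ 0# → All (λ s → φ s ≈ 0#) p
      short-annihilator⇒zero p p≤M pα≈0 with normalise p
      ... | inj₁ p≈0 = p≈0
      ... | inj₂ (N , c , _ , N<p , cc⁻¹≈1 , p≈cN) =
        ⊥-elim (least N (ℕ.<-≤-trans N<p p≤M) (x*y≈0 (≈-trans (≈-sym (p≈cN α)) pα≈0) (unit⇒≉0 cc⁻¹≈1)))

      module Reduce (p : List Source) where
        open Division S M p public

        division-at-root : ∀ {χ} → Preserves S χ → ∀ {x} → eval χ (monic S M) x ≈ 0# →
            eval χ p x ≈ eval χ R x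
        division-at-root {χ} χ-pres {x} Mx≈0 = begin
          eval χ p x                                         ≈⟨ division χ-pres x ⟩
          eval χ (monic S M) x * eval χ Q x + eval χ R x     ≈⟨ +-congʳ (*-congʳ Mx≈0) ⟩
          0# * eval χ Q x + eval χ R x                       ≈⟨ +-congʳ (zeroˡ _) ⟩
          0# + eval χ R x                                    ≈⟨ +-identityˡ _ ⟩
          eval χ R x                                         ∎

        exact : eval φ p α ≈ 0# → All (λ s → φ s ≈ 0#) R
        exact pα≈0 = short-annihilator⇒zero R R≤D (≈-trans (≈-sym (division-at-root φ-pres annihilates))
            pα≈0)

      φ-eval : ∀ p → Carrier
      φ-eval p = eval φ p α

      φ-eval-pres : Preserves S[X] φ-eval
      φ-eval-pres = eval-preserves S φ-pres α
      private module φ-eval = Preserves φ-eval-pres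

      -- The Euclidean algorithm applied to M and N.
      invert-monic : ∀ n N → length N ℕ.≤ n → length N ℕ.< length M →
          ∃[ q ] φ-eval (monic S N) * φ-eval q ≈ 1#
      invert-monic n [] _ _ = S[X].1# , ≈-trans (*-cong φ-eval.pres-1 φ-eval.pres-1) (*-identityˡ _)
      invert-monic (suc n) N@(_ ∷ N⁻) (s≤s N≤n) N<M = conclude (normalise R)
        where
        open Division S N (monic S M)
        N-inv = φ-eval (monic S N)
        MN : N-inv * φ-eval Q + φ-eval R ≈ 0#
        MN = ≈-trans (≈-sym (division φ-pres α)) annihilates

        -- The divisor has positive degree, so Q is shorter than the `length M` + 1 entries being
        -- divided.
        Q≤M : length Q ℕ.≤ length M
        Q≤M = ℕ.≤-trans (length-quotient S N n′ (monic S M))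
          (ℕ.≤-trans (ℕ.≤-reflexive (cong (ℕ._∸ length N)
              (≡.trans (List.length-++ M) (ℕ.+-comm (length M) 1))))
            (ℕ.m∸n≤m (length M) (length N⁻)))

        conclude : _ → ∃[ q ] N-inv * φ-eval q ≈ 1#
        -- N is shorter than M, so it does not annihilate α; with remainder zero, Q would. But Q is
        -- too short for that unless it is zero, and then the minimal polynomial would vanish
        -- everywhere.
        conclude (inj₁ R≈0) = ⊥-elim (monic-nonvanishing φ-pres M λ x → begin
          eval φ (monic S M) x                             ≈⟨ division φ-pres x ⟩
          eval φ (monic S N) x * eval φ Q x + eval φ R x  
              ≈⟨ +-cong (*-congˡ (eval-map-zero φ Q≈0 x)) (eval-map-zero φ R≈0 x) ⟩
          eval φ (monic S N) x * 0# + 0#                   ≈⟨ ≈-trans (+-identityʳ _) (zeroʳ _) ⟩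
          0#                                               ∎)
          where
          Q≈0 = short-annihilator⇒zero Q Q≤M (x*y≈0 (begin
            N-inv * φ-eval Q                 ≈⟨ +-identityʳ _ ⟨
            N-inv * φ-eval Q + 0#            ≈⟨ +-congˡ (eval-map-zero φ R≈0 α) ⟨
            N-inv * φ-eval Q + φ-eval R      ≈⟨ MN ⟩
            0#                               ∎) (least N N<M))
        -- At α one has N Q = - R = - c N′ and N′ q′ = 1, so the inverse of N is - Q q′ c⁻¹.
        conclude (inj₂ (N′ , c , c⁻¹ , N′<R , cc⁻¹≈1 , R≈cN′)) =
          S[X].- (Q S[X].* r) , (begin
            N-inv * φ-eval (S[X].- (Q S[X].* r))
              ≈⟨ *-congˡ (≈-trans (φ-eval.pres-neg (Q S[X].* r)) (-‿cong (≈-trans (φ-eval.pres-* Q r)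
                   (*-congˡ (≈-trans (φ-eval.pres-* q′ (c⁻¹ ∷ []))
                       (*-congˡ (eval-constant S φ-pres c⁻¹ α))))))) ⟩
            N-inv * - (φ-eval Q * (φ-eval q′ * φ c⁻¹))
              ≈⟨ solve 5 (λ n q q′ d r → n :* (:- (q :* (q′ :* d))) := r :* (q′ :* d) :- (n :* q :+ r)
                  :* (q′ :* d)) ≈-refl _ _ _ _ (φ-eval R) ⟩
            φ-eval R * (φ-eval q′ * φ c⁻¹) - (N-inv * φ-eval Q + φ-eval R) * (φ-eval q′ * φ c⁻¹)
              ≈⟨ +-cong (*-congʳ (R≈cN′ α)) (-‿cong (*-congʳ MN)) ⟩
            (φ c * φ-eval (monic S N′)) * (φ-eval q′ * φ c⁻¹) - 0# * (φ-eval q′ * φ c⁻¹)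
              ≈⟨ solve 4 (λ c n q d → (c :* n) :* (q :* d) :- con 0ℤ :* (q :* d) := (c :* d) :*
                  (n :* q)) ≈-refl _ _ _ _ ⟩
            (φ c * φ c⁻¹) * (φ-eval (monic S N′) * φ-eval q′)
              ≈⟨ ≈-trans (*-cong cc⁻¹≈1 N′q′≈1) (*-identityˡ _) ⟩
            1# ∎)
          where
          N′<N = ℕ.<-≤-trans N′<R R≤D
          smaller = invert-monic n N′ (ℕ.≤-trans (s≤s⁻¹ N′<N) N≤n) (ℕ.<-trans N′<N N<M)
          q′ = proj₁ smaller
          r  = q′ S[X].* (c⁻¹ ∷ [])
          N′q′≈1 = proj₂ smaller

      invert-eval : ∀ p → φ-eval p ≉ 0# → ∃[ q ] φ-eval p * φ-eval q ≈ 1#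
      invert-eval p pα≉0 = conclude (normalise R)
        where
        open Reduce p
        conclude : _ → ∃[ q ] φ-eval p * φ-eval q ≈ 1#
        conclude (inj₁ R≈0) =
          ⊥-elim (pα≉0 (≈-trans (division-at-root φ-pres annihilates) (eval-map-zero φ R≈0 α)))
        conclude (inj₂ (N , c , c⁻¹ , N<R , cc⁻¹≈1 , R≈cN)) with invert-monic (length N) N ℕ.≤-refl
            (ℕ.<-≤-trans N<R R≤D)
        ... | q , Nq≈1 = q S[X].* (c⁻¹ ∷ []) , (begin
          φ-eval p * φ-eval (q S[X].* (c⁻¹ ∷ []))
            ≈⟨ *-cong (≈-trans (division-at-root φ-pres annihilates) (R≈cN α))
                 (≈-trans (φ-eval.pres-* q (c⁻¹ ∷ [])) (*-congˡ (eval-constant S φ-pres c⁻¹ α))) ⟩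
          (φ c * φ-eval (monic S N)) * (φ-eval q * φ c⁻¹)
            ≈⟨ solve 4 (λ c n q d → (c :* n) :* (q :* d) := (c :* d) :* (n :* q)) ≈-refl _ _ _ _ ⟩
          (φ c * φ c⁻¹) * (φ-eval (monic S N) * φ-eval q)
            ≈⟨ ≈-trans (*-cong cc⁻¹≈1 Nq≈1) (*-identityˡ _) ⟩
          1# ∎)

      -- Well defined: if p(α) = 0, the remainder of p modulo M has coefficients that vanish under
      -- `φ`, hence under `ψ`. So the conjugate of p vanishes wherever that of M does.
      adjoin : ∀ β → eval ψ (monic S M) β ≈ 0# → PartialIso
      adjoin β Mβ≈0 = record
        { S        = S[X]
        ; φ        = φ-eval
        ; ψ        = λ p → eval ψ p β
        ; φ-pres   = φ-eval-pres
        ; ψ-pres   = eval-preserves S ψ-pres β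
        ; kernel   = λ p pα≈0 → let open Reduce p in ≈-trans (division-at-root ψ-pres Mβ≈0)
                       (eval-map-zero ψ (All.map (kernel _) (exact pα≈0)) β)
        ; invert   = invert-eval
        ; scalar   = λ q → scalar q ∷ []
        ; φ-scalar = λ q → ≈-trans (eval-constant S φ-pres _ α) (φ-scalar q)
        ; ψ-scalar = λ q → ≈-trans (eval-constant S ψ-pres _ β) (ψ-scalar q)
        }

      factor : ∀ p → φ-eval p ≈ 0# → ∃[ Q ] length Q ℕ.≤ length p ℕ.∸ length M ×
               (∀ x → eval ψ p x ≈ eval ψ (monic S M) x * eval ψ Q x)
      factor p pα≈0 = Q , length-quotient S M n′ p , λ x → ≈-trans (division ψ-pres x)
          (≈-trans (+-congˡ (eval-map-zero ψ (All.map (kernel _) (exact pα≈0)) x)) (+-identityʳ _))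
        where open Reduce p

      -- Under `ψ`, F becomes the product of M and a quotient Q. If no entry of `rs` were a root of
      -- M, all would be roots of Q, whose length is at most `length F` + 1 - `length M` and so at
      -- most their number. Then Q, and with it F, would vanish everywhere.
      conjugate-exists : ∀ F → Annihilates F → ∀ rs → length F ℕ.< length rs ℕ.+ length M →
          AllPairs _≉_ rs →
        All (λ r → eval ψ (monic S F) r ≈ 0#) rs → Any (λ r → eval ψ (monic S M) r ≈ 0#) rs
      conjugate-exists F F-ann rs F<rs+M rs! Frs≈0
        with Any.any? (λ r → eval ψ (monic S M) r ≟ 0#) rs | factor (monic S F) F-ann
      ... | yes found | _ = found
      ... | no none   | Q , Q≤ , F≈MQ = ⊥-elim (monic-nonvanishing ψ-pres F λ x →
        ≈-trans (F≈MQ x) (≈-trans (*-congˡ (eval-map-zero ψ Q≈0 x)) (zeroʳ _)))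
        where
        Q≈0 : All (λ s → ψ s ≈ 0#) Q
        Q≈0 = All.map⁻ (many-roots⇒zero (map ψ Q) rs
          (ℕ.≤-trans (ℕ.≤-reflexive (List.length-map ψ Q))
              (ℕ.≤-trans Q≤ (ℕ.m≤n+o⇒m∸n≤o (length (monic S F)) (length M)
            (ℕ.≤-trans (ℕ.≤-reflexive (≡.trans (List.length-++ F) (ℕ.+-comm (length F) 1)))
              (ℕ.≤-trans F<rs+M (ℕ.≤-reflexive (ℕ.+-comm (length rs) (length M))))))))
          rs!
          (All.map (λ {r} (Mr≉0 , Fr≈0) → ≈-trans (≈-reflexive (eval-map id ψ Q r))
              (x*y≈0 (≈-trans (≈-sym (F≈MQ r)) Fr≈0) Mr≉0))
            (All.zip (All.¬Any⇒All¬ rs none , Frs≈0))))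

-- Automorphisms of a splitting field

module Automorphisms (E : Extension) where
  open Field E
  open Evaluation E
  open RootCounting E
  open Extending E

  rationals : PartialIso
  rationals = record
    { S        = ℚ.+-*-rawRing
    ; φ        = ι
    ; ψ        = ι
    ; φ-pres   = ι-preserves
    ; ψ-pres   = ι-preserves
    ; kernel   = λ _ → id
    ; invert   = λ q ιq≉0 → invert q ιq≉0
    ; scalar   = id
    ; φ-scalar = λ _ → ≈-refl
    ; ψ-scalar = λ _ → ≈-refl
    }
    where
    ι-preserves : Preserves ℚ.+-*-rawRing ι
    ι-preserves = record { pres-+ = ι-+ ; pres-* = ι-* ; pres-neg = ι-neg ; pres-0 = ι-0 ; pres-1 =
        ι-1 }
    invert : ∀ q → ι q ≉ 0# → ∃[ r ] ι q * ι r ≈ 1#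
    invert q ιq≉0 = ℚ.1/ q , ≈-trans (≈-sym (ι-* q _)) (≈-trans (ι-cong (ℚ.*-inverseʳ q)) ι-1)
      where instance nonZero = ℚ.≢-nonZero λ q≡0 → ιq≉0 (≈-trans (ι-cong q≡0) ι-0)

  infix 4 _⊑_
  record _⊑_ (T T′ : PartialIso) : Set where
    private
      module T  = PartialIso T
      module T′ = PartialIso T′
    field
      embed   : T.Source → T′.Source
      φ-embed : ∀ s → T′.φ (embed s) ≈ T.φ s
      ψ-embed : ∀ s → T′.ψ (embed s) ≈ T.ψ s

  ⊑-refl : ∀ {T} → T ⊑ T
  ⊑-refl = record { embed = id ; φ-embed = λ _ → ≈-refl ; ψ-embed = λ _ → ≈-refl }

  ⊑-trans : ∀ {T U V} → T ⊑ U → U ⊑ V → T ⊑ V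
  ⊑-trans T⊑U U⊑V = record
    { embed   = V.embed ∘ U.embed
    ; φ-embed = λ s → ≈-trans (V.φ-embed _) (U.φ-embed s)
    ; ψ-embed = λ s → ≈-trans (V.ψ-embed _) (U.ψ-embed s)
    }
    where
    module U = _⊑_ T⊑U
    module V = _⊑_ U⊑V

  module SplittingField (F : List ℚ) (rs : List Carrier)
    (rs! : AllPairs _≉_ rs) (length-rs : length rs ≡ length F)
    (f≈0 : All (λ r → eval ι (monic ℚ.+-*-rawRing F) r ≈ 0#) rs)
    (generated : ∀ x → Generated E (λ y → Any (y ≈_) rs) x)
    where

    f : List ℚ
    f = monic ℚ.+-*-rawRing F

    Root : Carrier → Set
    Root r = eval ι f r ≈ 0#

    module _ (T : PartialIso) where
      open PartialIso T

      F-over : List Source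
      F-over = map scalar F

      eval-F-over : ∀ {χ} → Preserves S χ → (∀ q → χ (scalar q) ≈ ι q) → ∀ x →
          eval χ (monic S F-over) x ≈ eval ι f x
      eval-F-over {χ} χ-pres χ-scalar x = begin
        eval χ (monic S F-over) x              ≈⟨ eval-monic S χ-pres F-over x ⟩
        eval χ F-over x + x ^ length F-over    ≡⟨ ≡.cong₂ (λ y n → y + x ^ n) (eval-map χ scalar F x)
            (List.length-map scalar F) ⟩
        eval (χ ∘ scalar) F x + x ^ length F   ≈⟨ +-congʳ (eval-ext (χ ∘ scalar) ι χ-scalar F x) ⟩
        eval ι F x + x ^ length F              ≈⟨ eval-monic ℚ.+-*-rawRing (PartialIso.φ-pres rationals)
            F x ⟨
        eval ι f x                             ∎

      open Adjoin T

      ¬¬minimalPolynomial : ∀ {α} → Root α → ¬ ¬ MinimalPolynomial α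
      ¬¬minimalPolynomial {α} fα≈0 = ¬¬minimal α F-over (≈-trans (eval-F-over φ-pres φ-scalar α) fα≈0)

      degree-positive : ∀ {α} (min : MinimalPolynomial α) → 1 ℕ.≤ length (MinimalPolynomial.M min)
      degree-positive {α} record { M = [] ; annihilates = 1≈0 } =
        ⊥-elim (0≉1 (≈-trans (≈-sym 1≈0) (≈-trans (eval-constant S φ-pres (RawRing.1# S) α)
            (Preserves.pres-1 φ-pres))))
      degree-positive record { M = _ ∷ _ } = s≤s z≤n

      conjugate : ∀ {α} (min : MinimalPolynomial α) → Root α → ∀ ss →
          length F ℕ.< length ss ℕ.+ length (MinimalPolynomial.M min) →
        AllPairs _≉_ ss → All Root ss → Any (λ r → eval ψ (monic S (MinimalPolynomial.M min)) r ≈ 0#) ss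
      conjugate {α} min fα≈0 ss F<ss+M ss! fss≈0 = WithMinimal.conjugate-exists α min F-over
        (≈-trans (eval-F-over φ-pres φ-scalar α) fα≈0) ss
        (ℕ.≤-<-trans (ℕ.≤-reflexive (List.length-map scalar F)) F<ss+M) ss!
        (All.map (λ {r} fr≈0 → ≈-trans (eval-F-over ψ-pres ψ-scalar r) fr≈0) fss≈0)

      ⊑-adjoin : ∀ {α} (min : MinimalPolynomial α) {β} (Mβ≈0 : _) → T ⊑ WithMinimal.adjoin α min β Mβ≈0
      ⊑-adjoin {α} min {β} Mβ≈0 = record
        { embed   = _∷ []
        ; φ-embed = λ s → eval-constant S φ-pres s α
        ; ψ-embed = λ s → eval-constant S ψ-pres s β
        }

      eval-X : ∀ {χ} → Preserves S χ → ∀ x → eval χ (RawRing.0# S ∷ RawRing.1# S ∷ []) x ≈ x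
      eval-X χ-pres x = ≈-trans (+-cong (Preserves.pres-0 χ-pres)
          (*-congˡ (+-congʳ (Preserves.pres-1 χ-pres))))
        (solve 1 (λ x → con 0ℤ :+ x :* (con 1ℤ :+ x :* con 0ℤ) := x) ≈-refl x)

    -- The image, too, has to be a root of f: distinct roots then have distinct images among the
    -- roots, and this makes the extended map surjective.
    Matched : PartialIso → Carrier → Set
    Matched T α = ∃[ s ] PartialIso.φ T s ≈ α × Root (PartialIso.ψ T s)

    root-cong : ∀ {x y} → x ≈ y → Root x → Root y
    root-cong x≈y fx≈0 = ≈-trans (≈-sym (eval-cong ι f x≈y)) fx≈0

    Matched-⊑ : ∀ {T T′} → T ⊑ T′ → ∀ {α} → Matched T α → Matched T′ α
    Matched-⊑ T⊑T′ (s , φs≈α , fψs≈0) =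
      embed s , ≈-trans (φ-embed s) φs≈α , root-cong (≈-sym (ψ-embed s)) fψs≈0
      where open _⊑_ T⊑T′

    match-root : ∀ T {α} → Root α → ¬ ¬ (∃[ T′ ] T ⊑ T′ × Matched T′ α)
    match-root T {α} fα≈0 none = ¬¬minimalPolynomial T fα≈0 λ min →
      -- There are as many candidates as the degree of f, and M has positive degree; this is just
      -- enough for the root count.
      let found = conjugate T min fα≈0 rs
            (ℕ.≤-trans (ℕ.≤-reflexive (≡.trans (cong suc (≡.sym length-rs)) (ℕ.+-comm 1 _)))
              (ℕ.+-monoʳ-≤ (length rs) (degree-positive T min))) rs! f≈0
          β = Any.lookup found
          fβ≈0 , Mβ≈0 = All.lookupAny f≈0 found
      in none (_ , ⊑-adjoin T min Mβ≈0 ,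
               (RawRing.0# (PartialIso.S T) ∷ RawRing.1# (PartialIso.S T) ∷ [] , eval-X T
                   (PartialIso.φ-pres T) α , root-cong (≈-sym (eval-X T (PartialIso.ψ-pres T) β)) fβ≈0))

    match-roots : ∀ T {αs} → All Root αs → ¬ ¬ (∃[ T′ ] T ⊑ T′ × All (Matched T′) αs)
    match-roots T []           none = none (T , ⊑-refl , [])
    match-roots T (fα≈0 ∷ fαs≈0) none = match-root T fα≈0 λ (T′ , T⊑T′ , α-matched) →
      match-roots T′ fαs≈0 λ (T″ , T′⊑T″ , αs-matched) →
      none (T″ , ⊑-trans T⊑T′ T′⊑T″ , Matched-⊑ T′⊑T″ α-matched ∷ αs-matched)

    module _ (T : PartialIso) (matched : All (Matched T) rs) where
      open PartialIso T
      private
        module S = RawRing S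
        module φ = Preserves φ-pres
        module ψ = Preserves ψ-pres

      φ⇒ψ : ∀ {s t} → φ s ≈ φ t → ψ s ≈ ψ t
      φ⇒ψ {s} {t} φs≈φt = x-y≈0⇒x≈y (begin
        ψ s - ψ t            ≈⟨ ≈-trans (ψ.pres-+ s (S.- t)) (+-congˡ (ψ.pres-neg t)) ⟨
        ψ (s S.+ S.- t)      ≈⟨ kernel _ (≈-trans (φ.pres-+ s (S.- t))
            (≈-trans (+-congˡ (φ.pres-neg t)) (x≈y⇒x-y≈0 φs≈φt))) ⟩
        0#                   ∎)

      φ⇒ψ-inverse : ∀ {s t} → φ s * φ t ≈ 1# → ψ s * ψ t ≈ 1#
      φ⇒ψ-inverse {s} {t} φsφt≈1 = begin
        ψ s * ψ t    ≈⟨ ψ.pres-* s t ⟨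
        ψ (s S.* t)  ≈⟨ φ⇒ψ (≈-trans (φ.pres-* s t) (≈-trans φsφt≈1 (≈-sym φ.pres-1))) ⟩
        ψ S.1#       ≈⟨ ψ.pres-1 ⟩
        1#           ∎

      ψ-kernel : ∀ s → ψ s ≈ 0# → φ s ≈ 0#
      ψ-kernel s ψs≈0 with φ s ≟ 0#
      ... | yes φs≈0 = φs≈0
      ... | no φs≉0  = ⊥-elim (unit⇒≉0 (φ⇒ψ-inverse (proj₂ (invert s φs≉0))) ψs≈0)

      ψ⇒φ : ∀ {s t} → ψ s ≈ ψ t → φ s ≈ φ t
      ψ⇒φ {s} {t} ψs≈ψt = x-y≈0⇒x≈y (begin
        φ s - φ t            ≈⟨ ≈-trans (φ.pres-+ s (S.- t)) (+-congˡ (φ.pres-neg t)) ⟨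
        φ (s S.+ S.- t)      ≈⟨ ψ-kernel _ (≈-trans (ψ.pres-+ s (S.- t))
            (≈-trans (+-congˡ (ψ.pres-neg t)) (x≈y⇒x-y≈0 ψs≈ψt))) ⟩
        0#                   ∎)

      inverse-unique : ∀ {x y z} → x * y ≈ 1# → x * z ≈ 1# → z ≈ y
      inverse-unique {x} {y} {z} xy≈1 xz≈1 = begin
        z            ≈⟨ ≈-trans (*-congˡ xy≈1) (*-identityʳ z) ⟨
        z * (x * y)  ≈⟨ solve 3 (λ x y z → z :* (x :* y) := (x :* z) :* y) ≈-refl x y z ⟩
        (x * z) * y  ≈⟨ ≈-trans (*-congʳ xz≈1) (*-identityˡ y) ⟩
        y            ∎

      -- The image of χ is a subfield, since the inverses that exist within it are those of the
      -- whole field. It contains ℚ and the roots, which generate everything.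
      images-cover : (χ : Source → Carrier) → Preserves S χ → (∀ q → χ (scalar q) ≈ ι q) →
        (∀ s → χ s ≉ 0# → ∃[ t ] χ s * χ t ≈ 1#) → All (λ r → ∃[ s ] χ s ≈ r) rs → ∀ x → ∃[ s ] χ s ≈ x
      images-cover χ χ-pres χ-scalar χ-invert χ-roots x = go (generated x)
        where
        module χ = Preserves χ-pres
        go : ∀ {x} → Generated E (λ y → Any (y ≈_) rs) x → ∃[ s ] χ s ≈ x
        go (base q) = scalar q , χ-scalar q
        go (gen x∈rs) with All.lookupAny χ-roots x∈rs
        ... | (s , χs≈r) , x≈r = s , ≈-trans χs≈r (≈-sym x≈r)
        go (add x y) = let s , χs≈x = go x ; t , χt≈y = go y in s S.+ t , ≈-trans (χ.pres-+ s t) (+-cong χs≈x χt≈y)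
        go (mul x y) = let s , χs≈x = go x ; t , χt≈y = go y in s S.* t , ≈-trans (χ.pres-* s t) (*-cong χs≈x χt≈y)
        go (neg x) = let s , χs≈x = go x in S.- s , ≈-trans (χ.pres-neg s) (-‿cong χs≈x)
        go (inv x xy≈1) =
          let s , χs≈x = go x
              t , χsχt≈1 = χ-invert s λ χs≈0 → unit⇒≉0 xy≈1 (≈-trans (≈-sym χs≈x) χs≈0)
          in t , inverse-unique xy≈1 (≈-trans (*-congʳ (≈-sym χs≈x)) χsχt≈1)
        go (resp x≈y x) = let s , χs≈x = go x in s , ≈-trans χs≈x x≈y

      φ-surjective : ∀ x → ∃[ s ] φ s ≈ x
      φ-surjective = images-cover φ φ-pres φ-scalar invert
          (All.map (λ (s , φs≈r , _) → s , φs≈r) matched)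

      sources : ∀ {xs} → All (Matched T) xs → List Source
      sources = All.reduce proj₁

      length-sources : ∀ {xs} (ms : All (Matched T) xs) → length (map ψ (sources ms)) ≡ length xs
      length-sources []       = refl
      length-sources (_ ∷ ms) = cong suc (length-sources ms)

      sources-distinct : ∀ {xs} → AllPairs _≉_ xs → (ms : All (Matched T) xs) →
          AllPairs _≉_ (map ψ (sources ms))
      sources-distinct []             []                  = []
      sources-distinct (x∉xs ∷ xs!) ((s , φs≈x , _) ∷ ms) = fresh x∉xs ms ∷ sources-distinct xs! ms
        where
        fresh : ∀ {xs} → All (_ ≉_) xs → (ms : All (Matched T) xs) → All (ψ s ≉_) (map ψ (sources ms))
        fresh []             []                    = []
        fresh (x≉y ∷ x∉xs) ((t , φt≈y , _) ∷ ms) =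
          (λ ψs≈ψt → x≉y (≈-trans (≈-sym φs≈x) (≈-trans (ψ⇒φ ψs≈ψt) φt≈y))) ∷ fresh x∉xs ms

      sources-roots : ∀ {xs} (ms : All (Matched T) xs) → All Root (map ψ (sources ms))
      sources-roots []                    = []
      sources-roots ((_ , _ , fψs≈0) ∷ ms) = fψs≈0 ∷ sources-roots ms

      -- Otherwise r and the images under ψ would be too many roots of f.
      ψ-root : ∀ {r} → Root r → ∃[ s ] ψ s ≈ r
      ψ-root {r} fr≈0 with Any.any? (λ s → ψ s ≟ r) (sources matched)
      ... | yes found = Any.satisfied found
      ... | no none = ⊥-elim (monic-nonvanishing (PartialIso.φ-pres rationals) F λ x →
        eval-map-zero ι (All.map⁻ (many-roots⇒zero (map ι f) (r ∷ map ψ (sources matched))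
          (ℕ.≤-reflexive (≡.trans (List.length-map ι f) (≡.trans (List.length-++ F)
              (≡.trans (ℕ.+-comm (length F) 1)
            (cong suc (≡.sym (≡.trans (length-sources matched) length-rs)))))))
          (All.map⁺ (All.map (λ ψs≉r r≈ψs → ψs≉r (≈-sym r≈ψs)) (All.¬Any⇒All¬ _ none)) ∷
              sources-distinct rs! matched)
          (All.map (λ {y} fy≈0 → ≈-trans (≈-reflexive (eval-map id ι f y)) fy≈0)
              (fr≈0 ∷ sources-roots matched)))) x)

      ψ-surjective : ∀ x → ∃[ s ] ψ s ≈ x
      ψ-surjective = images-cover ψ ψ-pres ψ-scalar
        (λ s ψs≉0 → let t , φsφt≈1 = invert s (λ φs≈0 → ψs≉0 (kernel s φs≈0)) in t , φ⇒ψ-inverse φsφt≈1)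
        (All.map ψ-root f≈0)

      σ : Carrier → Carrier
      σ x = ψ (proj₁ (φ-surjective x))

      σ≈ψ : ∀ {x} s → φ s ≈ x → σ x ≈ ψ s
      σ≈ψ {x} s φs≈x = φ⇒ψ (≈-trans (proj₂ (φ-surjective x)) (≈-sym φs≈x))

      automorphism : Automorphism E
      automorphism = record
        { ⟦_⟧               = σ
        ; isRingIsomorphism = record
          { isRingMonomorphism = record
            { isRingHomomorphism = record
              { isSemiringHomomorphism = record
                { isNearSemiringHomomorphism = record
                  { +-isMonoidHomomorphism = record
                    { isMagmaHomomorphism = record
                      { isRelHomomorphism = record { cong = λ {x} {y} x≈y →
                          σ≈ψ _ (≈-trans (φσ y) (≈-sym x≈y)) }
                      ; homo = λ x y → ≈-trans
                          (σ≈ψ (s x S.+ s y) (≈-trans (φ.pres-+ _ _) (+-cong (φσ x) (φσ y))))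
                              (ψ.pres-+ _ _)
                      }
                    ; ε-homo = ≈-trans (σ≈ψ S.0# φ.pres-0) ψ.pres-0
                    }
                  ; *-homo = λ x y → ≈-trans
                      (σ≈ψ (s x S.* s y) (≈-trans (φ.pres-* _ _) (*-cong (φσ x) (φσ y)))) (ψ.pres-* _ _)
                  }
                ; 1#-homo = ≈-trans (σ≈ψ S.1# φ.pres-1) ψ.pres-1
                }
              ; -‿homo = λ x → ≈-trans (σ≈ψ (S.- s x) (≈-trans (φ.pres-neg _) (-‿cong (φσ x))))
                  (ψ.pres-neg _)
              }
            ; injective = λ {x} {y} σx≈σy → ≈-trans (≈-sym (φσ x)) (≈-trans (ψ⇒φ σx≈σy) (φσ y))
            }
          ; surjective = λ y → φ (proj₁ (ψ-surjective y)) , λ z≈x →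
              ≈-trans (σ≈ψ _ (≈-sym z≈x)) (proj₂ (ψ-surjective y))
          }
        ; fixesℚ            = λ q → ≈-trans (σ≈ψ (scalar q) (φ-scalar q)) (ψ-scalar q)
        }
        where
        s : Carrier → Source
        s x = proj₁ (φ-surjective x)
        φσ : ∀ x → φ (s x) ≈ x
        φσ x = proj₂ (φ-surjective x)

    open Automorphism using (⟦_⟧)

    extends : ∀ T → ¬ ¬ (∃[ σ ] ∀ s → ⟦_⟧ {E} σ (PartialIso.φ T s) ≈ PartialIso.ψ T s)
    extends T none = match-roots T f≈0 λ (T′ , T⊑T′ , matched) →
      let open _⊑_ T⊑T′ in
      none (automorphism T′ matched , λ s → ≈-trans (σ≈ψ T′ matched (embed s) (φ-embed s)) (ψ-embed s))

    -- An element outside ℚ(θ) has a minimal polynomial of degree at least two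
    -- over ℚ(θ), hence a second conjugate.
    moves : ∀ {θ α} → Root θ → Root α → ¬ Generated E (_≈ θ) α →
            ∀ ss → length rs ≡ suc (length ss) → AllPairs _≉_ ss → All Root ss → All (_≉ α) ss →
            ¬ ¬ (∃[ σ ] ⟦_⟧ {E} σ θ ≈ θ × ⟦_⟧ {E} σ α ≉ α)
    moves {θ} {α} fθ≈0 fα≈0 α∉ℚ⟨θ⟩ ss rs-ss ss! fss≈0 α∉ss none =
      ¬¬minimalPolynomial rationals fθ≈0 λ θ-min →
      -- T is the identity of ℚ(θ), as θ is sent to itself.
      let T = Adjoin.WithMinimal.adjoin rationals θ θ-min θ (Adjoin.MinimalPolynomial.annihilates θ-min)
          open PartialIso T
      in ¬¬minimalPolynomial T fα≈0 λ α-min →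
      let M = Adjoin.MinimalPolynomial.M α-min
          -- The list `ss` has one root fewer than f, as it avoids α; that M has degree at least 2
          -- makes up for this.
          found = conjugate T α-min fα≈0 ss (ℕ.≤-trans (ℕ.≤-reflexive
              (≡.trans (cong suc (≡.trans (≡.sym length-rs) rs-ss)) (ℕ.+-comm 2 _)))
            (ℕ.+-monoʳ-≤ (length ss) (degree T φ-in-ℚ⟨θ⟩ α-min))) ss! fss≈0
          β = Any.lookup found
          β≉α , Mβ≈0 = All.lookupAny α∉ss found
          T′ = Adjoin.WithMinimal.adjoin T α α-min β Mβ≈0
          open _⊑_ (⊑-adjoin T α-min Mβ≈0)
          X = RawRing.0# ℚ.+-*-rawRing ∷ RawRing.1# ℚ.+-*-rawRing ∷ []
          Y = RawRing.0# S ∷ RawRing.1# S ∷ []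
      in extends T′ λ (σ , σφ≈ψ) →
      let σ-cong = Automorphism.⟦⟧-cong σ
          T-θ = eval-X rationals (PartialIso.φ-pres rationals) θ
      in none (σ , ≈-trans (σ-cong (≈-trans (≈-sym T-θ) (≈-sym (φ-embed X))))
          (≈-trans (σφ≈ψ (embed X)) (≈-trans (ψ-embed X) T-θ)) ,
        λ σα≈α → β≉α (≈-trans (≈-sym (≈-trans (σ-cong (≈-sym (eval-X T φ-pres α)))
            (≈-trans (σφ≈ψ Y) (eval-X T ψ-pres β)))) σα≈α))
      where
      φ-in-ℚ⟨θ⟩ : ∀ p → Generated E (_≈ θ) (eval ι p θ)
      φ-in-ℚ⟨θ⟩ []      = resp ι-0 (base 0ℚ)
      φ-in-ℚ⟨θ⟩ (q ∷ p) = add (base q) (mul (gen ≈-refl) (φ-in-ℚ⟨θ⟩ p))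

      -- If M were linear, say X + b, then α = - b would lie in ℚ(θ).
      degree : ∀ T → (∀ s → Generated E (_≈ θ) (PartialIso.φ T s)) →
               (min : Adjoin.MinimalPolynomial T α) → 2 ℕ.≤ length (Adjoin.MinimalPolynomial.M min)
      degree T φ∈ min with Adjoin.MinimalPolynomial.M min | degree-positive T min |
          Adjoin.MinimalPolynomial.annihilates min
      ... | b ∷ []    | _ | b+α≈0 = ⊥-elim (α∉ℚ⟨θ⟩ (resp (begin
        - φ b                                             
            ≈⟨ solve 2 (λ b α → :- b := α :- (b :+ α :* (con 1ℤ :+ α :* con 0ℤ))) ≈-refl (φ b) α ⟩
        α - (φ b + α * (1# + α * 0#))                     
            ≈⟨ +-congˡ (-‿cong (≈-trans (+-congˡ (*-congˡ (+-congʳ (≈-sym (Preserves.pres-1 φ-pres)))))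
            b+α≈0)) ⟩
        α - 0#                                             ≈⟨ ≈-trans (+-congˡ -0#≈0#) (+-identityʳ α) ⟩
        α ∎) (neg (φ∈ b))))
        where open PartialIso T
      ... | _ ∷ _ ∷ _ | _ | _ = s≤s (s≤s z≤n)

-- Conjugacy of the roots of an irreducible polynomial

module Conjugates (E : Extension) where
  open Field E
  open Evaluation E
  open RootCounting E
  open Extending E
  open Automorphisms E
  open ℚ[X] using (Poly; coeff; _≈ₚ_; _+ₚ_; _*ₚ_; 1ₚ)
  open RawSemiringDefinitions ℚ[X].polyRawSemiring using (Irreducible; _∣_)

  private
    ℚᴿ : RawRing 0ℓ 0ℓ
    ℚᴿ = ℚ.+-*-rawRing
    ι-pres : Preserves ℚᴿ ι
    ι-pres = PartialIso.φ-pres rationals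

  zero-coefficients : ∀ p → (∀ n → coeff p n ≡ 0ℚ) → ∀ x → eval ι p x ≈ 0#
  zero-coefficients []      p≡0 x = ≈-refl
  zero-coefficients (a ∷ p) p≡0 x = begin
    ι a + x * eval ι p x  ≈⟨ +-cong (≈-trans (ι-cong (p≡0 0)) ι-0)
        (*-congˡ (zero-coefficients p (p≡0 ∘ suc) x)) ⟩
    0# + x * 0#           ≈⟨ solve 1 (λ x → con 0ℤ :+ x :* con 0ℤ := con 0ℤ) ≈-refl x ⟩
    0#                    ∎

  eval-≈ₚ : ∀ p q → p ≈ₚ q → ∀ x → eval ι p x ≈ eval ι q x
  eval-≈ₚ []      q       p≈q x = ≈-sym (zero-coefficients q (≡.sym ∘ p≈q) x)
  eval-≈ₚ (a ∷ p) []      p≈q x = zero-coefficients (a ∷ p) p≈q x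
  eval-≈ₚ (a ∷ p) (b ∷ q) p≈q x = +-cong (ι-cong (p≈q 0)) (*-congˡ (eval-≈ₚ p q (p≈q ∘ suc) x))

  difference-zero : ∀ p q → All (_≡ 0ℚ) (p +ₚ map ℚ.-_ q) → p ≈ₚ q
  difference-zero []      []      _                _       = refl
  difference-zero []      (b ∷ q) (-b≡0 ∷ _)       zero    = ≡.sym (ℚ.neg-injective -b≡0)
  difference-zero []      (b ∷ q) (_ ∷ -q≡0)       (suc n) = difference-zero [] q -q≡0 n
  difference-zero (a ∷ p) []      (a≡0 ∷ _)        zero    = a≡0
  difference-zero (a ∷ p) []      (_ ∷ p≡0)        (suc n) = zero-list p p≡0 n
    where
    zero-list : ∀ p → All (_≡ 0ℚ) p → ∀ n → coeff p n ≡ 0ℚ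
    zero-list []      _           _       = refl
    zero-list (a ∷ p) (a≡0 ∷ _)   zero    = a≡0
    zero-list (a ∷ p) (_ ∷ p≡0)   (suc n) = zero-list p p≡0 n
  difference-zero (a ∷ p) (b ∷ q) (a-b≡0 ∷ _)      zero    =
      RingProperties.x∙y⁻¹≈ε⇒x≈y (CommutativeRing.ring ℚ.+-*-commutativeRing) a b a-b≡0
  difference-zero (a ∷ p) (b ∷ q) (_ ∷ p-q≡0)      (suc n) = difference-zero p q p-q≡0 n

  -- Irreducibility speaks of coefficients, whereas division yields identities of values. Over an
  -- infinite field the two agree.
  eval⇒≈ₚ : ∀ p q → (∀ x → eval ι p x ≈ eval ι q x) → p ≈ₚ q
  eval⇒≈ₚ p q p≈q = difference-zero p q (All.map ι-injective-0 (vanishing⇒zero ι (p +ₚ map ℚ.-_ q) λ x →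
      begin
    eval ι (p +ₚ map ℚ.-_ q) x           ≈⟨ eval-+ₚ ℚᴿ ι-pres p (map ℚ.-_ q) x ⟩
    eval ι p x + eval ι (map ℚ.-_ q) x   ≈⟨ +-cong (p≈q x) (eval-neg ℚᴿ ι-pres q x) ⟩
    eval ι q x - eval ι q x              ≈⟨ x≈y⇒x-y≈0 ≈-refl ⟩
    0#                                   ∎))

  unit-nonvanishing : ∀ {p} → p ∣ 1ₚ → ∀ x → eval ι p x ≉ 0#
  unit-nonvanishing {p} p∣1 x = unit⇒≉0 (begin
    eval ι p x * eval ι q x   ≈⟨ *-comm _ _ ⟩
    eval ι q x * eval ι p x   ≈⟨ eval-*ₚ ℚᴿ ι-pres q p x ⟨
    eval ι (q *ₚ p) x         ≈⟨ eval-≈ₚ (q *ₚ p) 1ₚ qp≈1 x ⟩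
    eval ι 1ₚ x               ≈⟨ ≈-trans (eval-constant ℚᴿ ι-pres 1ℚ x) ι-1 ⟩
    1#                        ∎)
    where open _∣ʳ_ p∣1 renaming (quotient to q; equality to qp≈1)

  module _ (F : List ℚ) (irreducible : Irreducible (monic ℚᴿ F)) where
    private
      Root : Carrier → Set
      Root x = eval ι (monic ℚᴿ F) x ≈ 0#
    open Adjoin rationals

    -- In f = M Q one factor is a unit. It is not M, which vanishes at α; so Q vanishes nowhere, and
    -- the root β of f is a root of M.
    minimal-vanishes : ∀ {α β} → Root α → Root β → (min : MinimalPolynomial α) →
        eval ι (monic ℚᴿ (MinimalPolynomial.M min)) β ≈ 0#
    minimal-vanishes {α} {β} fα≈0 fβ≈0 min with WithMinimal.factor α min (monic ℚᴿ F) fα≈0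
    ... | Q , _ , f≈MQ with Irreducible.split-∣1 irreducible {monic ℚᴿ M} {Q}
          (eval⇒≈ₚ (monic ℚᴿ F) (monic ℚᴿ M *ₚ Q) λ x → ≈-trans (f≈MQ x)
              (≈-sym (eval-*ₚ ℚᴿ ι-pres (monic ℚᴿ M) Q x)))
          where open MinimalPolynomial α min
    ...   | inj₁ M∣1 = ⊥-elim (unit-nonvanishing M∣1 α (MinimalPolynomial.annihilates min))
    ...   | inj₂ Q∣1 = x*y≈0 (≈-trans (*-comm _ _) (≈-trans (≈-sym (f≈MQ β)) fβ≈0))
        (unit-nonvanishing Q∣1 β)

    same-equations : ∀ {α β} → Root α → Root β → ∀ p → eval ι p α ≈ 0# → eval ι p β ≈ 0#
    same-equations {α} {β} fα≈0 fβ≈0 p pα≈0 = decidable-stable (_ ≟ _) λ pβ≉0 →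
      ¬¬minimal α F fα≈0 λ min →
      pβ≉0 (PartialIso.kernel (WithMinimal.adjoin α min β (minimal-vanishes fα≈0 fβ≈0 min)) p pα≈0)

    module _ (rs : List Carrier) (rs! : AllPairs _≉_ rs) (length-rs : length rs ≡ length F)
             (f≈0 : All Root rs) (generated : ∀ x → Generated E (λ y → Any (y ≈_) rs) x) where
      open SplittingField F rs rs! length-rs f≈0 generated using (extends; eval-X)

      transitive : ∀ {α β} → Root α → Root β → ¬ ¬ (∃[ σ ] Automorphism.⟦_⟧ {E} σ α ≈ β)
      transitive {α} {β} fα≈0 fβ≈0 none = ¬¬minimal α F fα≈0 λ min →
        let T = WithMinimal.adjoin α min β (minimal-vanishes fα≈0 fβ≈0 min)
            X = 0ℚ ∷ 1ℚ ∷ []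
        in extends T λ (σ , σφ≈ψ) → none (σ , ≈-trans
             (Automorphism.⟦⟧-cong σ (≈-sym (eval-X rationals ι-pres α)))
             (≈-trans (σφ≈ψ X) (eval-X rationals ι-pres β)))

-- The quartic, its symmetric functions and its resolvent cubic

module Quartic (a d : ℤ) (a≢0 : a ≢ 0ℤ) (d≢0 : d ≢ 0ℤ) (L : Extension) where
  open Field L
  open Evaluation L
  open RootCounting L
  open Polynomial rawRing using (coeff; _≈ₚ_; _+ₚ_; _*ₚ_; 1ₚ; X-_)

  A D : Carrier
  A = int a
  D = int d

  F : List ℚ
  F = fromℤ d ∷ fromℤ 0ℤ ∷ fromℤ 0ℤ ∷ fromℤ a ∷ []

  Root : Carrier → Set
  Root x = eval ι (monic ℚ.+-*-rawRing F) x ≈ 0#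

  quartic : Carrier → Carrier
  quartic x = x * x * x * x + A * (x * x * x) + D

  eval-quartic : ∀ x → eval ι (monic ℚ.+-*-rawRing F) x ≈ quartic x
  eval-quartic x = ≈-trans
    (+-congˡ (*-congˡ (+-cong ι-0 (*-congˡ (+-cong ι-0 (*-congˡ (+-congˡ (*-congˡ (+-congʳ ι-1)))))))))
    (solve 3 (λ x a d → d :+ x :* (con 0ℤ :+ x :* (con 0ℤ :+ x :* (a :+ x :* (con 1ℤ :+ x :* con 0ℤ))))
      := x :* x :* x :* x :+ a :* (x :* x :* x) :+ d) ≈-refl x A D)

  record Vieta (x₀ x₁ x₂ x₃ : Carrier) : Set where
    field
      e₁ : x₀ + x₁ + x₂ + x₃ ≈ - A
      e₂ : x₀ * x₁ + x₀ * x₂ + x₀ * x₃ + x₁ * x₂ + x₁ * x₃ + x₂ * x₃ ≈ 0#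
      e₃ : x₀ * x₁ * x₂ + x₀ * x₁ * x₃ + x₀ * x₂ * x₃ + x₁ * x₂ * x₃ ≈ 0#
      e₄ : x₀ * x₁ * x₂ * x₃ ≈ D

  -- Together with `swap` this generates all permutations of the roots, so a statement about x₀ and
  -- x₁ reaches every pair.
  rotate : ∀ {x₀ x₁ x₂ x₃} → Vieta x₀ x₁ x₂ x₃ → Vieta x₁ x₂ x₃ x₀
  rotate {x₀} {x₁} {x₂} {x₃} v = record
    { e₁ = ≈-trans (solve 4 (λ x₀ x₁ x₂ x₃ → x₁ :+ x₂ :+ x₃ :+ x₀ := x₀ :+ x₁ :+ x₂ :+ x₃) ≈-refl x₀ x₁
        x₂ x₃) e₁
    ; e₂ = ≈-trans (solve 4 (λ x₀ x₁ x₂ x₃ →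
             x₁ :* x₂ :+ x₁ :* x₃ :+ x₁ :* x₀ :+ x₂ :* x₃ :+ x₂ :* x₀ :+ x₃ :* x₀
          := x₀ :* x₁ :+ x₀ :* x₂ :+ x₀ :* x₃ :+ x₁ :* x₂ :+ x₁ :* x₃ :+ x₂ :* x₃) ≈-refl x₀ x₁ x₂ x₃)
              e₂
    ; e₃ = ≈-trans (solve 4 (λ x₀ x₁ x₂ x₃ →
             x₁ :* x₂ :* x₃ :+ x₁ :* x₂ :* x₀ :+ x₁ :* x₃ :* x₀ :+ x₂ :* x₃ :* x₀
          := x₀ :* x₁ :* x₂ :+ x₀ :* x₁ :* x₃ :+ x₀ :* x₂ :* x₃ :+ x₁ :* x₂ :* x₃) ≈-refl x₀ x₁ x₂ x₃)
              e₃
    ; e₄ = ≈-trans (solve 4 (λ x₀ x₁ x₂ x₃ → x₁ :* x₂ :* x₃ :* x₀ := x₀ :* x₁ :* x₂ :* x₃) ≈-refl x₀ x₁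
        x₂ x₃) e₄
    }
    where open Vieta v

  swap : ∀ {x₀ x₁ x₂ x₃} → Vieta x₀ x₁ x₂ x₃ → Vieta x₀ x₂ x₁ x₃
  swap {x₀} {x₁} {x₂} {x₃} v = record
    { e₁ = ≈-trans (solve 4 (λ x₀ x₁ x₂ x₃ → x₀ :+ x₂ :+ x₁ :+ x₃ := x₀ :+ x₁ :+ x₂ :+ x₃) ≈-refl x₀ x₁
        x₂ x₃) e₁
    ; e₂ = ≈-trans (solve 4 (λ x₀ x₁ x₂ x₃ →
             x₀ :* x₂ :+ x₀ :* x₁ :+ x₀ :* x₃ :+ x₂ :* x₁ :+ x₂ :* x₃ :+ x₁ :* x₃
          := x₀ :* x₁ :+ x₀ :* x₂ :+ x₀ :* x₃ :+ x₁ :* x₂ :+ x₁ :* x₃ :+ x₂ :* x₃) ≈-refl x₀ x₁ x₂ x₃)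
              e₂
    ; e₃ = ≈-trans (solve 4 (λ x₀ x₁ x₂ x₃ →
             x₀ :* x₂ :* x₁ :+ x₀ :* x₂ :* x₃ :+ x₀ :* x₁ :* x₃ :+ x₂ :* x₁ :* x₃
          := x₀ :* x₁ :* x₂ :+ x₀ :* x₁ :* x₃ :+ x₀ :* x₂ :* x₃ :+ x₁ :* x₂ :* x₃) ≈-refl x₀ x₁ x₂ x₃)
              e₃
    ; e₄ = ≈-trans (solve 4 (λ x₀ x₁ x₂ x₃ → x₀ :* x₂ :* x₁ :* x₃ := x₀ :* x₁ :* x₂ :* x₃) ≈-refl x₀ x₁
        x₂ x₃) e₄
    }
    where open Vieta v

  vieta⇒root : ∀ {x₀ x₁ x₂ x₃} → Vieta x₀ x₁ x₂ x₃ → Root x₀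
  vieta⇒root {x₀} {x₁} {x₂} {x₃} v = begin
    eval ι (monic ℚ.+-*-rawRing F) x₀
      ≈⟨ eval-quartic x₀ ⟩
    x₀ * x₀ * x₀ * x₀ + A * (x₀ * x₀ * x₀) + D
      ≈⟨ solve 3 (λ x a d → x :* x :* x :* x :+ a :* (x :* x :* x) :+ d
           := x :* x :* x :* x :+ con 0ℤ :* (x :* x) :- ((:- a) :* (x :* x :* x) :+ con 0ℤ :* x) :+ d)
               ≈-refl x₀ A D ⟩
    x₀ * x₀ * x₀ * x₀ + 0# * (x₀ * x₀) - (- A * (x₀ * x₀ * x₀) + 0# * x₀) + D
      ≈⟨ +-cong (+-cong (+-congˡ (*-congʳ e₂)) (-‿cong (+-cong (*-congʳ e₁) (*-congʳ e₃)))) e₄ ⟨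
    _ ≈⟨ solve 4 (λ x₀ x₁ x₂ x₃ →
             x₀ :* x₀ :* x₀ :* x₀
             :+ (x₀ :* x₁ :+ x₀ :* x₂ :+ x₀ :* x₃ :+ x₁ :* x₂ :+ x₁ :* x₃ :+ x₂ :* x₃) :* (x₀ :* x₀)
             :- ((x₀ :+ x₁ :+ x₂ :+ x₃) :* (x₀ :* x₀ :* x₀)
                :+ (x₀ :* x₁ :* x₂ :+ x₀ :* x₁ :* x₃ :+ x₀ :* x₂ :* x₃ :+ x₁ :* x₂ :* x₃) :* x₀)
             :+ x₀ :* x₁ :* x₂ :* x₃ := con 0ℤ) ≈-refl x₀ x₁ x₂ x₃ ⟩
    0# ∎
    where open Vieta v

  int≉0 : ∀ {i} → i ≢ 0ℤ → int i ≉ 0#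
  int≉0 i≢0 i≈0 = i≢0 (int-injective-0 i≈0)

  root≉0 : ∀ {x} → Root x → x ≉ 0#
  root≉0 {x} fx≈0 x≈0 = int≉0 d≢0 (begin
    D                                      ≈⟨ solve 2 (λ a d →
        d := con 0ℤ :* con 0ℤ :* con 0ℤ :* con 0ℤ :+ a :* (con 0ℤ :* con 0ℤ :* con 0ℤ) :+ d) ≈-refl A D
        ⟩
    0# * 0# * 0# * 0# + A * (0# * 0# * 0#) + D ≈⟨ +-congʳ (+-cong (*-cong xxx x≈0) (*-congˡ xxx)) ⟨
    quartic x                              ≈⟨ ≈-trans (≈-sym (eval-quartic x)) fx≈0 ⟩
    0#                                     ∎)
    where
    xxx : x * x * x ≈ 0# * 0# * 0#
    xxx = *-cong (*-cong x≈0 x≈0) x≈0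

  -- The difference of f and the product of the x - xᵢ has degree at most 3 and four roots. This
  -- gives the formulas for roots listed in the order in which automorphisms produce them.
  distinct-roots⇒vieta : ∀ {x₀ x₁ x₂ x₃} → AllPairs _≉_ (x₀ ∷ x₁ ∷ x₂ ∷ x₃ ∷ []) →
    All Root (x₀ ∷ x₁ ∷ x₂ ∷ x₃ ∷ []) → Vieta x₀ x₁ x₂ x₃
  distinct-roots⇒vieta {x₀} {x₁} {x₂} {x₃} xs! (f₀ ∷ f₁ ∷ f₂ ∷ f₃ ∷ []) =
    conclude (many-roots⇒zero difference (x₀ ∷ x₁ ∷ x₂ ∷ x₃ ∷ []) ℕ.≤-refl xs!
      (root x₀ f₀ vanish₀ ∷ root x₁ f₁ vanish₁ ∷ root x₂ f₂ vanish₂ ∷ root x₃ f₃ vanish₃ ∷ []))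
    where
    s₁ s₂ s₃ s₄ : Carrier
    s₁ = x₀ + x₁ + x₂ + x₃
    s₂ = x₀ * x₁ + x₀ * x₂ + x₀ * x₃ + x₁ * x₂ + x₁ * x₃ + x₂ * x₃
    s₃ = x₀ * x₁ * x₂ + x₀ * x₁ * x₃ + x₀ * x₂ * x₃ + x₁ * x₂ * x₃
    s₄ = x₀ * x₁ * x₂ * x₃
    difference : List Carrier
    difference = D - s₄ ∷ s₃ ∷ - s₂ ∷ A + s₁ ∷ []
    product : Carrier → Carrier
    product x = (x - x₀) * (x - x₁) * (x - x₂) * (x - x₃)
    identity : ∀ x → eval id difference x ≈ quartic x - product x
    identity x = solve 7 (λ x x₀ x₁ x₂ x₃ a d →
           (d :- x₀ :* x₁ :* x₂ :* x₃) :+ x :* ((x₀ :* x₁ :* x₂ :+ x₀ :* x₁ :* x₃ :+ x₀ :* x₂ :* x₃ :+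
               x₁ :* x₂ :* x₃)
           :+ x :* (:- (x₀ :* x₁ :+ x₀ :* x₂ :+ x₀ :* x₃ :+ x₁ :* x₂ :+ x₁ :* x₃ :+ x₂ :* x₃)
           :+ x :* ((a :+ (x₀ :+ x₁ :+ x₂ :+ x₃)) :+ x :* con 0ℤ)))
           := (x :* x :* x :* x :+ a :* (x :* x :* x) :+ d) :- (x :- x₀) :* (x :- x₁) :* (x :- x₂) :*
               (x :- x₃))
           ≈-refl x x₀ x₁ x₂ x₃ A D
    root : ∀ x → Root x → product x ≈ 0# → eval id difference x ≈ 0#
    root x fx≈0 x∈ = begin
      eval id difference x     ≈⟨ identity x ⟩
      quartic x - product x    ≈⟨ x≈y⇒x-y≈0 (≈-trans (≈-trans (≈-sym (eval-quartic x)) fx≈0) (≈-sym x∈))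
          ⟩
      0#                       ∎
    vanish₀ : product x₀ ≈ 0#
    vanish₀ = solve 4 (λ x₀ x₁ x₂ x₃ → (x₀ :- x₀) :* (x₀ :- x₁) :* (x₀ :- x₂) :* (x₀ :- x₃) := con 0ℤ)
        ≈-refl x₀ x₁ x₂ x₃
    vanish₁ : product x₁ ≈ 0#
    vanish₁ = solve 4 (λ x₀ x₁ x₂ x₃ → (x₁ :- x₀) :* (x₁ :- x₁) :* (x₁ :- x₂) :* (x₁ :- x₃) := con 0ℤ)
        ≈-refl x₀ x₁ x₂ x₃
    vanish₂ : product x₂ ≈ 0#
    vanish₂ = solve 4 (λ x₀ x₁ x₂ x₃ → (x₂ :- x₀) :* (x₂ :- x₁) :* (x₂ :- x₂) :* (x₂ :- x₃) := con 0ℤ)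
        ≈-refl x₀ x₁ x₂ x₃
    vanish₃ : product x₃ ≈ 0#
    vanish₃ = solve 4 (λ x₀ x₁ x₂ x₃ → (x₃ :- x₀) :* (x₃ :- x₁) :* (x₃ :- x₂) :* (x₃ :- x₃) := con 0ℤ)
        ≈-refl x₀ x₁ x₂ x₃
    conclude : All (_≈ 0#) difference → Vieta x₀ x₁ x₂ x₃
    conclude (D-s₄≈0 ∷ s₃≈0 ∷ -s₂≈0 ∷ A+s₁≈0 ∷ []) = record
      { e₁ = begin
          s₁             ≈⟨ solve 2 (λ s a → s := (a :+ s) :- a) ≈-refl s₁ A ⟩
          (A + s₁) - A   ≈⟨ ≈-trans (+-congʳ A+s₁≈0) (+-identityˡ (- A)) ⟩
          - A            ∎
      ; e₂ = begin
          s₂       ≈⟨ solve 1 (λ s → s := :- (:- s)) ≈-refl s₂ ⟩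
          - (- s₂) ≈⟨ ≈-trans (-‿cong -s₂≈0) -0#≈0# ⟩
          0#       ∎
      ; e₃ = s₃≈0
      ; e₄ = ≈-sym (x-y≈0⇒x≈y D-s₄≈0)
      }

  module Resolvent {x₀ x₁ x₂ x₃} (v : Vieta x₀ x₁ x₂ x₃) where
    open Vieta v

    y p w : Carrier
    y = x₀ * x₂ + x₁ * x₃
    p = x₀ * x₂ - x₁ * x₃
    w = (x₀ - x₂) * (x₁ - x₃)

    private
      -- The pairing gives f = (x² - m x + s) (x² - n x + t); the next four lemmas compare
      -- coefficients.
      s t m n : Carrier
      s = x₀ * x₂
      t = x₁ * x₃
      m = x₀ + x₂
      n = x₁ + x₃

    y+mn≈0 : y + m * n ≈ 0#
    y+mn≈0 = ≈-trans (solve 4 (λ x₀ x₁ x₂ x₃ → (x₀ :* x₂ :+ x₁ :* x₃) :+ (x₀ :+ x₂) :* (x₁ :+ x₃)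
      := x₀ :* x₁ :+ x₀ :* x₂ :+ x₀ :* x₃ :+ x₁ :* x₂ :+ x₁ :* x₃ :+ x₂ :* x₃) ≈-refl x₀ x₁ x₂ x₃) e₂

    sn+tm≈0 : s * n + t * m ≈ 0#
    sn+tm≈0 = ≈-trans (solve 4 (λ x₀ x₁ x₂ x₃ → x₀ :* x₂ :* (x₁ :+ x₃) :+ x₁ :* x₃ :* (x₀ :+ x₂)
      := x₀ :* x₁ :* x₂ :+ x₀ :* x₁ :* x₃ :+ x₀ :* x₂ :* x₃ :+ x₁ :* x₂ :* x₃) ≈-refl x₀ x₁ x₂ x₃) e₃

    st≈D : s * t ≈ D
    st≈D = ≈-trans (solve 4 (λ x₀ x₁ x₂ x₃ → x₀ :* x₂ :* (x₁ :* x₃) := x₀ :* x₁ :* x₂ :* x₃) ≈-refl x₀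
        x₁ x₂ x₃) e₄

    m+n≈-A : m + n ≈ - A
    m+n≈-A = ≈-trans (solve 4 (λ x₀ x₁ x₂ x₃ → (x₀ :+ x₂) :+ (x₁ :+ x₃) := x₀ :+ x₁ :+ x₂ :+ x₃) ≈-refl
        x₀ x₁ x₂ x₃) e₁

    -- The left side is y (s - t)² = - m n (s - t)². Moreover (m + n)² s t + m n (s - t)² = (m s + n
    -- t) (s n + t m), whose last factor is zero.
    cubic : y * y * y - int (+ 4) * D * y ≈ A * A * D
    cubic = begin
      y * y * y - int (+ 4) * D * y
        ≈⟨ +-congˡ (-‿cong (*-congʳ (*-congˡ st≈D))) ⟨
      y * y * y - int (+ 4) * (s * t) * y
        ≈⟨ solve 4 (λ s t m n → (s :+ t) :* (s :+ t) :* (s :+ t) :- con (+ 4) :* (s :* t) :* (s :+ t)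
             := (m :+ n) :* (m :+ n) :* (s :* t)
                :+ ((s :+ t :+ m :* n) :* ((s :- t) :* (s :- t))
                :+ (s :* n :+ t :* m) :* ((s :* n :+ t :* m) :- (m :+ n) :* (s :+ t)))) ≈-refl s t m n ⟩
      (m + n) * (m + n) * (s * t) + ((y + m * n) * ((s - t) * (s - t)) + (s * n + t * m) *
          ((s * n + t * m) - (m + n) * y))
        ≈⟨ +-cong (*-cong (*-cong m+n≈-A m+n≈-A) st≈D) (+-cong (*-congʳ y+mn≈0) (*-congʳ sn+tm≈0)) ⟩
      - A * - A * D + (0# * ((s - t) * (s - t)) + 0# * ((s * n + t * m) - (m + n) * y))
        ≈⟨ solve 4 (λ a d u v → (:- a) :* (:- a) :* d :+ (con 0ℤ :* u :+ con 0ℤ :* v) := a :* a :* d)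
            ≈-refl A D _ _ ⟩
      A * A * D ∎

    p-square : p * p ≈ y * y - int (+ 4) * D
    p-square = begin
      p * p                       ≈⟨ solve 2 (λ s t → (s :- t) :* (s :- t) := (s :+ t) :* (s :+ t) :-
          con (+ 4) :* (s :* t)) ≈-refl s t ⟩
      y * y - int (+ 4) * (s * t) ≈⟨ +-congˡ (-‿cong (*-congˡ st≈D)) ⟩
      y * y - int (+ 4) * D       ∎

    -- The square is the product of the discriminants m² - 4 s and n² - 4 t of the two quadratics.
    -- Here m² n² = y², and m² t + n² s = - m n (s + t) = y², both by the vanishing coefficients of
    -- f.
    w-square : w * w ≈ int (+ 16) * D - int (+ 3) * (y * y)
    w-square = begin
      w * w
        ≈⟨ solve 4 (λ x₀ x₁ x₂ x₃ → (x₀ :- x₂) :* (x₁ :- x₃) :* ((x₀ :- x₂) :* (x₁ :- x₃))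
             := ((x₀ :+ x₂) :* (x₀ :+ x₂) :- con (+ 4) :* (x₀ :* x₂)) :*
                 ((x₁ :+ x₃) :* (x₁ :+ x₃) :- con (+ 4) :* (x₁ :* x₃))) ≈-refl x₀ x₁ x₂ x₃ ⟩
      (m * m - int (+ 4) * s) * (n * n - int (+ 4) * t)
        ≈⟨ solve 4 (λ s t m n → (m :* m :- con (+ 4) :* s) :* (n :* n :- con (+ 4) :* t)
             := (con (+ 16) :* (s :* t) :- con (+ 3) :* ((s :+ t) :* (s :+ t)))
                :+ ((s :+ t :+ m :* n) :* (m :* n :+ con (+ 3) :* (s :+ t)) :- (s :* n :+ t :* m) :*
                    (con (+ 4) :* (m :+ n)))) ≈-refl s t m n ⟩
      (int (+ 16) * (s * t) - int (+ 3) * (y * y)) + ((y + m * n) * (m * n + int (+ 3) * y) -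
          (s * n + t * m) * (int (+ 4) * (m + n)))
        ≈⟨ +-cong (+-congʳ (*-congˡ st≈D)) (+-cong (*-congʳ y+mn≈0) (-‿cong (*-congʳ sn+tm≈0))) ⟩
      (int (+ 16) * D - int (+ 3) * (y * y)) + (0# * (m * n + int (+ 3) * y) - 0# *
          (int (+ 4) * (m + n)))
        ≈⟨ solve 3 (λ z u v → z :+ (con 0ℤ :* u :- con 0ℤ :* v) := z) ≈-refl _ _ _ ⟩
      int (+ 16) * D - int (+ 3) * (y * y) ∎

  -- The coefficient of degree n in the product of the factors x - r; up to sign an
  -- elementary symmetric polynomial.
  elementary : ℕ → List Carrier → Carrier
  elementary zero    []       = 1#
  elementary (suc n) []       = 0#
  elementary zero    (r ∷ rs) = - r * elementary zero rs
  elementary (suc n) (r ∷ rs) = - r * elementary (suc n) rs + elementary n rs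

  elementary-beyond : ∀ n rs → length rs ℕ.< n → elementary n rs ≈ 0#
  elementary-beyond (suc n) []       _         = ≈-refl
  elementary-beyond (suc n) (r ∷ rs) (s≤s rs<n) = begin
    - r * elementary (suc n) rs + elementary n rs
      ≈⟨ +-cong (*-congˡ (elementary-beyond (suc n) rs (ℕ.m≤n⇒m≤1+n rs<n)))
          (elementary-beyond n rs rs<n) ⟩
    - r * 0# + 0#  ≈⟨ solve 1 (λ r → (:- r) :* con 0ℤ :+ con 0ℤ := con 0ℤ) ≈-refl r ⟩
    0# ∎

  elementary-leading : ∀ rs → elementary (length rs) rs ≈ 1#
  elementary-leading []       = ≈-refl
  elementary-leading (r ∷ rs) = begin
    - r * elementary (suc (length rs)) rs + elementary (length rs) rs
      ≈⟨ +-cong (*-congˡ (elementary-beyond (suc (length rs)) rs ℕ.≤-refl)) (elementary-leading rs) ⟩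
    - r * 0# + 1#  ≈⟨ solve 1 (λ r → (:- r) :* con 0ℤ :+ con 1ℤ := con 1ℤ) ≈-refl r ⟩
    1# ∎

  coeff-+ₚ : ∀ p q n → coeff (p +ₚ q) n ≈ coeff p n + coeff q n
  coeff-+ₚ []      q       n       = ≈-sym (+-identityˡ _)
  coeff-+ₚ (a ∷ p) []      n       = ≈-sym (+-identityʳ _)
  coeff-+ₚ (a ∷ p) (b ∷ q) zero    = ≈-refl
  coeff-+ₚ (a ∷ p) (b ∷ q) (suc n) = coeff-+ₚ p q n

  coeff-scale : ∀ c p n → coeff (map (c *_) p) n ≈ c * coeff p n
  coeff-scale c []      n       = ≈-sym (zeroʳ c)
  coeff-scale c (a ∷ p) zero    = ≈-refl
  coeff-scale c (a ∷ p) (suc n) = coeff-scale c p n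

  coeff-product : ∀ rs n → coeff (foldr (λ r p → (X- r) *ₚ p) 1ₚ rs) n ≈ elementary n rs
  coeff-product []       zero    = ≈-refl
  coeff-product []       (suc n) = ≈-refl
  coeff-product (r ∷ rs) n = begin
    coeff (map (- r *_) p +ₚ (0# ∷ (map (1# *_) p +ₚ (0# ∷ [])))) n
      ≈⟨ coeff-+ₚ (map (- r *_) p) _ n ⟩
    coeff (map (- r *_) p) n + coeff (0# ∷ (map (1# *_) p +ₚ (0# ∷ []))) n
      ≈⟨ +-cong (≈-trans (coeff-scale (- r) p n) (*-congˡ (coeff-product rs n))) (shifted n) ⟩
    - r * elementary n rs + below n
      ≈⟨ combine n ⟩
    elementary n (r ∷ rs) ∎
    where
    p = foldr (λ r p → (X- r) *ₚ p) 1ₚ rs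
    below : ℕ → Carrier
    below zero    = 0#
    below (suc n) = elementary n rs
    coeff-0 : ∀ n → coeff (0# ∷ []) n ≈ 0#
    coeff-0 zero    = ≈-refl
    coeff-0 (suc n) = ≈-refl
    shifted : ∀ n → coeff (0# ∷ (map (1# *_) p +ₚ (0# ∷ []))) n ≈ below n
    shifted zero    = ≈-refl
    shifted (suc n) = begin
      coeff (map (1# *_) p +ₚ (0# ∷ [])) n             ≈⟨ coeff-+ₚ (map (1# *_) p) (0# ∷ []) n ⟩
      coeff (map (1# *_) p) n + coeff (0# ∷ []) n      ≈⟨ +-cong
          (≈-trans (coeff-scale 1# p n) (*-identityˡ _)) (coeff-0 n) ⟩
      coeff p n + 0#                                   ≈⟨ ≈-trans (+-identityʳ _) (coeff-product rs n) ⟩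
      elementary n rs                                  ∎
    combine : ∀ n → - r * elementary n rs + below n ≈ elementary n (r ∷ rs)
    combine zero    = +-identityʳ _
    combine (suc n) = ≈-refl

  -- With fewer than four factors the product has coefficient 0 in degree 4; with more it has
  -- leading coefficient 1 in a degree where f has 0.
  four-roots : ∀ rs → map int (x⁴+ax³+d a d) ≈ₚ foldr (λ r p → (X- r) *ₚ p) 1ₚ rs →
    ∃[ x₀ ] ∃[ x₁ ] ∃[ x₂ ] ∃[ x₃ ] rs ≡ x₀ ∷ x₁ ∷ x₂ ∷ x₃ ∷ [] × Vieta x₀ x₁ x₂ x₃
  four-roots rs splits = go rs (λ n → ≈-trans (splits n) (coeff-product rs n))
    where
    short : ∀ rs → length rs ℕ.< 4 → ¬ (int 1ℤ ≈ elementary 4 rs)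
    short rs rs<4 1≈ = 0≉1 (≈-trans (≈-sym (elementary-beyond 4 rs rs<4)) (≈-trans (≈-sym 1≈) ι-1))
    go : ∀ rs → (∀ n → coeff (map int (x⁴+ax³+d a d)) n ≈ elementary n rs) →
         ∃[ x₀ ] ∃[ x₁ ] ∃[ x₂ ] ∃[ x₃ ] rs ≡ x₀ ∷ x₁ ∷ x₂ ∷ x₃ ∷ [] × Vieta x₀ x₁ x₂ x₃
    go [] h = ⊥-elim (short [] (s≤s z≤n) (h 4))
    go rs@(_ ∷ []) h = ⊥-elim (short rs (s≤s (s≤s z≤n)) (h 4))
    go rs@(_ ∷ _ ∷ []) h = ⊥-elim (short rs (s≤s (s≤s (s≤s z≤n))) (h 4))
    go rs@(_ ∷ _ ∷ _ ∷ []) h = ⊥-elim (short rs (s≤s (s≤s (s≤s (s≤s z≤n)))) (h 4))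
    go rs@(_ ∷ _ ∷ _ ∷ _ ∷ _ ∷ _) h = ⊥-elim (0≉1 (≈-trans (h (length rs)) (elementary-leading rs)))
    go (x₀ ∷ x₁ ∷ x₂ ∷ x₃ ∷ []) h = x₀ , x₁ , x₂ , x₃ , refl , record
      { e₁ = ≈-trans (solve 4 (λ x₀ x₁ x₂ x₃ → x₀ :+ x₁ :+ x₂ :+ x₃ := :- syntactic 3 x₀ x₁ x₂ x₃)
          ≈-refl x₀ x₁ x₂ x₃) (-‿cong (≈-sym (h 3)))
      ; e₂ = ≈-trans (solve 4 (λ x₀ x₁ x₂ x₃ → x₀ :* x₁ :+ x₀ :* x₂ :+ x₀ :* x₃ :+ x₁ :* x₂ :+ x₁ :* x₃
          :+ x₂ :* x₃
               := syntactic 2 x₀ x₁ x₂ x₃) ≈-refl x₀ x₁ x₂ x₃) (≈-trans (≈-sym (h 2)) ι-0)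
      ; e₃ = ≈-trans (solve 4 (λ x₀ x₁ x₂ x₃ → x₀ :* x₁ :* x₂ :+ x₀ :* x₁ :* x₃ :+ x₀ :* x₂ :* x₃ :+ x₁
          :* x₂ :* x₃
               := :- syntactic 1 x₀ x₁ x₂ x₃) ≈-refl x₀ x₁ x₂ x₃)
                   (≈-trans (-‿cong (≈-trans (≈-sym (h 1)) ι-0)) -0#≈0#)
      ; e₄ = ≈-trans (solve 4 (λ x₀ x₁ x₂ x₃ → x₀ :* x₁ :* x₂ :* x₃ := syntactic 0 x₀ x₁ x₂ x₃) ≈-refl
          x₀ x₁ x₂ x₃) (≈-sym (h 0))
      }
      where
      -- A copy of `elementary` in the syntax of the solver, so that the coefficients of the product
      -- need not be written out.
      elementaryₛ : ∀ {m} → ℕ → List (Syntax m) → Syntax m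
      elementaryₛ zero    []       = con 1ℤ
      elementaryₛ (suc n) []       = con 0ℤ
      elementaryₛ zero    (r ∷ rs) = :- r :* elementaryₛ zero rs
      elementaryₛ (suc n) (r ∷ rs) = :- r :* elementaryₛ (suc n) rs :+ elementaryₛ n rs
      syntactic : ℕ → Syntax 4 → Syntax 4 → Syntax 4 → Syntax 4 → Syntax 4
      syntactic n x₀ x₁ x₂ x₃ = elementaryₛ n (x₀ ∷ x₁ ∷ x₂ ∷ x₃ ∷ [])

-- What the power basis says about d

module MonogenicQuartic (a d : ℤ) (a≢0 : a ≢ 0ℤ) (d≢0 : d ≢ 0ℤ) (monogenic : Monogenic (x⁴+ax³+d a d)) (L : Extension) where
  open Field L
  open Evaluation L
  open RootCounting L
  open Quartic a d a≢0 d≢0 L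
  open Monogenic monogenic
  open Conjugates L

  f : ℤ[X].Poly
  f = x⁴+ax³+d a d

  evalℤ-int : ∀ p x → evalℤ L p x ≈ eval int p x
  evalℤ-int p x = ≈-reflexive (eval-map id int p x)

  module Basis {θ} (fθ≈0 : Root θ) where
    evalℤ-root : evalℤ L f θ ≈ 0#
    evalℤ-root = fθ≈0

    open IsℤBasis (powerBasis L θ evalℤ-root) public

    combination : (c₀ c₁ c₂ c₃ : ℤ) → Carrier → Carrier
    combination c₀ c₁ c₂ c₃ x = int c₀ + (int c₁ * x + (int c₂ * (x * x) + int c₃ * (x * x * x)))

    ℤ-combination≈ : ∀ c → ℤ-combination L c (powers L 4 θ) ≈
      combination (c Fin.zero) (c (Fin.suc Fin.zero)) (c (Fin.suc (Fin.suc Fin.zero)))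
          (c (Fin.suc (Fin.suc (Fin.suc Fin.zero)))) θ
    ℤ-combination≈ c = solve 5 (λ θ c₀ c₁ c₂ c₃ →
        c₀ :* con 1ℤ :+ (c₁ :* (θ :* con 1ℤ) :+ (c₂ :* (θ :* (θ :* con 1ℤ)) :+
            (c₃ :* (θ :* (θ :* (θ :* con 1ℤ))) :+ con 0ℤ)))
        := c₀ :+ (c₁ :* θ :+ (c₂ :* (θ :* θ) :+ c₃ :* (θ :* θ :* θ)))) ≈-refl θ _ _ _ _

    spans : ∀ x → Generated L (_≈ θ) x → IntegralOverℤ L x →
            ∃[ c₀ ] ∃[ c₁ ] ∃[ c₂ ] ∃[ c₃ ] x ≈ combination c₀ c₁ c₂ c₃ θ
    spans x x∈ℚ⟨θ⟩ x-integral with spanning x (x∈ℚ⟨θ⟩ , x-integral)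
    ... | c , x≈ = c Fin.zero , c (Fin.suc Fin.zero) , c (Fin.suc (Fin.suc Fin.zero)) , c
        (Fin.suc (Fin.suc (Fin.suc Fin.zero))) , ≈-trans x≈ (ℤ-combination≈ c)

    coefficient₃-zero : ∀ c₀ c₁ c₂ c₃ → combination c₀ c₁ c₂ c₃ θ ≈ 0# → c₃ ≡ 0ℤ
    coefficient₃-zero c₀ c₁ c₂ c₃ ≈0 = independent c (≈-trans (ℤ-combination≈ c) ≈0)
        (Fin.suc (Fin.suc (Fin.suc Fin.zero)))
      where
      c : Fin 4 → ℤ
      c Fin.zero                                  = c₀
      c (Fin.suc Fin.zero)                        = c₁
      c (Fin.suc (Fin.suc Fin.zero))              = c₂
      c (Fin.suc (Fin.suc (Fin.suc Fin.zero)))    = c₃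

    -- If p² ∣ d, then η = (θ³ + a θ²) / p is integral, as p η = - d / θ.
    module _ (p : ℕ) (e : ℤ) (d≡ : d ≡ e ℤ.* (+ p ℤ.* + p)) where
      private
        P N V : Carrier
        P = int (+ p)
        N = int e
        V = P * N

      D≈NPP : D ≈ N * (P * P)
      D≈NPP = ≈-trans (ι-cong (cong fromℤ d≡)) (≈-trans (int-* e (+ p ℤ.* + p))
          (*-congˡ (int-* (+ p) (+ p))))

      P≉0 : P ≉ 0#
      P≉0 P≈0 = int≉0 d≢0 (≈-trans D≈NPP (≈-trans (*-congˡ (*-congʳ P≈0))
          (solve 2 (λ n p → n :* (con 0ℤ :* p) := con 0ℤ) ≈-refl N P)))

      p⁻¹ : ∃[ q ] P * ι q ≈ 1#
      p⁻¹ = PartialIso.invert rationals (fromℤ (+ p)) P≉0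
        where
        open Extending L
        open Automorphisms L

      η : Carrier
      η = ι (proj₁ p⁻¹) * (θ * θ * θ + A * (θ * θ))

      η∈ℚ⟨θ⟩ : Generated L (_≈ θ) η
      η∈ℚ⟨θ⟩ = mul (base _) (add (mul (mul θ∈ θ∈) θ∈) (mul (base _) (mul θ∈ θ∈)))
        where
        θ∈ : Generated L (_≈ θ) θ
        θ∈ = gen ≈-refl

      Pη : P * η ≈ θ * θ * θ + A * (θ * θ)
      Pη = ≈-trans (≈-sym (*-assoc P _ _)) (≈-trans (*-congʳ (proj₂ p⁻¹)) (*-identityˡ _))

      θ-equation : N * (P * P) + (A * (θ * θ * θ) + θ * θ * θ * θ) ≈ 0#
      θ-equation = begin
        N * (P * P) + (A * (θ * θ * θ) + θ * θ * θ * θ) ≈⟨ +-congʳ D≈NPP ⟨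
        D + (A * (θ * θ * θ) + θ * θ * θ * θ)           ≈⟨ solve 3 (λ x a d →
            d :+ (a :* (x :* x :* x) :+ x :* x :* x :* x) := x :* x :* x :* x :+ a :* (x :* x :* x) :+
            d) ≈-refl θ A D ⟩
        quartic θ                                       ≈⟨ eval-quartic θ ⟨
        _                                               ≈⟨ fθ≈0 ⟩
        0#                                              ∎

      ηθ+PN≈0 : η * θ + P * N ≈ 0#
      ηθ+PN≈0 = x*y≈0 (begin
        P * (η * θ + P * N)                             
            ≈⟨ solve 4 (λ p η θ n → p :* (η :* θ :+ p :* n) := (p :* η) :* θ :+ n :* (p :* p)) ≈-refl P
            η θ N ⟩
        (P * η) * θ + N * (P * P)                        ≈⟨ +-congʳ (*-congʳ Pη) ⟩
        (θ * θ * θ + A * (θ * θ)) * θ + N * (P * P)     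
            ≈⟨ solve 3 (λ θ a d → (θ :* θ :* θ :+ a :* (θ :* θ)) :* θ :+ d := d :+
            (a :* (θ :* θ :* θ) :+ θ :* θ :* θ :* θ)) ≈-refl θ A _ ⟩
        N * (P * P) + (A * (θ * θ * θ) + θ * θ * θ * θ)  ≈⟨ θ-equation ⟩
        0#                                               ∎) P≉0

      -- Substitute θ = - V / η in f(θ) = 0, multiply by η⁴ and divide by d = e p². As V = p e, the
      -- coefficients stay integral. The proof avoids these divisions by multiplying the claim by θ⁴
      -- ≠ 0.
      η-equation : V * V * N + (- (A * V * N)) * η + η * η * η * η ≈ 0#
      η-equation = x*y≈0 (begin
        θ * θ * θ * θ * (V * V * N + (- (A * V * N)) * η + η * η * η * η)
          ≈⟨ solve 5 (λ η θ a v n →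
               θ :* θ :* θ :* θ :* (v :* v :* n :+ (:- (a :* v :* n)) :* η :+ η :* η :* η :* η)
               := v :* v :* n :* (θ :* θ :* θ :* θ) :- v :* n :* (η :* θ) :* (a :* (θ :* θ :* θ))
                  :+ (η :* θ) :* (η :* θ) :* ((η :* θ) :* (η :* θ))) ≈-refl η θ A V N ⟩
        V * V * N * θ⁴ - V * N * u * b + u * u * (u * u)
          ≈⟨ solve 5 (λ u p n b q →
               (p :* n) :* (p :* n) :* n :* q :- (p :* n) :* n :* u :* b :+ u :* u :* (u :* u)
               := (n :* (p :* p) :+ (b :+ q)) :* ((p :* n) :* (p :* n) :* n)
                  :+ (u :+ p :* n) :* ((u :- p :* n) :* (u :* u :+ (p :* n) :* (p :* n)) :- p :* n :* n
                      :* b)) ≈-refl u P N b θ⁴ ⟩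
        (N * (P * P) + (b + θ⁴)) * (V * V * N) + (u + V) * ((u - V) * (u * u + V * V) - V * N * b)
          ≈⟨ +-cong (*-congʳ θ-equation) (*-congʳ ηθ+PN≈0) ⟩
        0# * (V * V * N) + 0# * ((u - V) * (u * u + V * V) - V * N * b)
          ≈⟨ ≈-trans (+-cong (zeroˡ _) (zeroˡ _)) (+-identityˡ 0#) ⟩
        0# ∎) θ⁴≉0
        where
        u b θ⁴ : Carrier
        u = η * θ
        b = A * (θ * θ * θ)
        θ⁴ = θ * θ * θ * θ
        θ≉0 = root≉0 fθ≈0
        product≉0 : ∀ {x y} → x ≉ 0# → y ≉ 0# → x * y ≉ 0#
        product≉0 x≉0 y≉0 xy≈0 = y≉0 (x*y≈0 xy≈0 x≉0)
        θ⁴≉0 : θ⁴ ≉ 0#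
        θ⁴≉0 = product≉0 (product≉0 (product≉0 θ≉0 θ≉0) θ≉0) θ≉0

      η-integral : IntegralOverℤ L η
      η-integral = 4 , q , (refl , beyond) , (begin
        evalℤ L q η
          ≈⟨ evalℤ-int q η ⟩
        int c₀ + η * (int c₁ + η * (int 0ℤ + η * (int 0ℤ + η * (int 1ℤ + η * 0#))))
          ≈⟨ +-cong int-c₀ (*-congˡ (+-cong int-c₁ (*-congˡ
              (+-cong ι-0 (*-congˡ (+-cong ι-0 (*-congˡ (+-congʳ ι-1)))))))) ⟩
        V * V * N + η * (- (A * V * N) + η * (0# + η * (0# + η * (1# + η * 0#))))
          ≈⟨ solve 3 (λ u v η → u :+ η :* (v :+ η :* (con 0ℤ :+ η :*
              (con 0ℤ :+ η :* (con 1ℤ :+ η :* con 0ℤ)))) := u :+ v :* η :+ η :* η :* η :* η) ≈-refl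
              (V * V * N) (- (A * V * N)) η ⟩
        V * V * N + (- (A * V * N)) * η + η * η * η * η
          ≈⟨ η-equation ⟩
        0# ∎)
        where
        v c₀ c₁ : ℤ
        v  = + p ℤ.* e
        c₀ = v ℤ.* v ℤ.* e
        c₁ = ℤ.- (a ℤ.* v ℤ.* e)
        q : ℤ[X].Poly
        q = c₀ ∷ c₁ ∷ 0ℤ ∷ 0ℤ ∷ 1ℤ ∷ []
        beyond : ∀ m → 4 ℕ.< m → ℤ[X].coeff q m ≡ 0ℤ
        beyond (suc (suc (suc (suc (suc m))))) _ = refl
        beyond 1 (s≤s ())
        beyond 2 (s≤s (s≤s ()))
        beyond 3 (s≤s (s≤s (s≤s ())))
        beyond 4 (s≤s (s≤s (s≤s (s≤s ()))))
        int-v : int v ≈ V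
        int-v = int-* (+ p) e
        int-c₀ : int c₀ ≈ V * V * N
        int-c₀ = ≈-trans (int-* (v ℤ.* v) e) (*-congʳ (≈-trans (int-* v v) (*-cong int-v int-v)))
        int-c₁ : int c₁ ≈ - (A * V * N)
        int-c₁ = ≈-trans (int-neg (a ℤ.* v ℤ.* e)) (-‿cong (≈-trans (int-* (a ℤ.* v) e)
                 (*-congʳ (≈-trans (int-* a v) (*-congˡ int-v)))))

      -- In p η = θ³ + a θ² the coefficient of θ³ is p c₃ on the left and 1 on the right, so p
      -- divides 1.
      square-divisor-trivial : p ≡ 1
      square-divisor-trivial = conclude (spans η η∈ℚ⟨θ⟩ η-integral)
        where
        negated : ∀ c → int (ℤ.- (c ℤ.* + p)) ≈ - (int c * P)
        negated c = ≈-trans (int-neg (c ℤ.* + p)) (-‿cong (int-* c (+ p)))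
        shifted : ∀ i c → int (i ℤ.- c ℤ.* + p) ≈ int i - int c * P
        shifted i c = ≈-trans (int-+ i (ℤ.- (c ℤ.* + p))) (+-congˡ (negated c))
        conclude : ∃[ c₀ ] ∃[ c₁ ] ∃[ c₂ ] ∃[ c₃ ] η ≈ combination c₀ c₁ c₂ c₃ θ → p ≡ 1
        conclude (c₀ , c₁ , c₂ , c₃ , η≈) = ℕ∣.∣1⇒≡1 (ℤ∣.∣⇒∣ᵤ
            (ℤ∣.divides c₃ (ℤ.i-j≡0⇒i≡j 1ℤ (c₃ ℤ.* + p)
          (coefficient₃-zero (ℤ.- (c₀ ℤ.* + p)) (ℤ.- (c₁ ℤ.* + p)) (a ℤ.- c₂ ℤ.* + p)
              (1ℤ ℤ.- c₃ ℤ.* + p) (begin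
            combination (ℤ.- (c₀ ℤ.* + p)) (ℤ.- (c₁ ℤ.* + p)) (a ℤ.- c₂ ℤ.* + p) (1ℤ ℤ.- c₃ ℤ.* + p) θ
              ≈⟨ +-cong (negated c₀) (+-cong (*-congʳ (negated c₁))
                  (+-cong (*-congʳ (shifted a c₂)) (*-congʳ (≈-trans (shifted 1ℤ c₃) (+-congʳ ι-1))))) ⟩
            - (int c₀ * P) + (- (int c₁ * P) * θ + ((A - int c₂ * P) * (θ * θ) + (1# - int c₃ * P) *
                (θ * θ * θ)))
              ≈⟨ solve 7 (λ c₀ c₁ c₂ c₃ p a θ → :- (c₀ :* p) :+
                  ((:- (c₁ :* p)) :* θ :+ ((a :- c₂ :* p) :* (θ :* θ) :+ (con 1ℤ :- c₃ :* p) :*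
                  (θ :* θ :* θ)))
                   := (θ :* θ :* θ :+ a :* (θ :* θ)) :- p :*
                       (c₀ :+ (c₁ :* θ :+ (c₂ :* (θ :* θ) :+ c₃ :* (θ :* θ :* θ))))) ≈-refl (int c₀)
                       (int c₁) (int c₂) (int c₃) P A θ ⟩
            (θ * θ * θ + A * (θ * θ)) - P * combination c₀ c₁ c₂ c₃ θ
              ≈⟨ x≈y⇒x-y≈0 (≈-trans (≈-sym Pη) (*-congˡ η≈)) ⟩
            0# ∎)))))

    constant-squarefree : Arithmetic.Squarefree d
    constant-squarefree p (ℤ∣.divides e d≡) = square-divisor-trivial p e d≡

-- The splitting field under an abelian Galois group

module AbelianGaloisGroup (a d : ℤ) (a≢0 : a ≢ 0ℤ) (d≢0 : d ≢ 0ℤ) (monogenic : Monogenic (x⁴+ax³+d a d))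
  (L : Extension) (splitting : IsSplittingField L (x⁴+ax³+d a d)) where
  open Field L
  open Evaluation L
  open RootCounting L
  open Conjugates L
  open Quartic a d a≢0 d≢0 L
  open MonogenicQuartic a d a≢0 d≢0 monogenic L
  open IsSplittingField splitting
  open Automorphism using (⟦_⟧; ⟦⟧-cong; +-homo; *-homo; -‿homo; fixesℚ; ⟦⟧-injective)

  private
    irr = Monogenic.irreducible monogenic

  -- A double root x ≠ 0 of f has f′(x) = x² (4 x + 3 a) = 0, so all roots of f
  -- are - 3 a / 4, and a = 0 by their sum.
  vieta⇒distinct : ∀ {x₀ x₁ x₂ x₃} → Vieta x₀ x₁ x₂ x₃ → x₀ ≉ x₁
  -- The four numbers 4 xᵢ + 3 a, all of them zero, add up to 4 (- a) + 12 a = 8 a.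
  vieta⇒distinct {x₀} {x₁} {x₂} {x₃} v x₀≈x₁ = int≉0 a≢0 (x*y≈0 {int (+ 8)} (begin
    int (+ 8) * A
      ≈⟨ solve 5 (λ a x₀ x₁ x₂ x₃ → con (+ 8) :* a
           := (con (+ 4) :* x₀ :+ con (+ 3) :* a) :+ (con (+ 4) :* x₁ :+ con (+ 3) :* a) :+
               (con (+ 4) :* x₂ :+ con (+ 3) :* a) :+ (con (+ 4) :* x₃ :+ con (+ 3) :* a)
              :- con (+ 4) :* ((x₀ :+ x₁ :+ x₂ :+ x₃) :- (:- a))) ≈-refl A x₀ x₁ x₂ x₃ ⟩
    (ℓ x₀ + ℓ x₁ + ℓ x₂ + ℓ x₃) - int (+ 4) * ((x₀ + x₁ + x₂ + x₃) - (- A))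
      ≈⟨ +-cong (+-cong (+-cong (+-cong ℓx₀≈0 (ℓ-root v₁)) (ℓ-root v₂)) (ℓ-root v₃))
          (-‿cong (*-congˡ (x≈y⇒x-y≈0 (Vieta.e₁ v)))) ⟩
    (0# + 0# + 0# + 0#) - int (+ 4) * 0#
      ≈⟨ solve 0 ((con 0ℤ :+ con 0ℤ :+ con 0ℤ :+ con 0ℤ) :- con (+ 4) :* con 0ℤ := con 0ℤ) ≈-refl ⟩
    0# ∎) (int≉0 {+ 8} λ ()))
    where
    v₁ = rotate v
    v₂ = rotate v₁
    v₃ = rotate v₂
    ℓ : Carrier → Carrier
    ℓ x = int (+ 4) * x + int (+ 3) * A
    x₀≉0 : x₀ ≉ 0#
    x₀≉0 = root≉0 (vieta⇒root v)
    derivative : x₀ * (x₀ * ℓ x₀) ≈ 0#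
    derivative = begin
      x₀ * (x₀ * ℓ x₀)
        ≈⟨ solve 5 (λ a x₀ x₁ x₂ x₃ →
             x₀ :* (x₀ :* (con (+ 4) :* x₀ :+ con (+ 3) :* a))
             := (x₀ :- x₁) :* ((x₀ :- x₂) :* (x₀ :- x₃))
                :+ con (+ 3) :* (x₀ :* x₀) :* ((x₀ :+ x₁ :+ x₂ :+ x₃) :- (:- a))
                :- con (+ 2) :* x₀ :* (x₀ :* x₁ :+ x₀ :* x₂ :+ x₀ :* x₃ :+ x₁ :* x₂ :+ x₁ :* x₃ :+ x₂ :*
                    x₃)
                :+ (x₀ :* x₁ :* x₂ :+ x₀ :* x₁ :* x₃ :+ x₀ :* x₂ :* x₃ :+ x₁ :* x₂ :* x₃)) ≈-refl A x₀
                    x₁ x₂ x₃ ⟩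
      _ ≈⟨ +-cong (+-cong (+-cong (*-congʳ (x≈y⇒x-y≈0 x₀≈x₁)) (*-congˡ (x≈y⇒x-y≈0 (Vieta.e₁ v))))
          (-‿cong (*-congˡ (Vieta.e₂ v)))) (Vieta.e₃ v) ⟩
      0# * ((x₀ - x₂) * (x₀ - x₃)) + int (+ 3) * (x₀ * x₀) * 0# - int (+ 2) * x₀ * 0# + 0#
        ≈⟨ solve 2 (λ x y → con 0ℤ :* y :+ con (+ 3) :* (x :* x) :* con 0ℤ :- con (+ 2) :* x :* con 0ℤ
            :+ con 0ℤ := con 0ℤ) ≈-refl x₀ ((x₀ - x₂) * (x₀ - x₃)) ⟩
      0# ∎
    ℓx₀≈0 : ℓ x₀ ≈ 0#
    ℓx₀≈0 = x*y≈0 (x*y≈0 derivative x₀≉0) x₀≉0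
    -- The linear factor is written over ℚ so that its vanishing passes from x₀ to all conjugates.
    linear : List ℚ
    linear = fromℤ (+ 3 ℤ.* a) ∷ fromℤ (+ 4) ∷ []
    eval-linear : ∀ x → eval ι linear x ≈ ℓ x
    eval-linear x = ≈-trans (+-congʳ (int-* (+ 3) a)) (solve 2 (λ x a →
        con (+ 3) :* a :+ x :* (con (+ 4) :+ x :* con 0ℤ) := con (+ 4) :* x :+ con (+ 3) :* a) ≈-refl x
        A)
    ℓ-root : ∀ {y₀ y₁ y₂ y₃} → Vieta y₀ y₁ y₂ y₃ → ℓ y₀ ≈ 0#
    ℓ-root {y₀} w = ≈-trans (≈-sym (eval-linear y₀)) (same-equations F irr (vieta⇒root v) (vieta⇒root w)
        linear (≈-trans (eval-linear x₀) ℓx₀≈0))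

  vieta⇒all-distinct : ∀ {x₀ x₁ x₂ x₃} → Vieta x₀ x₁ x₂ x₃ → AllPairs _≉_ (x₀ ∷ x₁ ∷ x₂ ∷ x₃ ∷ [])
  vieta⇒all-distinct v =
    (vieta⇒distinct v ∷ vieta⇒distinct (swap v) ∷ (vieta⇒distinct v₃ ∘ ≈-sym) ∷ []) ∷
    (vieta⇒distinct v₁ ∷ vieta⇒distinct (swap v₁) ∷ []) ∷
    (vieta⇒distinct v₂ ∷ []) ∷ [] ∷ []
    where
    v₁ = rotate v
    v₂ = rotate v₁
    v₃ = rotate v₂

  private
    four = four-roots roots splits

  θ : Carrier
  θ = proj₁ four

  private
    r₁ r₂ r₃ : Carrier
    r₁ = proj₁ (proj₂ four)
    r₂ = proj₁ (proj₂ (proj₂ four))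
    r₃ = proj₁ (proj₂ (proj₂ (proj₂ four)))
    rs : List Carrier
    rs = θ ∷ r₁ ∷ r₂ ∷ r₃ ∷ []
    roots≡rs : roots ≡ rs
    roots≡rs = proj₁ (proj₂ (proj₂ (proj₂ (proj₂ four))))
    v : Vieta θ r₁ r₂ r₃
    v = proj₂ (proj₂ (proj₂ (proj₂ (proj₂ four))))

  rs! : AllPairs _≉_ rs
  rs! = vieta⇒all-distinct v

  f≈0 : All Root rs
  f≈0 = vieta⇒root v ∷ vieta⇒root (rotate v) ∷ vieta⇒root (rotate (rotate v)) ∷ vieta⇒root
      (rotate (rotate (rotate v))) ∷ []

  fθ≈0 : Root θ
  fθ≈0 = vieta⇒root v

  generated-rs : ∀ x → Generated L (λ y → Any (y ≈_) rs) x
  generated-rs = ≡.subst (λ rs → ∀ x → Generated L (λ y → Any (y ≈_) rs) x) roots≡rs generated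

  open Automorphisms.SplittingField L F rs rs! refl f≈0 generated-rs using (moves)

  Generated-bind : ∀ {S T : Carrier → Set} → (∀ {x} → S x → Generated L T x) → ∀ {x} → Generated L S x →
      Generated L T x
  Generated-bind S⊆T (base q)       = base q
  Generated-bind S⊆T (gen x∈S)      = S⊆T x∈S
  Generated-bind S⊆T (add x y)      = add (Generated-bind S⊆T x) (Generated-bind S⊆T y)
  Generated-bind S⊆T (mul x y)      = mul (Generated-bind S⊆T x) (Generated-bind S⊆T y)
  Generated-bind S⊆T (neg x)        = neg (Generated-bind S⊆T x)
  Generated-bind S⊆T (inv x xy≈1)   = inv (Generated-bind S⊆T x) xy≈1
  Generated-bind S⊆T (resp x≈y x)   = resp x≈y (Generated-bind S⊆T x)

  fixes-generated : ∀ σ {S} → (∀ {x} → S x → ⟦_⟧ {L} σ x ≈ x) → ∀ {x} → Generated L S x → ⟦ σ ⟧ x ≈ x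
  fixes-generated σ fixed (base q) = fixesℚ σ q
  fixes-generated σ fixed (gen x∈S) = fixed x∈S
  fixes-generated σ fixed (add x y) = ≈-trans (+-homo σ _ _)
      (+-cong (fixes-generated σ fixed x) (fixes-generated σ fixed y))
  fixes-generated σ fixed (mul x y) = ≈-trans (*-homo σ _ _)
      (*-cong (fixes-generated σ fixed x) (fixes-generated σ fixed y))
  fixes-generated σ fixed (neg x) = ≈-trans (-‿homo σ _) (-‿cong (fixes-generated σ fixed x))
  fixes-generated σ fixed (inv {x} {y} x∈ xy≈1) = begin
    ⟦ σ ⟧ y                   ≈⟨ ≈-trans (*-congˡ xy≈1) (*-identityʳ _) ⟨
    ⟦ σ ⟧ y * (x * y)         ≈⟨ solve 3 (λ s x y → s :* (x :* y) := (x :* s) :* y) ≈-refl (⟦ σ ⟧ y) x y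
        ⟩
    (x * ⟦ σ ⟧ y) * y         ≈⟨ *-congʳ (*-congʳ (fixes-generated σ fixed x∈)) ⟨
    (⟦ σ ⟧ x * ⟦ σ ⟧ y) * y   ≈⟨ *-congʳ (≈-trans (≈-sym (*-homo σ x y))
        (≈-trans (⟦⟧-cong σ xy≈1) (Automorphism.1#-homo σ))) ⟩
    1# * y                    ≈⟨ *-identityˡ y ⟩
    y                         ∎
  fixes-generated σ fixed (resp x≈y x) = ≈-trans (⟦⟧-cong σ (≈-sym x≈y))
      (≈-trans (fixes-generated σ fixed x) x≈y)

  σ-root : ∀ σ {x} → Root x → Root (⟦_⟧ {L} σ x)
  σ-root σ {x} fx≈0 = ≈-trans (eval-quartic (⟦ σ ⟧ x)) (≈-trans (≈-sym (begin
    ⟦ σ ⟧ (quartic x)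
      ≈⟨ ≈-trans (+-homo σ _ D) (+-cong (+-homo σ _ _) (fixesℚ σ _)) ⟩
    ⟦ σ ⟧ (x * x * x * x) + ⟦ σ ⟧ (A * (x * x * x)) + D
      ≈⟨ +-congʳ (+-cong (≈-trans (*-homo σ _ x) (*-congʳ cube))
          (≈-trans (*-homo σ A _) (*-cong (fixesℚ σ _) cube))) ⟩
    quartic (⟦ σ ⟧ x) ∎))
    (≈-trans (⟦⟧-cong σ (≈-trans (≈-sym (eval-quartic x)) fx≈0)) (Automorphism.0#-homo σ)))
    where
    cube : ⟦ σ ⟧ (x * x * x) ≈ ⟦ σ ⟧ x * ⟦ σ ⟧ x * ⟦ σ ⟧ x
    cube = ≈-trans (*-homo σ _ x) (*-congʳ (*-homo σ x x))

  module Abelian (commute : ∀ (σ τ : Automorphism L) x → ⟦ σ ⟧ (⟦ τ ⟧ x) ≈ ⟦ τ ⟧ (⟦ σ ⟧ x)) where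

    trivial-stabiliser : ∀ σ → ⟦_⟧ {L} σ θ ≈ θ → ∀ x → ⟦ σ ⟧ x ≈ x
    trivial-stabiliser σ σθ≈θ x = fixes-generated σ fixes-roots (generated-rs x)
      where
      fixes-root : ∀ {r} → Root r → ⟦ σ ⟧ r ≈ r
      fixes-root {r} fr≈0 = decidable-stable (_ ≟ _) λ σr≉r →
        transitive F irr rs rs! refl f≈0 generated-rs fθ≈0 fr≈0 λ (τ , τθ≈r) → σr≉r (begin
          ⟦ σ ⟧ r           ≈⟨ ⟦⟧-cong σ τθ≈r ⟨
          ⟦ σ ⟧ (⟦ τ ⟧ θ)   ≈⟨ commute σ τ θ ⟩
          ⟦ τ ⟧ (⟦ σ ⟧ θ)   ≈⟨ ⟦⟧-cong τ σθ≈θ ⟩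
          ⟦ τ ⟧ θ           ≈⟨ τθ≈r ⟩
          r                 ∎)
      fixes-roots : ∀ {y} → Any (y ≈_) rs → ⟦ σ ⟧ y ≈ y
      fixes-roots y∈rs = let fr≈0 , y≈r = All.lookupAny f≈0 y∈rs in
        ≈-trans (⟦⟧-cong σ y≈r) (≈-trans (fixes-root fr≈0) (≈-sym y≈r))

    ¬¬root∈ℚ⟨θ⟩ : ∀ {α} → Root α → ∀ ss → length rs ≡ suc (length ss) → AllPairs _≉_ ss → All Root ss →
        All (_≉ α) ss →
                  ¬ ¬ Generated L (_≈ θ) α
    ¬¬root∈ℚ⟨θ⟩ {α} fα≈0 ss rs-ss ss! fss≈0 ss≉α α∉ =
      moves fθ≈0 fα≈0 α∉ ss rs-ss ss! fss≈0 ss≉α λ (σ , σθ≈θ , σα≉α) →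
          σα≉α (trivial-stabiliser σ σθ≈θ α)

    ¬¬simple : ¬ ¬ (∀ x → Generated L (_≈ θ) x)
    ¬¬simple none = go rs! f≈0
      where
      go : AllPairs _≉_ rs → All Root rs → ⊥
      go ((0≉1 ∷ 0≉2 ∷ 0≉3 ∷ []) ∷ (1≉2 ∷ 1≉3 ∷ []) ∷ (2≉3 ∷ []) ∷ [] ∷ []) (f₀ ∷ f₁ ∷ f₂ ∷ f₃ ∷ []) =
        ¬¬root∈ℚ⟨θ⟩ f₁ (θ ∷ r₂ ∷ r₃ ∷ []) refl ((0≉2 ∷ 0≉3 ∷ []) ∷ (2≉3 ∷ []) ∷ [] ∷ [])
            (f₀ ∷ f₂ ∷ f₃ ∷ []) (0≉1 ∷ (1≉2 ∘ ≈-sym) ∷ (1≉3 ∘ ≈-sym) ∷ []) λ r₁∈ →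
        ¬¬root∈ℚ⟨θ⟩ f₂ (θ ∷ r₁ ∷ r₃ ∷ []) refl ((0≉1 ∷ 0≉3 ∷ []) ∷ (1≉3 ∷ []) ∷ [] ∷ [])
            (f₀ ∷ f₁ ∷ f₃ ∷ []) (0≉2 ∷ 1≉2 ∷ (2≉3 ∘ ≈-sym) ∷ []) λ r₂∈ →
        ¬¬root∈ℚ⟨θ⟩ f₃ (θ ∷ r₁ ∷ r₂ ∷ []) refl ((0≉1 ∷ 0≉2 ∷ []) ∷ (1≉2 ∷ []) ∷ [] ∷ [])
            (f₀ ∷ f₁ ∷ f₂ ∷ []) (0≉3 ∷ 1≉3 ∷ 2≉3 ∷ []) λ r₃∈ →
        let rs∈ : All (Generated L (_≈ θ)) rs
            rs∈ = gen ≈-refl ∷ r₁∈ ∷ r₂∈ ∷ r₃∈ ∷ []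
        in none λ x → Generated-bind
             (λ y∈rs → let r∈ , y≈r = All.lookupAny rs∈ y∈rs in resp (≈-sym y≈r) r∈) (generated-rs x)

    -- An element of ℤ[θ] fixed by four automorphisms moving θ differently is the
    -- constant coefficient of its expansion in powers of θ.
    fixed-integral⇒integer : (∀ x → Generated L (_≈ θ) x) → ∀ {x} → IntegralOverℤ L x →
        ∀ (σs : List (Automorphism L)) → 4 ℕ.≤ length σs →
      AllPairs _≉_ (map (λ σ → ⟦ σ ⟧ θ) σs) → All (λ σ → ⟦ σ ⟧ x ≈ x) σs → ∃[ c ] x ≈ int c
    fixed-integral⇒integer simple {x} x-integral σs 4≤σs distinct fixed =
        conclude (spans x (simple x) x-integral)
      where
      open Basis fθ≈0
      conclude : ∃[ c₀ ] ∃[ c₁ ] ∃[ c₂ ] ∃[ c₃ ] x ≈ combination c₀ c₁ c₂ c₃ θ → ∃[ c ] x ≈ int c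
      conclude (c₀ , c₁ , c₂ , c₃ , x≈) = c₀ , ≈-sym (x-y≈0⇒x≈y
          (All.head (many-roots⇒zero p (map (λ σ → ⟦ σ ⟧ θ) σs)
          (ℕ.≤-trans 4≤σs (ℕ.≤-reflexive (≡.sym (List.length-map _ σs)))) distinct
              (All.map⁺ (All.map (λ {σ} → root {σ}) fixed)))))
        where
        p : List Carrier
        p = int c₀ - x ∷ int c₁ ∷ int c₂ ∷ int c₃ ∷ []
        root : ∀ {σ} → ⟦_⟧ {L} σ x ≈ x → eval id p (⟦ σ ⟧ θ) ≈ 0#
        root {σ} σx≈x = begin
          eval id p z
            ≈⟨ solve 6 (λ c₀ c₁ c₂ c₃ x z → (c₀ :- x) :+ z :*
                (c₁ :+ z :* (c₂ :+ z :* (c₃ :+ z :* con 0ℤ)))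
                 := (c₀ :+ (c₁ :* z :+ (c₂ :* (z :* z) :+ c₃ :* (z :* z :* z)))) :- x) ≈-refl (int c₀)
                     (int c₁) (int c₂) (int c₃) x z ⟩
          combination c₀ c₁ c₂ c₃ z - x
            ≈⟨ x≈y⇒x-y≈0 (≈-trans (≈-sym σ-combination) (≈-trans (⟦⟧-cong σ (≈-sym x≈)) σx≈x)) ⟩
          0# ∎
          where
          z = ⟦ σ ⟧ θ
          σ-combination : ⟦ σ ⟧ (combination c₀ c₁ c₂ c₃ θ) ≈ combination c₀ c₁ c₂ c₃ z
          σ-combination = ≈-trans (+-homo σ _ _) (+-cong (fixesℚ σ _) (≈-trans (+-homo σ _ _) (+-cong
            (≈-trans (*-homo σ _ _) (*-congʳ (fixesℚ σ _))) (≈-trans (+-homo σ _ _) (+-cong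
              (≈-trans (*-homo σ _ _) (*-cong (fixesℚ σ _) (*-homo σ θ θ)))
              (≈-trans (*-homo σ _ _) (*-cong (fixesℚ σ _)
                  (≈-trans (*-homo σ _ θ) (*-congʳ (*-homo σ θ θ))))))))))

-- Integrality of y, w and p w, and transport along the group isomorphism

module Cases (a d : ℤ) (a≢0 : a ≢ 0ℤ) (d≢0 : d ≢ 0ℤ) (monogenic : Monogenic (x⁴+ax³+d a d))
  (L : Extension) (splitting : IsSplittingField L (x⁴+ax³+d a d)) where
  open Field L
  open Evaluation L
  open Quartic a d a≢0 d≢0 L
  open MonogenicQuartic a d a≢0 d≢0 monogenic L
  open AbelianGaloisGroup a d a≢0 d≢0 monogenic L splitting
  open Automorphism using (⟦_⟧; ⟦⟧-cong; +-homo; *-homo; -‿homo; fixesℚ; ⟦⟧-injective)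
  open Arithmetic using (V; W; no-solution)

  int-V : ∀ c → int (V d c) ≈ int c * int c - int (+ 4) * D
  int-V c = ≈-trans (int-+ (c ℤ.* c) (ℤ.- (+ 4 ℤ.* d))) (+-cong (int-* c c)
    (≈-trans (int-neg (+ 4 ℤ.* d)) (-‿cong (int-* (+ 4) d))))

  int-W : ∀ c → int (W d c) ≈ int (+ 16) * D - int (+ 3) * (int c * int c)
  int-W c = ≈-trans (int-+ (+ 16 ℤ.* d) (ℤ.- (+ 3 ℤ.* (c ℤ.* c)))) (+-cong (int-* (+ 16) d)
    (≈-trans (int-neg (+ 3 ℤ.* (c ℤ.* c))) (-‿cong (≈-trans (int-* (+ 3) (c ℤ.* c))
        (*-congˡ (int-* c c))))))

  square-integral : ∀ {x} m → x * x ≈ int m → IntegralOverℤ L x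
  square-integral {x} m xx≈m = 2 , q , (refl , beyond) , (begin
    evalℤ L q x
      ≈⟨ +-cong (int-neg m) (*-congˡ (+-cong ι-0 (*-congˡ (+-congʳ ι-1)))) ⟩
    - int m + x * (0# + x * (1# + x * 0#))
      ≈⟨ solve 2 (λ m x → :- m :+ x :* (con 0ℤ :+ x :* (con 1ℤ :+ x :* con 0ℤ)) := x :* x :- m) ≈-refl
          (int m) x ⟩
    x * x - int m
      ≈⟨ x≈y⇒x-y≈0 xx≈m ⟩
    0# ∎)
    where
    q : ℤ[X].Poly
    q = ℤ.- m ∷ 0ℤ ∷ 1ℤ ∷ []
    beyond : ∀ n → 2 ℕ.< n → ℤ[X].coeff q n ≡ 0ℤ
    beyond 1 (s≤s ())
    beyond 2 (s≤s (s≤s ()))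
    beyond (suc (suc (suc n))) _ = refl

  module Integrality {x₀ x₁ x₂ x₃} (v : Vieta x₀ x₁ x₂ x₃) where
    open Resolvent v public

    y-integral : IntegralOverℤ L y
    y-integral = 3 , q , (refl , beyond) , (begin
      evalℤ L q y
        ≈⟨ +-cong (≈-trans (int-neg (a ℤ.* a ℤ.* d)) (-‿cong
            (≈-trans (int-* (a ℤ.* a) d) (*-congʳ (int-* a a)))))
             (*-congˡ (+-cong (≈-trans (int-neg (+ 4 ℤ.* d)) (-‿cong (int-* (+ 4) d)))
                 (*-congˡ (+-cong ι-0 (*-congˡ (+-congʳ ι-1)))))) ⟩
      - (A * A * D) + y * (- (int (+ 4) * D) + y * (0# + y * (1# + y * 0#)))
        ≈⟨ solve 3 (λ k l y → :- k :+ y :* (:- l :+ y :* (con 0ℤ :+ y :* (con 1ℤ :+ y :* con 0ℤ)))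
             := (y :* y :* y :- l :* y) :- k) ≈-refl (A * A * D) (int (+ 4) * D) y ⟩
      (y * y * y - int (+ 4) * D * y) - A * A * D
        ≈⟨ x≈y⇒x-y≈0 cubic ⟩
      0# ∎)
      where
      q : ℤ[X].Poly
      q = ℤ.- (a ℤ.* a ℤ.* d) ∷ ℤ.- (+ 4 ℤ.* d) ∷ 0ℤ ∷ 1ℤ ∷ []
      beyond : ∀ n → 3 ℕ.< n → ℤ[X].coeff q n ≡ 0ℤ
      beyond 1 (s≤s ())
      beyond 2 (s≤s (s≤s ()))
      beyond 3 (s≤s (s≤s (s≤s ())))
      beyond (suc (suc (suc (suc n)))) _ = refl

    module _ (c : ℤ) (y≈c : y ≈ int c) where

      ww≈W : w * w ≈ int (W d c)
      ww≈W = ≈-trans w-square (≈-trans (+-congˡ (-‿cong (*-congˡ (*-cong y≈c y≈c)))) (≈-sym (int-W c)))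

      pp≈V : p * p ≈ int (V d c)
      pp≈V = ≈-trans p-square (≈-trans (+-congʳ (*-cong y≈c y≈c)) (≈-sym (int-V c)))

      pwpw≈VW : (p * w) * (p * w) ≈ int (V d c ℤ.* W d c)
      pwpw≈VW = begin
        (p * w) * (p * w)        ≈⟨ solve 2 (λ p w → (p :* w) :* (p :* w) := (p :* p) :* (w :* w))
            ≈-refl p w ⟩
        (p * p) * (w * w)        ≈⟨ *-cong pp≈V ww≈W ⟩
        int (V d c) * int (W d c) ≈⟨ int-* (V d c) (W d c) ⟨
        int (V d c ℤ.* W d c)     ∎

      integer-cubic : c ℤ.* c ℤ.* c ℤ.- + 4 ℤ.* d ℤ.* c ≡ a ℤ.* a ℤ.* d
      integer-cubic = int-injective (begin
        int (c ℤ.* c ℤ.* c ℤ.- + 4 ℤ.* d ℤ.* c)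
          ≈⟨ ≈-trans (int-+ (c ℤ.* c ℤ.* c) (ℤ.- (+ 4 ℤ.* d ℤ.* c))) (+-cong
               (≈-trans (int-* (c ℤ.* c) c) (*-cong (≈-trans (int-* c c)
                   (*-cong (≈-sym y≈c) (≈-sym y≈c))) (≈-sym y≈c)))
               (≈-trans (int-neg (+ 4 ℤ.* d ℤ.* c)) (-‿cong
                   (≈-trans (int-* (+ 4 ℤ.* d) c) (*-cong (int-* (+ 4) d) (≈-sym y≈c)))))) ⟩
        y * y * y - int (+ 4) * D * y
          ≈⟨ cubic ⟩
        A * A * D
          ≈⟨ ≈-trans (int-* (a ℤ.* a) d) (*-congʳ (int-* a a)) ⟨
        int (a ℤ.* a ℤ.* d) ∎)

    square-root : ∀ {x m} c → x ≈ int c → x * x ≈ int m → c ℤ.* c ≡ m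
    square-root c x≈c xx≈m = int-injective (≈-trans (int-* c c)
        (≈-trans (*-cong (≈-sym x≈c) (≈-sym x≈c)) xx≈m))

    -- The integer c comes first because w and p w are recognised as integral from their squares,
    -- which are seen to be the integers W and V W only once y = c.
    not-both-integers : ∃[ c ] y ≈ int c →
      (∀ c → y ≈ int c → (∃[ e ] w ≈ int e) ⊎ (∃[ e ] p * w ≈ int e)) → ⊥
    not-both-integers (c , y≈c) found = no-solution a d c a≢0 d≢0 (Basis.constant-squarefree fθ≈0)
        (integer-cubic c y≈c)
      (Sum.map (λ (e , w≈e) → e , square-root e w≈e (ww≈W c y≈c)) (λ (e , pw≈e) →
          e , square-root e pw≈e (pwpw≈VW c y≈c)) (found c y≈c))

  σ-difference : ∀ σ x y → ⟦_⟧ {L} σ (x - y) ≈ ⟦ σ ⟧ x - ⟦ σ ⟧ y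
  σ-difference σ x y = ≈-trans (+-homo σ x (- y)) (+-congˡ (-‿homo σ y))

  σ-sum-of-products : ∀ σ ((x , x′) (y , y′) : Carrier × Carrier) →
    ⟦_⟧ {L} σ (x * x′ + y * y′) ≈ ⟦ σ ⟧ x * ⟦ σ ⟧ x′ + ⟦ σ ⟧ y * ⟦ σ ⟧ y′
  σ-sum-of-products σ (x , x′) (y , y′) = ≈-trans (+-homo σ _ _)
      (+-cong (*-homo σ x x′) (*-homo σ y y′))

  σ-product-of-differences : ∀ σ x x′ y y′ →
    ⟦_⟧ {L} σ ((x - x′) * (y - y′)) ≈ (⟦ σ ⟧ x - ⟦ σ ⟧ x′) * (⟦ σ ⟧ y - ⟦ σ ⟧ y′)
  σ-product-of-differences σ x x′ y y′ = ≈-trans (*-homo σ _ _)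
      (*-cong (σ-difference σ x x′) (σ-difference σ y y′))

  module Identify (H : Group 0ℓ 0ℓ) (H-comm : ∀ x y → Group._≈_ H (Group._∙_ H x y) (Group._∙_ H y x)) (iso : Gal L ≅ H) where
    private
      module T = Group H
      module Γ = Group (Gal L)
    φ : Automorphism L → T.Carrier
    φ = proj₁ iso
    open GroupMorphisms.IsGroupIsomorphism (proj₂ iso)
      using (injective; surjective) renaming (∙-homo to φ-homo; ε-homo to φ-ε; ⟦⟧-cong to φ-cong)

    commute : ∀ (σ τ : Automorphism L) x → ⟦ σ ⟧ (⟦ τ ⟧ x) ≈ ⟦ τ ⟧ (⟦ σ ⟧ x)
    commute σ τ = injective {σ Γ.∙ τ} {τ Γ.∙ σ}
      (T.trans (φ-homo σ τ) (T.trans (H-comm (φ σ) (φ τ)) (T.sym (φ-homo τ σ))))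

    open Abelian commute public

    preimage : T.Carrier → Automorphism L
    preimage h = proj₁ (surjective h)

    φ-preimage : ∀ h → φ (preimage h) T.≈ h
    φ-preimage h = proj₂ (surjective h) {preimage h} λ _ → ≈-refl

    moves-θ : ∀ σ h → φ σ T.≈ h → ¬ (h T.≈ T.ε) → ⟦ σ ⟧ θ ≉ θ
    moves-θ σ h φσ≈h h≉ε σθ≈θ = h≉ε (T.trans (T.sym φσ≈h)
      (T.trans (φ-cong {σ} {Γ.ε} (trivial-stabiliser σ σθ≈θ)) φ-ε))

    identity : ∀ σ h → φ σ T.≈ h → h T.≈ T.ε → ∀ x → ⟦ σ ⟧ x ≈ x
    identity σ h φσ≈h h≈ε = injective {σ} {Γ.ε} (T.trans φσ≈h (T.trans h≈ε (T.sym φ-ε)))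

    φ-∙ : ∀ σ τ h k → φ σ T.≈ h → φ τ T.≈ k → φ (σ Γ.∙ τ) T.≈ h T.∙ k
    φ-∙ σ τ h k φσ≈h φτ≈k = T.trans (φ-homo σ τ) (T.∙-cong φσ≈h φτ≈k)

  C-comm : ∀ n i j → Group._≈_ (C n) (i ℤ.+ j) (j ℤ.+ i)
  C-comm n i j = Group.reflexive (C n) (ℤ.+-comm i j)

  C-nontrivial : ∀ n i → {{_ : ℕ.NonZero ℤ.∣ i ∣}} → ℤ.∣ i ∣ ℕ.< n → ¬ (Group._≈_ (C n) i 0ℤ)
  C-nontrivial n i i<n n∣i = ℕ.<⇒≱ i<n (ℕ∣.∣⇒≤ (ℤ∣.∣⇒∣ᵤ (≡.subst (+ n ℤ∣.∣_) (ℤ.+-identityʳ i) n∣i)))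

  C-trivial : ∀ n → Group._≈_ (C n) (+ n) 0ℤ
  C-trivial n = ℤ∣.divides 1ℤ (≡.trans (ℤ.+-identityʳ (+ n)) (≡.sym (ℤ.*-identityˡ (+ n))))

  -- The group C₂ × C₂

  module KleinFour (iso : Gal L ≅ group (C 2) (C 2)) where
    private
      V₄ = group (C 2) (C 2)
      module V₄ = Group V₄
      V₄-comm : ∀ x y → (x V₄.∙ y) V₄.≈ (y V₄.∙ x)
      V₄-comm (i , j) (k , l) = C-comm 2 i k , C-comm 2 j l
    open Identify V₄ V₄-comm iso

    g h : Automorphism L
    g = preimage (1ℤ , 0ℤ)
    h = preimage (0ℤ , 1ℤ)

    open Group (Gal L) using (_∙_; ε)

    φg : φ g V₄.≈ (1ℤ , 0ℤ)
    φg = φ-preimage (1ℤ , 0ℤ)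
    φh : φ h V₄.≈ (0ℤ , 1ℤ)
    φh = φ-preimage (0ℤ , 1ℤ)

    gg : ∀ x → ⟦ g ⟧ (⟦ g ⟧ x) ≈ x
    gg = identity (g ∙ g) (+ 2 , 0ℤ) (φ-∙ g g (1ℤ , 0ℤ) (1ℤ , 0ℤ) φg φg)
        (C-trivial 2 , Group.refl (C 2) {0ℤ})

    hh : ∀ x → ⟦ h ⟧ (⟦ h ⟧ x) ≈ x
    hh = identity (h ∙ h) (0ℤ , + 2) (φ-∙ h h (0ℤ , 1ℤ) (0ℤ , 1ℤ) φh φh)
        (Group.refl (C 2) {0ℤ} , C-trivial 2)

    -- In this numbering g exchanges the members within each of the pairs {θ, x₂}, {x₁, x₃}, and h
    -- exchanges the pairs. So g negates both factors of w, and h swaps them.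
    x₁ x₂ x₃ : Carrier
    x₁ = ⟦ h ⟧ θ
    x₂ = ⟦ g ⟧ θ
    x₃ = ⟦ g ⟧ (⟦ h ⟧ θ)

    hx₂ : ⟦ h ⟧ x₂ ≈ x₃
    hx₂ = commute h g θ

    hx₃ : ⟦ h ⟧ x₃ ≈ x₂
    hx₃ = ≈-trans (commute h g x₁) (⟦⟧-cong g (hh θ))

    x₁≉θ : x₁ ≉ θ
    x₁≉θ = moves-θ h (0ℤ , 1ℤ) φh (C-nontrivial 2 1ℤ (s≤s (s≤s z≤n)) ∘ proj₂)

    x₂≉θ : x₂ ≉ θ
    x₂≉θ = moves-θ g (1ℤ , 0ℤ) φg (C-nontrivial 2 1ℤ (s≤s (s≤s z≤n)) ∘ proj₁)

    x₃≉θ : x₃ ≉ θ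
    x₃≉θ = moves-θ (g ∙ h) (1ℤ , 1ℤ) (φ-∙ g h (1ℤ , 0ℤ) (0ℤ , 1ℤ) φg φh)
        (C-nontrivial 2 1ℤ (s≤s (s≤s z≤n)) ∘ proj₁)

    distinct : AllPairs _≉_ (θ ∷ x₁ ∷ x₂ ∷ x₃ ∷ [])
    distinct =
      ((x₁≉θ ∘ ≈-sym) ∷ (x₂≉θ ∘ ≈-sym) ∷ (x₃≉θ ∘ ≈-sym) ∷ []) ∷
      ((λ x₁≈x₂ → x₃≉θ (≈-trans (⟦⟧-cong g x₁≈x₂) (gg θ))) ∷ (λ x₁≈x₃ →
          x₂≉θ (≈-sym (⟦⟧-injective h (≈-trans x₁≈x₃ (≈-sym hx₂))))) ∷ []) ∷
      ((λ x₂≈x₃ → x₁≉θ (≈-sym (⟦⟧-injective g x₂≈x₃))) ∷ []) ∷ [] ∷ []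

    vieta : Vieta θ x₁ x₂ x₃
    vieta = distinct-roots⇒vieta distinct (fθ≈0 ∷ σ-root h fθ≈0 ∷ σ-root g fθ≈0 ∷ σ-root g
        (σ-root h fθ≈0) ∷ [])

    open Integrality vieta

    gy≈y : ⟦ g ⟧ y ≈ y
    gy≈y = begin
      ⟦ g ⟧ (θ * x₂ + x₁ * x₃)  ≈⟨ σ-sum-of-products g (θ , x₂) (x₁ , x₃) ⟩
      ⟦ g ⟧ θ * ⟦ g ⟧ x₂ + ⟦ g ⟧ x₁ * ⟦ g ⟧ x₃ ≈⟨ +-cong (*-congˡ (gg θ)) (*-congˡ (gg x₁)) ⟩
      x₂ * θ + x₃ * x₁ ≈⟨ +-cong (*-comm _ _) (*-comm _ _) ⟩
      y ∎

    gw≈w : ⟦ g ⟧ w ≈ w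
    gw≈w = begin
      ⟦ g ⟧ w ≈⟨ σ-product-of-differences g θ x₂ x₁ x₃ ⟩
      (⟦ g ⟧ θ - ⟦ g ⟧ x₂) * (⟦ g ⟧ x₁ - ⟦ g ⟧ x₃) ≈⟨ *-cong (+-congˡ (-‿cong (gg θ)))
          (+-congˡ (-‿cong (gg x₁))) ⟩
      (x₂ - θ) * (x₃ - x₁) ≈⟨ solve 4 (λ x₀ x₁ x₂ x₃ → (x₂ :- x₀) :* (x₃ :- x₁) := (x₀ :- x₂) :*
          (x₁ :- x₃)) ≈-refl θ x₁ x₂ x₃ ⟩
      w ∎

    hy≈y : ⟦ h ⟧ y ≈ y
    hy≈y = begin
      ⟦ h ⟧ (θ * x₂ + x₁ * x₃)  ≈⟨ σ-sum-of-products h (θ , x₂) (x₁ , x₃) ⟩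
      ⟦ h ⟧ θ * ⟦ h ⟧ x₂ + ⟦ h ⟧ x₁ * ⟦ h ⟧ x₃ ≈⟨ +-cong (*-congˡ hx₂) (*-cong (hh θ) hx₃) ⟩
      x₁ * x₃ + θ * x₂ ≈⟨ solve 2 (λ s t → t :+ s := s :+ t) ≈-refl (θ * x₂) (x₁ * x₃) ⟩
      y ∎

    hw≈w : ⟦ h ⟧ w ≈ w
    hw≈w = begin
      ⟦ h ⟧ w ≈⟨ σ-product-of-differences h θ x₂ x₁ x₃ ⟩
      (⟦ h ⟧ θ - ⟦ h ⟧ x₂) * (⟦ h ⟧ x₁ - ⟦ h ⟧ x₃) ≈⟨ *-cong (+-congˡ (-‿cong hx₂))
          (+-cong (hh θ) (-‿cong hx₃)) ⟩
      (x₁ - x₃) * (θ - x₂) ≈⟨ *-comm _ _ ⟩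
      w ∎

    contradictory : ⊥
    contradictory = ¬¬simple λ simple →
      let integer : ∀ {x} → IntegralOverℤ L x → ⟦ g ⟧ x ≈ x → ⟦ h ⟧ x ≈ x → ∃[ c ] x ≈ int c
          integer x-integral gx≈x hx≈x = fixed-integral⇒integer simple x-integral
              (ε ∷ h ∷ g ∷ (g ∙ h) ∷ []) ℕ.≤-refl distinct
            (≈-refl ∷ hx≈x ∷ gx≈x ∷ ≈-trans (⟦⟧-cong g hx≈x) gx≈x ∷ [])
      in not-both-integers (integer y-integral gy≈y hy≈y)
           λ c y≈c → inj₁ (integer (square-integral (W d c) (ww≈W c y≈c)) gw≈w hw≈w)

  -- The group C₄

  module CyclicFour (iso : Gal L ≅ C 4) where
    open Identify (C 4) (C-comm 4) iso
    open Group (Gal L) using (_∙_; ε)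

    g : Automorphism L
    g = preimage 1ℤ

    private
      g² g³ : Automorphism L
      g² = g ∙ g
      g³ = g ∙ g²
      module C₄ = Group (C 4)
      φg : φ g C₄.≈ 1ℤ
      φg = φ-preimage 1ℤ
      φg² : φ g² C₄.≈ + 2
      φg² = φ-∙ g g 1ℤ 1ℤ φg φg
      φg³ : φ g³ C₄.≈ + 3
      φg³ = φ-∙ g g² 1ℤ (+ 2) φg φg²

    x₁ x₂ x₃ : Carrier
    x₁ = ⟦ g ⟧ θ
    x₂ = ⟦ g ⟧ x₁
    x₃ = ⟦ g ⟧ x₂

    gx₃ : ⟦ g ⟧ x₃ ≈ θ
    gx₃ = identity (g ∙ g³) (+ 4) (φ-∙ g g³ 1ℤ (+ 3) φg φg³) (C-trivial 4) θ

    x₁≉θ : x₁ ≉ θ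
    x₁≉θ = moves-θ g 1ℤ φg (C-nontrivial 4 1ℤ (ℕ.m≤m+n 2 2))

    x₂≉θ : x₂ ≉ θ
    x₂≉θ = moves-θ g² (+ 2) φg² (C-nontrivial 4 (+ 2) (ℕ.m≤m+n 3 1))

    x₃≉θ : x₃ ≉ θ
    x₃≉θ = moves-θ g³ (+ 3) φg³ (C-nontrivial 4 (+ 3) ℕ.≤-refl)

    distinct : AllPairs _≉_ (θ ∷ x₁ ∷ x₂ ∷ x₃ ∷ [])
    distinct =
      ((x₁≉θ ∘ ≈-sym) ∷ (x₂≉θ ∘ ≈-sym) ∷ (x₃≉θ ∘ ≈-sym) ∷ []) ∷
      ((x₁≉θ ∘ ≈-sym ∘ ⟦⟧-injective g) ∷ (x₂≉θ ∘ ≈-sym ∘ ⟦⟧-injective g) ∷ []) ∷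
      ((x₁≉θ ∘ ≈-sym ∘ ⟦⟧-injective g ∘ ⟦⟧-injective g) ∷ []) ∷ [] ∷ []

    vieta : Vieta θ x₁ x₂ x₃
    vieta = distinct-roots⇒vieta distinct
      (fθ≈0 ∷ σ-root g fθ≈0 ∷ σ-root g (σ-root g fθ≈0) ∷ σ-root g (σ-root g (σ-root g fθ≈0)) ∷ [])

    open Integrality vieta

    gy≈y : ⟦ g ⟧ y ≈ y
    gy≈y = begin
      ⟦ g ⟧ (θ * x₂ + x₁ * x₃)  ≈⟨ σ-sum-of-products g (θ , x₂) (x₁ , x₃) ⟩
      x₁ * x₃ + x₂ * ⟦ g ⟧ x₃ ≈⟨ +-congˡ (*-congˡ gx₃) ⟩
      x₁ * x₃ + x₂ * θ ≈⟨ solve 4 (λ x₀ x₁ x₂ x₃ → x₁ :* x₃ :+ x₂ :* x₀ := x₀ :* x₂ :+ x₁ :* x₃) ≈-refl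
          θ x₁ x₂ x₃ ⟩
      y ∎

    -- The generator takes θ - x₂ to x₁ - x₃, and this to x₂ - θ, so it negates w. It also swaps the
    -- two terms of p, and the signs cancel in the product.
    g-pw≈pw : ⟦ g ⟧ (p * w) ≈ p * w
    g-pw≈pw = begin
      ⟦ g ⟧ (p * w) ≈⟨ *-homo g p w ⟩
      ⟦ g ⟧ p * ⟦ g ⟧ w ≈⟨ *-cong gp (σ-product-of-differences g θ x₂ x₁ x₃) ⟩
      (x₁ * x₃ - x₂ * ⟦ g ⟧ x₃) * ((x₁ - x₃) * (x₂ - ⟦ g ⟧ x₃))
        ≈⟨ *-cong (+-congˡ (-‿cong (*-congˡ gx₃))) (*-congˡ (+-congˡ (-‿cong gx₃))) ⟩
      (x₁ * x₃ - x₂ * θ) * ((x₁ - x₃) * (x₂ - θ))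
        ≈⟨ solve 4 (λ x₀ x₁ x₂ x₃ → (x₁ :* x₃ :- x₂ :* x₀) :* ((x₁ :- x₃) :* (x₂ :- x₀))
             := (x₀ :* x₂ :- x₁ :* x₃) :* ((x₀ :- x₂) :* (x₁ :- x₃))) ≈-refl θ x₁ x₂ x₃ ⟩
      p * w ∎
      where
      gp : ⟦ g ⟧ p ≈ x₁ * x₃ - x₂ * ⟦ g ⟧ x₃
      gp = ≈-trans (σ-difference g _ _) (+-cong (*-homo g θ x₂) (-‿cong (*-homo g x₁ x₃)))

    contradictory : ⊥
    contradictory = ¬¬simple λ simple →
      let integer : ∀ {x} → IntegralOverℤ L x → ⟦ g ⟧ x ≈ x → ∃[ c ] x ≈ int c
          integer x-integral gx≈x = fixed-integral⇒integer simple x-integral (ε ∷ g ∷ g² ∷ g³ ∷ [])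
              ℕ.≤-refl distinct
            (≈-refl ∷ gx≈x ∷ ≈-trans (⟦⟧-cong g gx≈x) gx≈x ∷ ≈-trans
                (⟦⟧-cong g (≈-trans (⟦⟧-cong g gx≈x) gx≈x)) gx≈x ∷ [])
      in not-both-integers (integer y-integral gy≈y)
           λ c y≈c → inj₂ (integer (square-integral (V d c ℤ.* W d c) (pwpw≈VW c y≈c)) g-pw≈pw)

open import Data.Integer using (_*_)

corollary1p2 : (a d : ℤ) → a * d ≢ 0ℤ →
    Monogenic (x⁴+ax³+d a d) →
    (L : Extension) → IsSplittingField L (x⁴+ax³+d a d) →
    ¬ (Gal L ≅ group (C 2) (C 2)) × ¬ (Gal L ≅ C 4)
corollary1p2 a d ad≢0 monogenic L splitting = KleinFour.contradictory , CyclicFour.contradictory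
  where
  a≢0 : a ≢ 0ℤ
  a≢0 refl = ad≢0 refl
  d≢0 : d ≢ 0ℤ
  d≢0 refl = ad≢0 (ℤ.*-zeroʳ a)
  open Cases a d a≢0 d≢0 monogenic L splitting
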